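{- For every skew shape $\lambda/\mu$ with $n=|\lambda/\mu|$ cells, $$F(\lambda/\mu)\ \le\ e(\lambda/\mu)\ \le\ \xi(\lambda/\mu)\,F(\lambda/\mu),\qquad\text{where}\qquad F(\lambda/\mu)=n!\prod_{u\in\lambda/\mu}\frac{1}{h(u)}.$$
   Context: $e(\lambda/\mu)$ is the number of standard Young tableaux of skew shape $\lambda/\mu$. For a cell $u=(i,j)$ (row $i$, column $j$) of the partition $\lambda$, $h(u)=\lambda_i-i+\lambda'_j-j+1$ is the usual hook-length of $u$ in $\lambda$ (where $\lambda'$ is the conjugate partition); the product is over cells of $\lambda$ not in $\mu$. Excited diagrams: let $D$ be a subset of the Young diagram of $\lambda$. A cell $(i,j)\in D$ is active if $(i+1,j)$, $(i,j+1)$ and $(i+1,j+1)$ are all in $\lambda\setminus D$. An excited move replaces an active cell $(i,j)$ of $D$ by $(i+1,j+1)$. An excited diagram of $\lambda/\mu$ is a subset of cells of $\lambda$ obtained from the Young diagram of $\mu$ by a (possibly empty) sequence of excited moves. $\xi(\lambda/\mu)$ denotes the number of excited diagrams of $\lambda/\mu$. -}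

module Defs where

open import Data.Bool using (if_then_else_)
open import Data.Bool.Properties using () renaming (_≟_ to _≟ᵇ_)
open import Data.Fin using (Fin; zero; suc) renaming (_<_ to _<ᶠ_)
open import Data.Fin.Properties using (all?; any?) renaming (_≟_ to _≟ᶠ_; _<?_ to _<ᶠ?_)
open import Data.Fin.Subset using (Subset; inside; outside; _∈_; _∉_)
open import Data.Fin.Subset.Properties using (_∈?_; anySubset?)
import Data.Integer as ℤ
open import Data.List using (List; []; _∷_; length; lookup; map; concatMap; filter; upTo; allFin; foldr; cartesianProductWith)
open import Data.List.Membership.Propositional.Properties using (∈-map⁻; ∈-lookup)
open import Data.List.Relation.Binary.Disjoint.Propositional using (Disjoint)
open import Data.List.Relation.Unary.All as All using (All)
import Data.List.Relation.Unary.All.Properties as AllP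
open import Data.List.Relation.Unary.AllPairs as AllPairs using (_∷_)
import Data.List.Relation.Unary.AllPairs.Properties as AllPairsP
open import Data.List.Relation.Unary.Linked using (Linked)
open import Data.List.Relation.Unary.Unique.Propositional using (Unique)
open import Data.List.Relation.Unary.Unique.Propositional.Properties using (map⁺; concat⁺; upTo⁺)
open import Data.Nat using (ℕ; zero; suc; _+_; _∸_; _≤_; _≥_; _<_; _!)
open import Data.Nat.Properties using (_≟_; _<?_; suc-injective; +-assoc; +-comm; +-suc)
open import Data.Product using (_×_; _,_; ∃-syntax; proj₁; proj₂)
open import Data.Product.Properties using (≡-dec)
open import Data.Rational using (ℚ; 1ℚ; _/_) renaming (_*_ to _*ℚ_)
open import Data.Sum using (_⊎_; inj₁; inj₂; [_,_]′)
open import Data.Vec using (Vec; []; _∷_; tabulate; _[_]≔_) renaming (lookup to _‼_)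
open import Data.Vec.Properties using ([]=⇒lookup; lookup⇒[]=; lookup∘update′) renaming (≡-dec to ≡-decᵛ)
open import Function using (_∘_)
open import Function.Definitions using (Bijective)
open import Function.Consequences.Propositional using (strictlySurjective⇒surjective; surjective⇒strictlySurjective)
open import Relation.Binary.Construct.Closure.ReflexiveTransitive using (Star; ε; _◅_; _◅◅_)
open import Relation.Binary.PropositionalEquality using (_≡_; _≢_; refl; sym; trans; cong; subst; module ≡-Reasoning)
open import Relation.Nullary using (Dec; yes; no; does; contradiction)
open import Relation.Nullary.Decidable using (_×-dec_; _⊎-dec_; _→-dec_; ¬?; map′)

-- Rows and columns are numbered from 0 throughout, so that row i and column j
-- here are row i + 1 and column j + 1 in the usual matrix convention.

record Partition : Set where
  field
    parts      : List ℕ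
    decreasing : Linked _≥_ parts
    positive   : All (0 <_) parts

open Partition public

part : List ℕ → ℕ → ℕ
part []       _       = 0
part (x ∷ xs) zero    = x
part (x ∷ xs) (suc i) = part xs i

row : Partition → ℕ → ℕ
row ν = part (parts ν)

-- The part λ'ⱼ of the conjugate partition, as the number of rows reaching column j.
col : Partition → ℕ → ℕ
col ν j = length (filter (j <?_) (parts ν))

Cell : Set
Cell = ℕ × ℕ

_∈ᶜ_ : Cell → Partition → Set
(i , j) ∈ᶜ ν = j < row ν i

_∈ᶜ?_ : ∀ u ν → Dec (u ∈ᶜ ν)
(i , j) ∈ᶜ? ν = j <? row ν i

cells : Partition → List Cell
cells ν = concatMap (λ i → map (i ,_) (upTo (row ν i))) (upTo (length (parts ν)))

-- With i and j numbered from 0, λᵢ - i + λ'ⱼ - j + 1 becomes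
-- (λᵢ - (j + 1)) + (λ'ⱼ - (i + 1)) + 1; on cells of ν no subtraction truncates.
hook : Partition → Cell → ℕ
hook ν (i , j) = suc ((row ν i ∸ suc j) + (col ν j ∸ suc i))

record SkewShape : Set where
  field
    outer     : Partition
    inner     : Partition
    contained : ∀ i → row inner i ≤ row outer i

open SkewShape public

skewCells : SkewShape → List Cell
skewCells S = filter (λ u → ¬? (u ∈ᶜ? inner S)) (cells (outer S))

size : SkewShape → ℕ
size S = length (skewCells S)

allVecs : {A : Set} → List A → ∀ n → List (Vec A n)
allVecs xs zero    = [] ∷ []
allVecs xs (suc n) = cartesianProductWith _∷_ xs (allVecs xs n)

fillings : ∀ n → List (Vec (Fin n) n)
fillings n = allVecs (allFin n) n

subsets : ∀ n → List (Subset n)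
subsets = allVecs (inside ∷ outside ∷ [])

-- T ‼ p is the entry in the p-th cell of skewCells S, the entries 1, …, n
-- being represented by the elements of Fin n.
record IsSYT (S : SkewShape) (T : Vec (Fin (size S)) (size S)) : Set where
  field
    bijective : Bijective _≡_ _≡_ (T ‼_)
    rows      : ∀ p q → let (i , j) = lookup (skewCells S) p ; (i′ , j′) = lookup (skewCells S) q in
                i ≡ i′ × j < j′ → T ‼ p <ᶠ T ‼ q
    columns   : ∀ p q → let (i , j) = lookup (skewCells S) p ; (i′ , j′) = lookup (skewCells S) q in
                j ≡ j′ × i < i′ → T ‼ p <ᶠ T ‼ q

bijective? : ∀ {m n} (f : Fin m → Fin n) → Dec (Bijective _≡_ _≡_ f)
bijective? f =
  map′ (λ (i , s) → (λ {x} {y} → i x y) , strictlySurjective⇒surjective s)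
       (λ (i , s) → (λ x y → i {x} {y}) , surjective⇒strictlySurjective s)
       (all? (λ x → all? λ y → (f x ≟ᶠ f y) →-dec (x ≟ᶠ y))
         ×-dec all? (λ y → any? λ x → f x ≟ᶠ y))

isSYT? : ∀ S T → Dec (IsSYT S T)
isSYT? S T =
  map′ (λ (b , r , c) → record { bijective = b ; rows = r ; columns = c })
       (λ t → IsSYT.bijective t , IsSYT.rows t , IsSYT.columns t)
       (bijective? (T ‼_)
         ×-dec all? (λ p → all? λ q →
           ((proj₁ (at p) ≟ proj₁ (at q)) ×-dec (proj₂ (at p) <? proj₂ (at q))) →-dec (T ‼ p <ᶠ? T ‼ q))
         ×-dec all? (λ p → all? λ q →
           ((proj₂ (at p) ≟ proj₂ (at q)) ×-dec (proj₁ (at p) <? proj₁ (at q))) →-dec (T ‼ p <ᶠ? T ‼ q)))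
  where
  at : Fin (size S) → Cell
  at = lookup (skewCells S)

e : SkewShape → ℕ
e S = length (filter (isSYT? S) (fillings (size S)))

-- A set of cells of ν, as a set of positions in the list cells ν.
Diagram : Partition → Set
Diagram ν = Subset (length (cells ν))

cellAt : (ν : Partition) → Fin (length (cells ν)) → Cell
cellAt ν = lookup (cells ν)

module _ (ν : Partition) where

  Vacant : Diagram ν → Cell → Set
  Vacant D u = ∃[ q ] cellAt ν q ≡ u × q ∉ D

  Active : Diagram ν → Fin (length (cells ν)) → Set
  Active D p = p ∈ D × Vacant D (suc i , j) × Vacant D (i , suc j) × Vacant D (suc i , suc j)
    where
    i = proj₁ (cellAt ν p)
    j = proj₂ (cellAt ν p)

  ExcitedMove : Diagram ν → Diagram ν → Set
  ExcitedMove D D′ = ∃[ p ] ∃[ q ]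
    Active D p
    × cellAt ν q ≡ (suc (proj₁ (cellAt ν p)) , suc (proj₂ (cellAt ν p)))
    × D′ ≡ (D [ p ]≔ outside) [ q ]≔ inside

innerDiagram : (S : SkewShape) → Diagram (outer S)
innerDiagram S = tabulate λ p → does (cellAt (outer S) p ∈ᶜ? inner S)

IsExcited : (S : SkewShape) → Diagram (outer S) → Set
IsExcited S = Star (ExcitedMove (outer S)) (innerDiagram S)

-- Being excited is decidable: a move increases the sum of the row indices of
-- the cells of a diagram by exactly one, so searching backwards terminates.

weight : ∀ {n} → (Fin n → ℕ) → Subset n → ℕ
weight w []      = 0
weight w (b ∷ D) = (if b then w zero else 0) + weight (w ∘ suc) D

weight-remove : ∀ {n} (w : Fin n → ℕ) (D : Subset n) p → D ‼ p ≡ inside →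
                weight w D ≡ weight w (D [ p ]≔ outside) + w p
weight-remove w (_ ∷ D) zero    refl = +-comm (w zero) _
weight-remove w (b ∷ D) (suc p) p∈D  =
  trans (cong ((if b then w zero else 0) +_) (weight-remove (w ∘ suc) D p p∈D)) (sym (+-assoc (if b then w zero else 0) _ _))

weight-insert : ∀ {n} (w : Fin n → ℕ) (D : Subset n) p → D ‼ p ≡ outside →
                weight w (D [ p ]≔ inside) ≡ weight w D + w p
weight-insert w (_ ∷ D) zero    refl = +-comm (w zero) _
weight-insert w (b ∷ D) (suc p) p∉D  =
  trans (cong ((if b then w zero else 0) +_) (weight-insert (w ∘ suc) D p p∉D)) (sym (+-assoc (if b then w zero else 0) _ _))

∉⇒outside : ∀ {n} (D : Subset n) p → p ∉ D → D ‼ p ≡ outside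
∉⇒outside D p p∉D with D ‼ p in eq
... | outside = refl
... | inside  = contradiction (lookup⇒[]= p D eq) p∉D

disjointRows : (f : ℕ → ℕ) {i i′ : ℕ} → i ≢ i′ →
               Disjoint (map (i ,_) (upTo (f i))) (map (i′ ,_) (upTo (f i′)))
disjointRows f i≢i′ (u∈ , u∈′) with ∈-map⁻ _ u∈ | ∈-map⁻ _ u∈′
... | _ , _ , refl | _ , _ , refl = i≢i′ refl

lookup-injective : {A : Set} {xs : List A} → Unique xs → ∀ p q → lookup xs p ≡ lookup xs q → p ≡ q
lookup-injective (_ ∷ _)  zero    zero    _  = refl
lookup-injective (x∉ ∷ _) zero    (suc q) eq = contradiction eq (All.lookup x∉ (∈-lookup q))
lookup-injective (x∉ ∷ _) (suc p) zero    eq = contradiction (sym eq) (All.lookup x∉ (∈-lookup p))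
lookup-injective (_ ∷ u)  (suc p) (suc q) eq = cong suc (lookup-injective u p q eq)

cells-unique : ∀ ν → Unique (cells ν)
cells-unique ν = concat⁺
  (AllP.map⁺ (All.universal (λ i → map⁺ (cong proj₂) (upTo⁺ (row ν i))) indices))
  (AllPairsP.map⁺ {f = λ i → map (i ,_) (upTo (row ν i))}
    (AllPairs.map (disjointRows (row ν)) (upTo⁺ (length (parts ν)))))
  where
  indices : List ℕ
  indices = upTo (length (parts ν))

unsnoc : {A : Set} {R : A → A → Set} {x y : A} → Star R x y → x ≡ y ⊎ ∃[ z ] R z y × Star R x z
unsnoc ε        = inj₁ refl
unsnoc (r ◅ rs) with unsnoc rs
... | inj₁ refl          = inj₂ (_ , r , ε)
... | inj₂ (_ , r′ , rs′) = inj₂ (_ , r′ , r ◅ rs′)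

module _ (ν : Partition) where

  rowSum : Diagram ν → ℕ
  rowSum = weight (proj₁ ∘ cellAt ν)

  _≟ᶜ_ : (u v : Cell) → Dec (u ≡ v)
  _≟ᶜ_ = ≡-dec _≟_ _≟_

  _≟ᵈ_ : (D D′ : Diagram ν) → Dec (D ≡ D′)
  _≟ᵈ_ = ≡-decᵛ _≟ᵇ_

  vacant? : ∀ D u → Dec (Vacant ν D u)
  vacant? D u = any? λ q → (cellAt ν q ≟ᶜ u) ×-dec ¬? (q ∈? D)

  active? : ∀ D p → Dec (Active ν D p)
  active? D p = (p ∈? D) ×-dec vacant? D _ ×-dec vacant? D _ ×-dec vacant? D _

  excitedMove? : ∀ D D′ → Dec (ExcitedMove ν D D′)
  excitedMove? D D′ = any? λ p → any? λ q → active? D p ×-dec (cellAt ν q ≟ᶜ _) ×-dec (D′ ≟ᵈ _)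

  cellAt-injective : ∀ {p q} → cellAt ν p ≡ cellAt ν q → p ≡ q
  cellAt-injective = lookup-injective (cells-unique ν) _ _

  rowSum-move : ∀ {D D′} → ExcitedMove ν D D′ → rowSum D′ ≡ suc (rowSum D)
  rowSum-move {D} (p , q , (p∈D , _ , _ , r , r-at , r∉D) , q-at , refl) = begin
    rowSum (D₀ [ q ]≔ inside)         ≡⟨ weight-insert _ D₀ q q∉D₀ ⟩
    rowSum D₀ + proj₁ (cellAt ν q)          ≡⟨ cong (λ u → rowSum D₀ + proj₁ u) q-at ⟩
    rowSum D₀ + suc (proj₁ (cellAt ν p))    ≡⟨ +-suc _ _ ⟩
    suc (rowSum D₀ + proj₁ (cellAt ν p))    ≡⟨ cong suc (weight-remove _ D p ([]=⇒lookup p∈D)) ⟨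
    suc (rowSum D)                    ∎
    where
    open ≡-Reasoning
    D₀ : Diagram ν
    D₀ = D [ p ]≔ outside
    q∉D : q ∉ D
    q∉D = subst (_∉ D) (cellAt-injective (trans r-at (sym q-at))) r∉D
    q≢p : q ≢ p
    q≢p refl = q∉D p∈D
    q∉D₀ : D₀ ‼ q ≡ outside
    q∉D₀ = trans (lookup∘update′ q≢p D outside) (∉⇒outside D q q∉D)

  reachable? : ∀ D₁ D₂ → Dec (Star (ExcitedMove ν) D₁ D₂)
  reachable? D₁ D₂ = go (rowSum D₂) D₂ refl
    where
    predecessor? : ∀ k D → rowSum D ≡ k → Dec (∃[ D′ ] ExcitedMove ν D′ D × Star (ExcitedMove ν) D₁ D′)

    go : ∀ k D → rowSum D ≡ k → Dec (Star (ExcitedMove ν) D₁ D)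
    go k D eq = map′ [ (λ { refl → ε }) , (λ (_ , m , ms) → ms ◅◅ (m ◅ ε)) ]′ unsnoc
                     ((D₁ ≟ᵈ D) ⊎-dec predecessor? k D eq)

    predecessor? zero    D eq = no λ (_ , m , _) → contradiction (trans (sym (rowSum-move m)) eq) λ ()
    predecessor? (suc k) D eq = anySubset? step?
      where
      step? : ∀ D′ → Dec (ExcitedMove ν D′ D × Star (ExcitedMove ν) D₁ D′)
      step? D′ with excitedMove? D′ D
      ... | no ¬m = no (¬m ∘ proj₁)
      ... | yes m = map′ (m ,_) proj₂ (go k D′ (suc-injective (trans (sym (rowSum-move m)) eq)))

isExcited? : ∀ S D → Dec (IsExcited S D)
isExcited? S = reachable? (outer S) (innerDiagram S)

ξ : SkewShape → ℕ
ξ S = length (filter (isExcited? S) (subsets (length (cells (outer S)))))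

fromℕ : ℕ → ℚ
fromℕ n = ℤ.+ n / 1

F : SkewShape → ℚ
F S = fromℕ (size S !) *ℚ foldr _*ℚ_ 1ℚ (map (λ u → ℤ.+ 1 / hook (outer S) u) (skewCells S))

{-# OPTIONS --safe #-}

-- Both bounds follow from Naruse's formula, which expresses e(λ/μ) ∏ h(u), over the cells u of λ,
-- as n! times the sum of ∏ h(u), u ∈ D, over the excited diagrams D: the diagram of μ is one of
-- the terms, and moving a cell down its diagonal does not increase its hook.
--
-- For the formula, encode a partition with r rows by its beta numbers νᵢ + (r - 1 - i). Read the
-- cells of λ row by row; a cell on the k-th diagonal offers, with its hook as weight, the move of
-- a beta number from k to k + 1. The moves that turn the empty partition into μ form an excited
-- diagram. Let W(μ) be the total weight of all these subwords. The operators raising and lowering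
-- beta numbers satisfy a commutation relation in which the hooks are differences of a potential
-- that is permuted along the word, and this yields n W(μ) = Σ W(μ⁺), the sum over the partitions
-- μ⁺ covering μ. Standard tableaux obey the same recursion, by the position of their entry 1.

module Submission where

open import Data.Bool using (Bool; true; false; if_then_else_)
open import Data.Fin using (Fin; zero; suc; toℕ; fromℕ<; punchIn; punchOut; cast) renaming (_<_ to _<ᶠ_)
open import Data.Fin.Properties using (all?; any?; toℕ-injective; toℕ<n; toℕ-fromℕ<; punchIn-injective; punchInᵢ≢i; punchIn-punchOut; cast-is-id) renaming (_≟_ to _≟ᶠ_; _<?_ to _<ᶠ?_; suc-injective to suc-injectiveᶠ)
open import Data.Fin.Subset using (Subset; inside; outside)
open import Data.List as List using (List; []; _∷_; _++_; map; length; foldr; filter; concatMap; applyUpTo; upTo; allFin)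
open import Data.List.Membership.Propositional using (_∈_; _∉_; find; lose)
open import Data.List.Membership.Propositional.Properties using (∈-filter⁺; ∈-filter⁻; ∈-map⁺; ∈-map⁻; ∈-concatMap⁺; ∈-concatMap⁻; ∈-allFin; ∈-upTo⁺; ∈-upTo⁻; ∈-cartesianProductWith⁺; ∈-lookup)
open import Data.List.Membership.Propositional.Properties.WithK using (unique∧set⇒bag)
open import Data.List.Properties using (length-map; length-++; ++-identityʳ; map-++; map-cong; map-cong-local; map-∘; map-applyUpTo; tabulate-lookup; length-tabulate; lookup-tabulate; filter-++; filter-≐; filter-all; filter-none; filter-accept; filter-reject)
open import Data.List.Relation.Binary.BagAndSetEquality using (∼bag⇒↭)
open import Data.List.Relation.Binary.Disjoint.Propositional using (Disjoint)
open import Data.List.Relation.Binary.Permutation.Propositional using (_↭_)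
open import Data.List.Relation.Binary.Permutation.Propositional.Properties using (↭-length) renaming (map⁺ to ↭-map⁺)
open import Data.List.Relation.Unary.All as All using (All; []; _∷_)
import Data.List.Relation.Unary.All.Properties as AllP
open import Data.List.Relation.Unary.AllPairs as AllPairs using (AllPairs; []; _∷_)
import Data.List.Relation.Unary.AllPairs.Properties as AllPairsP
open import Data.List.Relation.Unary.Any using (here; there; index)
open import Data.List.Relation.Unary.Any.Properties using (lookup-index)
open import Data.List.Relation.Unary.Linked as Linked using (Linked)
open import Data.List.Relation.Unary.Linked.Properties using (Linked⇒AllPairs)
open import Data.List.Relation.Unary.Unique.Propositional using (Unique)
open import Data.List.Relation.Unary.Unique.Propositional.Properties using (map⁺; concat⁺; filter⁺; allFin⁺; cartesianProductWith⁺)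
open import Data.Nat as ℕ using (ℕ; zero; suc; pred)
open import Data.Nat.ListAction using (product) renaming (sum to sumˡ)
open import Data.Nat.ListAction.Properties using (sum-↭)
open import Data.Nat.Tactic.RingSolver using (solve-∀)
open import Data.Product using (_×_; _,_; proj₁; proj₂; ∃-syntax)
open import Data.Product.Properties using (≡-dec)
open import Data.Sum using (_⊎_; inj₁; inj₂; [_,_]′)
open import Data.Unit using (⊤; tt)
open import Data.Vec as Vec using (Vec; []; _∷_; lookup; tabulate; updateAt; insertAt; _[_]≔_)
open import Data.Vec using () renaming (lookup to _‼_)
open import Data.Vec.Properties using ([]=⇒lookup; lookup⇒[]=; lookup∘update; lookup∘update′; lookup∘updateAt; lookup∘updateAt′; updateAt-updateAt; updateAt-id; updateAt-id-local; updateAt-commutes; lookup∘tabulate; tabulate∘lookup; tabulate-cong; insertAt-lookup; insertAt-punchIn; lookup-map; ∷-injective) renaming (≡-dec to ≡-decᵛ)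
open import Defs
open import Function using (_∘_; id; mk⇔)
open import Function.Consequences.Propositional using (strictlySurjective⇒surjective)
open import Function.Definitions using (Bijective; Injective)
open import Relation.Binary using (tri<; tri≈; tri>)
open import Relation.Binary.Construct.Closure.ReflexiveTransitive using (Star; ε; _◅_; _◅◅_)
open import Relation.Binary.PropositionalEquality using (_≡_; _≢_; refl; sym; trans; cong; cong₂; subst; subst₂; module ≡-Reasoning)
open import Relation.Nullary using (Dec; yes; no; does; ¬_; contradiction)
open import Relation.Nullary.Decidable using (_×-dec_; _⊎-dec_; _→-dec_; ¬?; dec-true; dec-false; does-⇔)
open import Relation.Unary using (Decidable)

-- `W` is a specialised form of the Andersen-Jantzen-Soergel-Billey formula for the restriction of a
-- Schubert class of a Grassmannian to a fixed point, and `chevalley` is the equivariant Chevalley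
-- formula. Its induction on the word forces it to be stated for every compatible word and every
-- start state. At the empty partition it simplifies: no beta number can be lowered there, and the
-- two totals that remain differ by |λ/μ|. The hooks enter because the word of λ permutes places so
-- that beta numbers of the empty partition go to those of λ and gaps go to gaps, while a hook is
-- the beta number of its row minus the gap of its column. The recursion ends at μ = λ, where only
-- the full word contributes, with the product of all hooks. Excited diagrams are never classified.
-- The lower bound uses a single subword, the one formed by the cells of μ; the upper bound uses
-- only that distinct subwords give distinct excited diagrams. Both bounds carry the factor ∏ h(u),
-- u ∈ μ, which is cancelled at the end. Everything stays in ℕ, so negative terms are moved across
-- equations.

module NaruseFormula where

  open import Data.Nat using (_+_; _*_; _∸_; _^_; _≤_; _<_; _≥_; _!; z≤n; s≤s; z<s; s<s; s<s⁻¹; NonZero; >-nonZero)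
  open import Data.Nat.Properties
  open import Algebra.Properties.Semiring.Sum +-*-semiring using () renaming (sum to sumᵛ; sum-cong-≗ to sumᵛ-cong; ∑-distrib-+ to sumᵛ-distrib-+; ∑-comm to sumᵛ-comm; *-distribˡ-sum to *-distribˡ-sumᵛ; *-distribʳ-sum to *-distribʳ-sumᵛ)

  -- Raising and lowering beta numbers

  *-left-comm : ∀ a b c → a * (b * c) ≡ b * (a * c)
  *-left-comm = solve-∀

  *-expand : ∀ a x y c → a * (x + c * y) ≡ a * x + c * (a * y)
  *-expand = solve-∀

  ⟦_⟧ : {P : Set} → Dec P → ℕ
  ⟦ d ⟧ = if does d then 1 else 0

  ⟦⟧-yes : {P : Set} (d : Dec P) → P → ⟦ d ⟧ ≡ 1
  ⟦⟧-yes d p rewrite dec-true d p = refl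

  ⟦⟧-no : {P : Set} (d : Dec P) → ¬ P → ⟦ d ⟧ ≡ 0
  ⟦⟧-no d ¬p rewrite dec-false d ¬p = refl

  ⟦⟧-cong : {P Q : Set} (d : Dec P) (d′ : Dec Q) → (P → Q) → (Q → P) → ⟦ d ⟧ ≡ ⟦ d′ ⟧
  ⟦⟧-cong (yes p) d′ f g = sym (⟦⟧-yes d′ (f p))
  ⟦⟧-cong (no ¬p) d′ f g = sym (⟦⟧-no d′ (¬p ∘ g))

  ⟦⟧-guard : {P : Set} (d : Dec P) {x y : ℕ} → (P → x ≡ y) → ⟦ d ⟧ * x ≡ ⟦ d ⟧ * y
  ⟦⟧-guard (yes p) f = cong (1 *_) (f p)
  ⟦⟧-guard (no _)  f = refl

  ⟦⟧-guard-≤ : {P : Set} (d : Dec P) {x y : ℕ} → (P → x ≤ y) → ⟦ d ⟧ * x ≤ ⟦ d ⟧ * y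
  ⟦⟧-guard-≤ (yes p) f = +-monoˡ-≤ 0 (f p)
  ⟦⟧-guard-≤ (no _)  f = z≤n

  ⟦⟧≤1 : {P : Set} (d : Dec P) → ⟦ d ⟧ ≤ 1
  ⟦⟧≤1 (yes _) = ≤-refl
  ⟦⟧≤1 (no _)  = z≤n

  -- Made for exchanging two conditional moves: only the conjunctions of the conditions correspond,
  -- not the conditions one by one.
  ⟦⟧-guard₂ : {P Q P′ Q′ : Set} (d : Dec P) (e : Dec Q) (d′ : Dec P′) (e′ : Dec Q′) {x y : ℕ} →
              (P → Q → P′ × Q′) → (P′ → Q′ → P × Q) → (P → Q → x ≡ y) →
              ⟦ d ⟧ * (⟦ e ⟧ * x) ≡ ⟦ d′ ⟧ * (⟦ e′ ⟧ * y)
  ⟦⟧-guard₂ (yes p) (yes q) d′ e′ to from x≡y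
    rewrite ⟦⟧-yes d′ (proj₁ (to p q)) | ⟦⟧-yes e′ (proj₂ (to p q)) = cong (λ x → 1 * (1 * x)) (x≡y p q)
  ⟦⟧-guard₂ (no ¬p) e (yes p′) (yes q′) to from x≡y = contradiction (proj₁ (from p′ q′)) ¬p
  ⟦⟧-guard₂ (no ¬p) e (no _) e′ to from x≡y = refl
  ⟦⟧-guard₂ (no ¬p) e (yes _) (no _) to from x≡y = refl
  ⟦⟧-guard₂ (yes _) (no ¬q) (yes p′) (yes q′) to from x≡y = contradiction (proj₂ (from p′ q′)) ¬q
  ⟦⟧-guard₂ (yes _) (no ¬q) (no _) e′ to from x≡y = refl
  ⟦⟧-guard₂ (yes _) (no ¬q) (yes _) (no _) to from x≡y = refl

  -- Kept abstract so that the summand can be inferred by unification.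
  abstract

    sum : ∀ {n} → (Fin n → ℕ) → ℕ
    sum = sumᵛ

    sum-suc : ∀ {n} (f : Fin (suc n) → ℕ) → sum f ≡ f zero + sum (f ∘ suc)
    sum-suc f = refl

    sum-cong-≗ : ∀ {n} {f g : Fin n → ℕ} → (∀ i → f i ≡ g i) → sum f ≡ sum g
    sum-cong-≗ = sumᵛ-cong

    ∑-distrib-+ : ∀ {n} (f g : Fin n → ℕ) → sum (λ i → f i + g i) ≡ sum f + sum g
    ∑-distrib-+ = sumᵛ-distrib-+

    ∑-comm : ∀ {m n} (f : Fin m → Fin n → ℕ) → sum (λ i → sum (f i)) ≡ sum (λ j → sum λ i → f i j)
    ∑-comm = sumᵛ-comm

    *-distribˡ-sum : ∀ {n} c (f : Fin n → ℕ) → c * sum f ≡ sum (λ i → c * f i)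
    *-distribˡ-sum = *-distribˡ-sumᵛ

    *-distribʳ-sum : ∀ {n} c (f : Fin n → ℕ) → sum f * c ≡ sum (λ i → f i * c)
    *-distribʳ-sum = *-distribʳ-sumᵛ

    sum-zero : ∀ {n} (f : Fin n → ℕ) → (∀ i → f i ≡ 0) → sum f ≡ 0
    sum-zero {zero}  f f≡0 = refl
    sum-zero {suc n} f f≡0 = cong₂ _+_ (f≡0 zero) (sum-zero (f ∘ suc) (f≡0 ∘ suc))

    sum-single : ∀ {n} (f : Fin n → ℕ) i → (∀ j → j ≢ i → f j ≡ 0) → sum f ≡ f i
    sum-single f zero    f≡0 = trans (cong (f zero +_) (sum-zero (f ∘ suc) λ j → f≡0 (suc j) λ ())) (+-identityʳ _)
    sum-single f (suc i) f≡0 = cong₂ _+_ (f≡0 zero λ ()) (sum-single (f ∘ suc) i λ j j≢i → f≡0 (suc j) λ { refl → j≢i refl })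

    sum-mono : ∀ {n} {f g : Fin n → ℕ} → (∀ i → f i ≤ g i) → sum f ≤ sum g
    sum-mono {zero}  f≤g = z≤n
    sum-mono {suc n} f≤g = +-mono-≤ (f≤g zero) (sum-mono (f≤g ∘ suc))

    term≤sum : ∀ {n} (f : Fin n → ℕ) i → f i ≤ sum f
    term≤sum f zero    = m≤m+n _ _
    term≤sum f (suc i) = ≤-trans (term≤sum (f ∘ suc) i) (m≤n+m _ _)

  -- The i-th entry is the beta number of row i, the length of the row plus the number of rows below.
  State : ℕ → Set
  State = Vec ℕ

  _≟ˢ_ : ∀ {r} (β γ : State r) → Dec (β ≡ γ)
  _≟ˢ_ = ≡-decᵛ _≟_

  inc dec : ∀ {r} → State r → Fin r → State r
  inc β i = updateAt β i suc
  dec β i = updateAt β i pred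

  Distinct : ∀ {r} → State r → Set
  Distinct β = ∀ i j → lookup β i ≡ lookup β j → i ≡ j

  -- For a strictly decreasing state: a cell can be added to, or removed from, the end of row `i` so
  -- that a partition remains.
  Addable Removable : ∀ {r} → State r → Fin r → Set
  Addable   β i = ∀ j → lookup β j ≢ suc (lookup β i)
  Removable β i = lookup β i ≢ 0 × (∀ j → suc (lookup β j) ≢ lookup β i)

  addable? : ∀ {r} (β : State r) i → Dec (Addable β i)
  addable? β i = all? λ j → ¬? (lookup β j ≟ suc (lookup β i))

  removable? : ∀ {r} (β : State r) i → Dec (Removable β i)
  removable? β i = ¬? (lookup β i ≟ 0) ×-dec all? λ j → ¬? (suc (lookup β j) ≟ lookup β i)

  suc-pred-≢0 : ∀ {n} → n ≢ 0 → suc (pred n) ≡ n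
  suc-pred-≢0 {zero}  n≢0 = contradiction refl n≢0
  suc-pred-≢0 {suc n} n≢0 = refl

  module _ {r : ℕ} (β : State r) where

    inc-self : ∀ i → lookup (inc β i) i ≡ suc (lookup β i)
    inc-self i = lookup∘updateAt i β

    inc-other : ∀ {i j} → j ≢ i → lookup (inc β i) j ≡ lookup β j
    inc-other j≢i = lookup∘updateAt′ _ _ j≢i β

    dec-self : ∀ i → lookup (dec β i) i ≡ pred (lookup β i)
    dec-self i = lookup∘updateAt i β

    dec-other : ∀ {i j} → j ≢ i → lookup (dec β i) j ≡ lookup β j
    dec-other j≢i = lookup∘updateAt′ _ _ j≢i β

    dec-inc : ∀ i → dec (inc β i) i ≡ β
    dec-inc i = trans (updateAt-updateAt i β) (updateAt-id i β)

    inc-dec : ∀ i → lookup β i ≢ 0 → inc (dec β i) i ≡ β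
    inc-dec i βi≢0 = trans (updateAt-updateAt i β) (updateAt-id-local i β (suc-pred-≢0 βi≢0))

    inc-dec-comm : ∀ i j → i ≢ j → inc (dec β j) i ≡ dec (inc β i) j
    inc-dec-comm i j i≢j = updateAt-commutes i j i≢j β

  inc-distinct : ∀ {r} (β : State r) i → Distinct β → Addable β i → Distinct (inc β i)
  inc-distinct β i dist add p q eq with p ≟ᶠ i | q ≟ᶠ i
  ... | yes refl | yes refl = refl
  ... | yes refl | no q≢i   = contradiction (trans (sym (inc-other β q≢i)) (trans (sym eq) (inc-self β i))) (add q)
  ... | no p≢i   | yes refl = contradiction (trans (sym (inc-other β p≢i)) (trans eq (inc-self β i))) (add p)
  ... | no p≢i   | no q≢i   = dist p q (trans (sym (inc-other β p≢i)) (trans eq (inc-other β q≢i)))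

  Jump : ∀ {r} → ℕ → State r → Fin r → Set
  Jump k β i = lookup β i ≡ k × Addable β i

  jump? : ∀ {r} k (β : State r) i → Dec (Jump k β i)
  jump? k β i = (lookup β i ≟ k) ×-dec addable? β i

  Landed : ∀ {r} → ℕ → State r → Fin r → Set
  Landed k β i = lookup β i ≡ suc k × Removable β i

  landed? : ∀ {r} k (β : State r) i → Dec (Landed k β i)
  landed? k β i = (lookup β i ≟ suc k) ×-dec removable? β i

  -- On distinct beta numbers at most one summand is nonzero, so this pulls `f` back along the move
  -- of the beta number `k` to `k + 1`.
  raise : ∀ {r} → ℕ → (State r → ℕ) → State r → ℕ
  raise k f β = sum λ i → ⟦ jump? k β i ⟧ * f (inc β i)

  lower : ∀ {r} → (State r → ℕ) → State r → ℕ
  lower f β = sum λ i → ⟦ removable? β i ⟧ * f (dec β i)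

  -- The operators commute up to diagonal terms, which arise when a row is moved forth and back.
  module _ {r : ℕ} (k : ℕ) (f : State r → ℕ) (β : State r) (dist : Distinct β) where

    private
      X Y : Fin r → Fin r → ℕ
      X i j = ⟦ jump? k β i ⟧ * (⟦ removable? (inc β i) j ⟧ * f (dec (inc β i) j))
      Y i j = ⟦ removable? β j ⟧ * (⟦ jump? k (dec β j) i ⟧ * f (inc (dec β j) i))

      -- Moves of different rows interfere only if `lookup β j` is `k + 1` or `k + 2`, where one row
      -- would run into the other; either order of the moves excludes both values.
      off-diagonal : ∀ i j → i ≢ j → X i j ≡ Y i j
      off-diagonal i j i≢j = ⟦⟧-guard₂ (jump? k β i) (removable? (inc β i) j) (removable? β j) (jump? k (dec β j) i)
        to from (λ _ _ → cong f (sym (inc-dec-comm β i j i≢j)))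
        where
        j≢i : j ≢ i
        j≢i = i≢j ∘ sym
        to : Jump k β i → Removable (inc β i) j → Removable β j × Jump k (dec β j) i
        to (βi≡k , add) (≢0 , rem) =
          (subst (_≢ 0) (inc-other β j≢i) ≢0 , rem′) , trans (dec-other β i≢j) βi≡k , add′
          where
          rem′ : ∀ l → suc (lookup β l) ≢ lookup β j
          rem′ l eq with l ≟ᶠ i
          ... | yes refl = add j (sym eq)
          ... | no l≢i   = rem l (trans (cong suc (inc-other β l≢i)) (trans eq (sym (inc-other β j≢i))))
          add′ : ∀ l → lookup (dec β j) l ≢ suc (lookup (dec β j) i)
          add′ l eq with l ≟ᶠ j
          ... | no l≢j   = add l (trans (sym (dec-other β l≢j)) (trans eq (cong suc (dec-other β i≢j))))
          ... | yes refl = rem i (trans (cong suc (inc-self β i))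
                (trans (cong (λ x → suc (suc x)) (sym (dec-other β i≢j))) (trans (cong suc (trans (sym eq) (dec-self β j)))
                (trans (suc-pred-≢0 (subst (_≢ 0) (inc-other β j≢i) ≢0)) (sym (inc-other β j≢i))))))
        from : Removable β j → Jump k (dec β j) i → Jump k β i × Removable (inc β i) j
        from (≢0 , rem) (di≡k , add) = (βi≡k , add′) , subst (_≢ 0) (sym (inc-other β j≢i)) ≢0 , rem′
          where
          βi≡k : lookup β i ≡ k
          βi≡k = trans (sym (dec-other β i≢j)) di≡k
          add′ : ∀ l → lookup β l ≢ suc (lookup β i)
          add′ l eq with l ≟ᶠ j
          ... | yes refl = rem i (sym eq)
          ... | no l≢j   = add l (trans (dec-other β l≢j) (trans eq (cong suc (sym (dec-other β i≢j)))))
          rem′ : ∀ l → suc (lookup (inc β i) l) ≢ lookup (inc β i) j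
          rem′ l eq with l ≟ᶠ i
          ... | no l≢i   = rem l (trans (cong suc (sym (inc-other β l≢i))) (trans eq (inc-other β j≢i)))
          ... | yes refl = add j (trans (dec-self β j) (trans (cong pred (trans (sym (inc-other β j≢i)) (sym eq)))
                (trans (inc-self β i) (cong suc (sym (dec-other β i≢j))))))

      -- A raised row can always be lowered again: by distinctness its old place is free.
      diagonalˣ : ∀ i → X i i ≡ ⟦ jump? k β i ⟧ * f β
      diagonalˣ i = ⟦⟧-guard (jump? k β i) λ (βi≡k , add) →
        trans (cong₂ _*_ (⟦⟧-yes (removable? (inc β i) i) (rem add)) (cong f (dec-inc β i))) (*-identityˡ _)
        where
        rem : Addable β i → Removable (inc β i) i
        rem add = (λ eq → contradiction (trans (sym (inc-self β i)) eq) λ ()) , go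
          where
          go : ∀ l → suc (lookup (inc β i) l) ≢ lookup (inc β i) i
          go l eq with l ≟ᶠ i
          ... | yes refl = 1+n≢n eq
          ... | no l≢i   = l≢i (dist l i (suc-injective (trans (cong suc (sym (inc-other β l≢i))) (trans eq (inc-self β i)))))

      diagonalʸ : ∀ i → Y i i ≡ ⟦ landed? k β i ⟧ * f β
      diagonalʸ i = go (removable? β i)
        where
        m : ℕ
        m = pred (lookup β i)
        go : (d : Dec (Removable β i)) →
             ⟦ d ⟧ * (⟦ jump? k (dec β i) i ⟧ * f (inc (dec β i) i)) ≡ ⟦ landed? k β i ⟧ * f β
        go (no ¬rem) = sym (cong (_* f β) (⟦⟧-no (landed? k β i) (¬rem ∘ proj₂)))
        go (yes rem@(≢0 , gap)) = trans (*-identityˡ _) (cong₂ _*_ (⟦⟧-cong (jump? k (dec β i) i) (landed? k β i) to from) (cong f (inc-dec β i ≢0)))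
          where
          βi≡ : lookup β i ≡ suc m
          βi≡ = sym (suc-pred-≢0 ≢0)
          di : lookup (dec β i) i ≡ m
          di = dec-self β i
          to : Jump k (dec β i) i → Landed k β i
          to (eq , _) = trans βi≡ (cong suc (trans (sym di) eq)) , rem
          from : Landed k β i → Jump k (dec β i) i
          from (eq , _) = trans di (suc-injective (trans (sym βi≡) eq)) , add
            where
            add : ∀ l → lookup (dec β i) l ≢ suc (lookup (dec β i) i)
            add l eq′ with l ≟ᶠ i
            ... | yes refl = 1+n≢n (sym eq′)
            ... | no l≢i   = l≢i (dist l i (trans (sym (dec-other β l≢i)) (trans eq′ (trans (cong suc di) (sym βi≡)))))

      termwise : ∀ i j → X i j + ⟦ i ≟ᶠ j ⟧ * (⟦ landed? k β i ⟧ * f β) ≡ Y i j + ⟦ i ≟ᶠ j ⟧ * (⟦ jump? k β i ⟧ * f β)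
      termwise i j with i ≟ᶠ j
      ... | yes refl = trans (cong₂ (λ x y → x + 1 * y) (diagonalˣ i) (sym (diagonalʸ i)))
                         (rearrange (⟦ jump? k β i ⟧ * f β) (Y i i))
        where
        rearrange : ∀ x y → x + 1 * y ≡ y + 1 * x
        rearrange = solve-∀
      ... | no i≢j   = cong (_+ 0) (off-diagonal i j i≢j)

      sum-δ : ∀ (i : Fin r) (x : ℕ) → sum (λ j → ⟦ i ≟ᶠ j ⟧ * x) ≡ x
      sum-δ i x = trans (sum-single _ i λ j j≢i → cong (_* x) (⟦⟧-no (i ≟ᶠ j) (j≢i ∘ sym)))
                        (trans (cong (_* x) (⟦⟧-yes (i ≟ᶠ i) refl)) (*-identityˡ x))

      rowwise : ∀ i → sum (X i) + ⟦ landed? k β i ⟧ * f β ≡ sum (Y i) + ⟦ jump? k β i ⟧ * f β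
      rowwise i = begin
        sum (X i) + ⟦ landed? k β i ⟧ * f β                                             ≡⟨ cong (sum (X i) +_) (sum-δ i (⟦ landed? k β i ⟧ * f β)) ⟨
        sum (X i) + sum (λ j → ⟦ i ≟ᶠ j ⟧ * (⟦ landed? k β i ⟧ * f β)) ≡⟨ ∑-distrib-+ (X i) _ ⟨
        sum (λ j → X i j + ⟦ i ≟ᶠ j ⟧ * (⟦ landed? k β i ⟧ * f β))     ≡⟨ sum-cong-≗ (termwise i) ⟩
        sum (λ j → Y i j + ⟦ i ≟ᶠ j ⟧ * (⟦ jump? k β i ⟧ * f β))       ≡⟨ ∑-distrib-+ (Y i) _ ⟩
        sum (Y i) + sum (λ j → ⟦ i ≟ᶠ j ⟧ * (⟦ jump? k β i ⟧ * f β))   ≡⟨ cong (sum (Y i) +_) (sum-δ i (⟦ jump? k β i ⟧ * f β)) ⟩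
        sum (Y i) + ⟦ jump? k β i ⟧ * f β                                               ∎
        where open ≡-Reasoning

    -- The relation [E, F] = H of sl₂ without subtraction: jumps minus landings is the number of
    -- rows at `k` minus the number at `k + 1`.
    raise-lower : raise k (lower f) β + sum (λ i → ⟦ landed? k β i ⟧) * f β
                ≡ lower (raise k f) β + sum (λ i → ⟦ jump? k β i ⟧) * f β
    raise-lower = begin
      raise k (lower f) β + sum (λ i → ⟦ landed? k β i ⟧) * f β
        ≡⟨ cong₂ _+_ (sum-cong-≗ λ i → *-distribˡ-sum ⟦ jump? k β i ⟧ _) (*-distribʳ-sum (f β) λ i → ⟦ landed? k β i ⟧) ⟩
      sum (λ i → sum (X i)) + sum (λ i → ⟦ landed? k β i ⟧ * f β)
        ≡⟨ ∑-distrib-+ _ _ ⟨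
      sum (λ i → sum (X i) + ⟦ landed? k β i ⟧ * f β)
        ≡⟨ sum-cong-≗ rowwise ⟩
      sum (λ i → sum (Y i) + ⟦ jump? k β i ⟧ * f β)
        ≡⟨ ∑-distrib-+ _ _ ⟩
      sum (λ i → sum (Y i)) + sum (λ i → ⟦ jump? k β i ⟧ * f β)
        ≡⟨ cong₂ _+_ (∑-comm Y) (sym (*-distribʳ-sum (f β) λ i → ⟦ jump? k β i ⟧)) ⟩
      sum (λ j → sum (λ i → Y i j)) + sum (λ i → ⟦ jump? k β i ⟧) * f β
        ≡⟨ cong (_+ (sum (λ i → ⟦ jump? k β i ⟧) * f β)) (sum-cong-≗ λ j → *-distribˡ-sum ⟦ removable? β j ⟧ _) ⟨
      lower (raise k f) β + sum (λ i → ⟦ jump? k β i ⟧) * f β ∎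
      where open ≡-Reasoning

  -- Potentials under a transposition of places

  swap : ℕ → ℕ → ℕ
  swap k p with p ≟ k | p ≟ suc k
  ... | yes _ | _     = suc k
  ... | no _  | yes _ = k
  ... | no _  | no _  = p

  swap-left : ∀ k → swap k k ≡ suc k
  swap-left k with k ≟ k | k ≟ suc k
  ... | yes _  | _ = refl
  ... | no k≢k | _ = contradiction refl k≢k

  swap-right : ∀ k → swap k (suc k) ≡ k
  swap-right k with suc k ≟ k | suc k ≟ suc k
  ... | yes eq | _     = contradiction eq 1+n≢n
  ... | no _   | yes _ = refl
  ... | no _   | no ≢  = contradiction refl ≢

  swap-other : ∀ k {p} → p ≢ k → p ≢ suc k → swap k p ≡ p
  swap-other k {p} p≢k p≢sk with p ≟ k | p ≟ suc k
  ... | yes eq | _      = contradiction eq p≢k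
  ... | no _   | yes eq = contradiction eq p≢sk
  ... | no _   | no _   = refl

  -- For `y = id` this is the size of the partition plus r(r - 1)/2, so differences of such totals
  -- count cells.
  total : ∀ {r} → (ℕ → ℕ) → State r → ℕ
  total y β = sum λ i → y (lookup β i)

  module _ {r : ℕ} (β : State r) (dist : Distinct β) where

    occupied : ℕ → ℕ
    occupied p = sum λ i → ⟦ lookup β i ≟ p ⟧

    occupied-∈ : ∀ i → occupied (lookup β i) ≡ 1
    occupied-∈ i = trans (sum-single _ i λ j j≢i → ⟦⟧-no (lookup β j ≟ lookup β i) (j≢i ∘ dist j i)) (⟦⟧-yes (lookup β i ≟ lookup β i) refl)

    occupied-∉ : ∀ {p} → (∀ i → lookup β i ≢ p) → occupied p ≡ 0
    occupied-∉ {p} ∉ = sum-zero _ λ i → ⟦⟧-no (lookup β i ≟ p) (∉ i)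

    -- By distinctness `occupied (suc k)` is 0 or 1, according to whether the way of a row at `k` is
    -- free.
    jump-split : ∀ k i → ⟦ lookup β i ≟ k ⟧ ≡ ⟦ jump? k β i ⟧ + ⟦ lookup β i ≟ k ⟧ * occupied (suc k)
    jump-split k i = go (lookup β i ≟ k) (addable? β i)
      where
      go : (d : Dec (lookup β i ≡ k)) (d′ : Dec (Addable β i)) → ⟦ d ⟧ ≡ ⟦ d ×-dec d′ ⟧ + ⟦ d ⟧ * occupied (suc k)
      go (no _)     _        = refl
      go (yes refl) (yes add) = cong (λ x → 1 + (x + 0)) (sym (occupied-∉ add))
      go (yes refl) (no ¬add) with any? (λ j → lookup β j ≟ suc (lookup β i))
      ... | yes (j , eq) = sym (trans (+-identityʳ _) (trans (cong occupied (sym eq)) (occupied-∈ j)))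
      ... | no ∄         = contradiction (λ j eq → ∄ (j , eq)) ¬add

    landed-split : ∀ k i → ⟦ lookup β i ≟ suc k ⟧ ≡ ⟦ landed? k β i ⟧ + ⟦ lookup β i ≟ suc k ⟧ * occupied k
    landed-split k i = go (lookup β i ≟ suc k) (removable? β i)
      where
      go : (d : Dec (lookup β i ≡ suc k)) (d′ : Dec (Removable β i)) → ⟦ d ⟧ ≡ ⟦ d ×-dec d′ ⟧ + ⟦ d ⟧ * occupied k
      go (no _)   _                 = refl
      go (yes βi≡) (yes (_ , gap))  = cong (λ x → 1 + (x + 0)) (sym (occupied-∉ λ j eq → gap j (trans (cong suc eq) (sym βi≡))))
      go (yes βi≡) (no ¬rem) with any? (λ j → lookup β j ≟ k)
      ... | yes (j , eq) = sym (trans (+-identityʳ _) (trans (cong occupied (sym eq)) (occupied-∈ j)))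
      ... | no ∄         = contradiction ((λ eq → contradiction (trans (sym βi≡) eq) λ ()) , λ j eq → ∄ (j , suc-injective (trans eq βi≡))) ¬rem

    module _ (k h : ℕ) (y : ℕ → ℕ) (y-step : y (suc k) ≡ h + y k) where

      swap-pointwise : ∀ p → y (swap k p) + ⟦ p ≟ suc k ⟧ * h ≡ y p + ⟦ p ≟ k ⟧ * h
      swap-pointwise p = go (p ≟ k) (p ≟ suc k)
        where
        go : (d : Dec (p ≡ k)) (d′ : Dec (p ≡ suc k)) → y (swap k p) + ⟦ d′ ⟧ * h ≡ y p + ⟦ d ⟧ * h
        go (yes refl) (yes eq)   = contradiction (sym eq) 1+n≢n
        go (yes refl) (no _)     = trans (+-identityʳ _) (trans (cong y (swap-left k)) (trans y-step (trans (+-comm h _) (cong (y k +_) (sym (+-identityʳ h))))))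
        go (no _)     (yes refl) = trans (cong₂ _+_ (cong y (swap-right k)) (+-identityʳ h)) (trans (+-comm _ h) (trans (sym y-step) (sym (+-identityʳ _))))
        go (no p≢k)   (no p≢sk)  = cong (λ q → y q + 0) (swap-other k p≢k p≢sk)

      -- Exchanging the values at `k` and `k + 1` changes the total by `h` for a row at `k` and by
      -- `-h` for a row at `k + 1`. If both places are occupied the changes cancel, which leaves the
      -- rows that can jump or have landed.
      total-swap : total (y ∘ swap k) β + sum (λ i → ⟦ landed? k β i ⟧) * h ≡ total y β + sum (λ i → ⟦ jump? k β i ⟧) * h
      -- The added term is the contribution of two occupied places; it completes `L` and `J` to
      -- `occupied (suc k)` and `occupied k`.
      total-swap = +-cancelʳ-≡ (occupied k * occupied (suc k) * h) _ _ (begin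
        total (y ∘ swap k) β + L * h + occupied k * occupied (suc k) * h
          ≡⟨ rearrange _ L _ (occupied k) (occupied (suc k)) ⟩
        total (y ∘ swap k) β + (L + occupied (suc k) * occupied k) * h
          ≡⟨ cong (λ x → total (y ∘ swap k) β + x * h) (splitting landed-split) ⟨
        total (y ∘ swap k) β + occupied (suc k) * h
          ≡⟨ pull (y ∘ swap k) (suc k) ⟩
        sum (λ i → y (swap k (lookup β i)) + ⟦ lookup β i ≟ suc k ⟧ * h)
          ≡⟨ sum-cong-≗ (λ i → swap-pointwise (lookup β i)) ⟩
        sum (λ i → y (lookup β i) + ⟦ lookup β i ≟ k ⟧ * h)
          ≡⟨ pull y k ⟨
        total y β + occupied k * h
          ≡⟨ cong (λ x → total y β + x * h) (splitting′ jump-split) ⟩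
        total y β + (J + occupied k * occupied (suc k)) * h
          ≡⟨ rearrange′ _ J _ (occupied k) (occupied (suc k)) ⟩
        total y β + J * h + occupied k * occupied (suc k) * h ∎)
        where
        open ≡-Reasoning
        L J : ℕ
        L = sum (λ i → ⟦ landed? k β i ⟧)
        J = sum (λ i → ⟦ jump? k β i ⟧)
        rearrange : ∀ t l h a b → t + l * h + a * b * h ≡ t + (l + b * a) * h
        rearrange = solve-∀
        rearrange′ : ∀ t l h a b → t + (l + a * b) * h ≡ t + l * h + a * b * h
        rearrange′ = solve-∀
        splitting : (∀ k i → ⟦ lookup β i ≟ suc k ⟧ ≡ ⟦ landed? k β i ⟧ + ⟦ lookup β i ≟ suc k ⟧ * occupied k) →
                    occupied (suc k) ≡ L + occupied (suc k) * occupied k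
        splitting s = trans (sum-cong-≗ (s k)) (trans (∑-distrib-+ _ _) (cong (L +_) (sym (*-distribʳ-sum (occupied k) _))))
        splitting′ : (∀ k i → ⟦ lookup β i ≟ k ⟧ ≡ ⟦ jump? k β i ⟧ + ⟦ lookup β i ≟ k ⟧ * occupied (suc k)) →
                    occupied k ≡ J + occupied k * occupied (suc k)
        splitting′ s = trans (sum-cong-≗ (s k)) (trans (∑-distrib-+ _ _) (cong (J +_) (sym (*-distribʳ-sum (occupied (suc k)) _))))
        pull : ∀ z q → total z β + occupied q * h ≡ sum (λ i → z (lookup β i) + ⟦ lookup β i ≟ q ⟧ * h)
        pull z q = trans (cong (total z β +_) (*-distribʳ-sum h λ i → ⟦ lookup β i ≟ q ⟧)) (sym (∑-distrib-+ _ _))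

  -- A jump acts on the whole state as `swap k`: no other row is at `k`, by distinctness, and none
  -- is at `k + 1`, as the row is addable.
  total-jump : ∀ {r} (y : ℕ → ℕ) k (β : State r) → Distinct β → ∀ i → Jump k β i → total y (inc β i) ≡ total (y ∘ swap k) β
  total-jump y k β dist i (βi≡k , add) = sum-cong-≗ go
    where
    go : ∀ j → y (lookup (inc β i) j) ≡ y (swap k (lookup β j))
    go j with j ≟ᶠ i
    ... | yes refl = cong y (trans (inc-self β i) (trans (cong suc βi≡k) (trans (sym (swap-left k)) (cong (swap k) (sym βi≡k)))))
    ... | no j≢i   = cong y (trans (inc-other β j≢i) (sym (swap-other k (λ eq → j≢i (dist j i (trans eq (sym βi≡k)))) (λ eq → add j (trans eq (cong suc (sym βi≡k)))))))

  -- Weighted subwords and the Chevalley formula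

  Word : Set
  Word = List (ℕ × ℕ)

  module _ {r : ℕ} (μ : State r) where

    -- The sum, over the subwords of L that lead from β to μ, of the products of their weights.
    W : Word → State r → ℕ
    W []            β = ⟦ β ≟ˢ μ ⟧
    W ((k , h) ∷ L) β = W L β + h * raise k (W L) β

  -- The permutation of the places that the word spells, its first letter acting first.
  potential : Word → ℕ → ℕ
  potential []            = id
  potential ((k , _) ∷ L) = potential L ∘ swap k

  -- Each weight is forced: it is the difference of the values that the rest of the word gives to
  -- the two places exchanged.
  Compatible : Word → Set
  Compatible []            = ⊤
  Compatible ((k , h) ∷ L) = potential L (suc k) ≡ h + potential L k × Compatible L

  raise-linear : ∀ {r} k (f : State r → ℕ) (c : ℕ) β → c * raise k f β ≡ raise k (λ γ → c * f γ) β
  raise-linear {r} k f c β = trans (*-distribˡ-sum c λ i → ⟦ jump? k β i ⟧ * f (inc β i)) (sum-cong-≗ λ i → *-left-comm c ⟦ jump? k β i ⟧ (f (inc β i)))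

  lower-linear : ∀ {r} (f g : State r → ℕ) (c : ℕ) β → lower (λ γ → f γ + c * g γ) β ≡ lower f β + c * lower g β
  lower-linear {r} f g c β = trans (sum-cong-≗ λ i → *-expand ⟦ removable? β i ⟧ (f (dec β i)) (g (dec β i)) c)
    (trans (∑-distrib-+ _ _) (cong (lower f β +_) (sym (*-distribˡ-sum c λ i → ⟦ removable? β i ⟧ * g (dec β i)))))

  module _ {r : ℕ} (μ : State r) (distμ : Distinct μ) where

    covers : Word → State r → ℕ
    covers L β = sum λ i → ⟦ addable? μ i ⟧ * W (inc μ i) L β

    -- The recursion defining `W` is linear, and every `W (inc μ i)` obeys it with the same letters.
    covers-∷ : ∀ k h L β → covers ((k , h) ∷ L) β ≡ covers L β + h * raise k (covers L) β
    covers-∷ k h L β = begin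
      sum (λ i → ⟦ addable? μ i ⟧ * (W (inc μ i) L β + h * raise k (W (inc μ i) L) β))
        ≡⟨ sum-cong-≗ (λ i → *-expand ⟦ addable? μ i ⟧ (W (inc μ i) L β) _ h) ⟩
      sum (λ i → ⟦ addable? μ i ⟧ * W (inc μ i) L β + h * (⟦ addable? μ i ⟧ * raise k (W (inc μ i) L) β))
        ≡⟨ ∑-distrib-+ _ _ ⟩
      covers L β + sum (λ i → h * (⟦ addable? μ i ⟧ * raise k (W (inc μ i) L) β))
        ≡⟨ cong (covers L β +_) (*-distribˡ-sum h _) ⟨
      covers L β + h * sum (λ i → ⟦ addable? μ i ⟧ * raise k (W (inc μ i) L) β)
        ≡⟨ cong (λ x → covers L β + h * x) exchange ⟩
      covers L β + h * raise k (covers L) β ∎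
      where
      open ≡-Reasoning
      exchange : sum (λ i → ⟦ addable? μ i ⟧ * raise k (W (inc μ i) L) β) ≡ raise k (covers L) β
      exchange = begin
        sum (λ i → ⟦ addable? μ i ⟧ * raise k (W (inc μ i) L) β)
          ≡⟨ sum-cong-≗ (λ i → *-distribˡ-sum ⟦ addable? μ i ⟧ _) ⟩
        sum (λ i → sum λ j → ⟦ addable? μ i ⟧ * (⟦ jump? k β j ⟧ * W (inc μ i) L (inc β j)))
          ≡⟨ ∑-comm _ ⟩
        sum (λ j → sum λ i → ⟦ addable? μ i ⟧ * (⟦ jump? k β j ⟧ * W (inc μ i) L (inc β j)))
          ≡⟨ sum-cong-≗ (λ j → sum-cong-≗ λ i → *-left-comm ⟦ addable? μ i ⟧ ⟦ jump? k β j ⟧ _) ⟩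
        sum (λ j → sum λ i → ⟦ jump? k β j ⟧ * (⟦ addable? μ i ⟧ * W (inc μ i) L (inc β j)))
          ≡⟨ sum-cong-≗ (λ j → *-distribˡ-sum ⟦ jump? k β j ⟧ _) ⟨
        raise k (covers L) β ∎

    -- With no letter left, both sides count the rows by which `β` exceeds `μ` by one cell, added to
    -- `μ` on the left and removed from `β` on the right.
    covers-[] : ∀ β → Distinct β → covers [] β ≡ lower (W μ []) β
    covers-[] β distβ = sum-cong-≗ λ i → trans (cong (⟦ addable? μ i ⟧ *_) (sym (*-identityʳ _)))
      (trans (⟦⟧-guard₂ (addable? μ i) (β ≟ˢ inc μ i) (removable? β i) (dec β i ≟ˢ μ) {1} {1} (to i) (from i) (λ _ _ → refl))
             (cong (⟦ removable? β i ⟧ *_) (*-identityʳ _)))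
      where
      to : ∀ i → Addable μ i → β ≡ inc μ i → Removable β i × dec β i ≡ μ
      to i add refl = ((λ eq → contradiction (trans (sym (inc-self μ i)) eq) λ ()) , gap) , dec-inc μ i
        where
        gap : ∀ l → suc (lookup (inc μ i) l) ≢ lookup (inc μ i) i
        gap l eq with l ≟ᶠ i
        ... | yes refl = 1+n≢n eq
        ... | no l≢i   = l≢i (distμ l i (suc-injective (trans (cong suc (sym (inc-other μ l≢i))) (trans eq (inc-self μ i)))))
      from : ∀ i → Removable β i → dec β i ≡ μ → Addable μ i × β ≡ inc μ i
      from i (≢0 , gap) refl = add , sym (inc-dec β i ≢0)
        where
        add : ∀ l → lookup (dec β i) l ≢ suc (lookup (dec β i) i)
        add l eq with l ≟ᶠ i
        ... | yes refl = 1+n≢n (sym eq)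
        ... | no l≢i   = l≢i (distβ l i (trans (sym (dec-other β l≢i)) (trans eq
                           (trans (sym (inc-self (dec β i) i)) (cong (λ γ → lookup γ i) (inc-dec β i ≢0))))))

    -- Peeling off one letter, raise-lower moves lower past it, and the diagonal terms are absorbed
    -- by the change of potential (total-swap).
    chevalley : ∀ L → Compatible L → ∀ β → Distinct β →
                covers L β + total id μ * W μ L β ≡ lower (W μ L) β + total (potential L) β * W μ L β
    chevalley []            _              β distβ = cong₂ _+_ (covers-[] β distβ) (⟦⟧-end (β ≟ˢ μ))
      where
      ⟦⟧-end : (d : Dec (β ≡ μ)) → total id μ * ⟦ d ⟧ ≡ total id β * ⟦ d ⟧
      ⟦⟧-end (yes refl) = refl
      ⟦⟧-end (no _)     = trans (*-zeroʳ (total id μ)) (sym (*-zeroʳ (total id β)))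
    -- The term `l * (h * f)` stands for the subtraction hidden in `raise-lower` and `total-swap`.
    chevalley ((k , h) ∷ L) (y-step , comp) β distβ = +-cancelʳ-≡ (l * (h * f)) _ _ (begin
      covers ((k , h) ∷ L) β + M * (f + h * gf) + l * (h * f)
        ≡⟨ cong (λ x → x + M * (f + h * gf) + l * (h * f)) (covers-∷ k h L β) ⟩
      A + h * gA + M * (f + h * gf) + l * (h * f)
        ≡⟨ e₁ A h gA M f gf l ⟩
      A + M * f + h * (gA + M * gf) + l * (h * f)
        ≡⟨ cong₂ (λ x y → x + h * y + l * (h * f)) (chevalley L comp β distβ) raised ⟩
      Rf + Y * f + h * (gRf + Y′ * gf) + l * (h * f)
        ≡⟨ e₂ Rf Y f h gRf Y′ gf l ⟩
      Rf + Y * f + h * (gRf + l * f) + h * (Y′ * gf)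
        ≡⟨ cong (λ x → Rf + Y * f + h * x + h * (Y′ * gf)) (raise-lower k (W μ L) β distβ) ⟩
      Rf + Y * f + h * (Rgf + j * f) + h * (Y′ * gf)
        ≡⟨ e₃ Rf Y f h Rgf Y′ gf j ⟩
      Rf + h * Rgf + ((Y + j * h) * f + h * (Y′ * gf))
        ≡⟨ cong (λ x → Rf + h * Rgf + (x * f + h * (Y′ * gf))) (total-swap β distβ k h (potential L) y-step) ⟨
      Rf + h * Rgf + ((Y′ + l * h) * f + h * (Y′ * gf))
        ≡⟨ e₄ (Rf + h * Rgf) Y′ l h f gf ⟩
      Rf + h * Rgf + Y′ * (f + h * gf) + l * (h * f)
        ≡⟨ cong (λ x → x + Y′ * (f + h * gf) + l * (h * f)) (lower-linear (W μ L) (raise k (W μ L)) h β) ⟨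
      lower (W μ ((k , h) ∷ L)) β + Y′ * (f + h * gf) + l * (h * f) ∎)
      where
      open ≡-Reasoning
      f gf A gA M Rf gRf Rgf Y Y′ l j : ℕ
      f   = W μ L β
      gf  = raise k (W μ L) β
      A   = covers L β
      gA  = raise k (covers L) β
      M   = total id μ
      Rf  = lower (W μ L) β
      gRf = raise k (lower (W μ L)) β
      Rgf = lower (raise k (W μ L)) β
      Y   = total (potential L) β
      Y′  = total (potential L ∘ swap k) β
      l   = sum (λ i → ⟦ landed? k β i ⟧)
      j   = sum (λ i → ⟦ jump? k β i ⟧)
      e₁ : ∀ A h gA M f gf l → A + h * gA + M * (f + h * gf) + l * (h * f) ≡ A + M * f + h * (gA + M * gf) + l * (h * f)
      e₁ = solve-∀
      e₂ : ∀ Rf Y f h gRf Y′ gf l → Rf + Y * f + h * (gRf + Y′ * gf) + l * (h * f) ≡ Rf + Y * f + h * (gRf + l * f) + h * (Y′ * gf)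
      e₂ = solve-∀
      e₃ : ∀ Rf Y f h Rgf Y′ gf j → Rf + Y * f + h * (Rgf + j * f) + h * (Y′ * gf) ≡ Rf + h * Rgf + ((Y + j * h) * f + h * (Y′ * gf))
      e₃ = solve-∀
      e₄ : ∀ R Y′ l h f gf → R + ((Y′ + l * h) * f + h * (Y′ * gf)) ≡ R + Y′ * (f + h * gf) + l * (h * f)
      e₄ = solve-∀
      -- The induction hypothesis at the states reached by a jump. By `total-jump` the total of the
      -- potential is the same number `Y′` at all of them and comes out of the sum.
      raised : gA + M * gf ≡ gRf + Y′ * gf
      raised = begin
        gA + M * gf
          ≡⟨ cong (gA +_) (raise-linear k (W μ L) M β) ⟩
        gA + raise k (λ γ → M * W μ L γ) β
          ≡⟨ ∑-distrib-+ _ _ ⟨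
        sum (λ i → ⟦ jump? k β i ⟧ * covers L (inc β i) + ⟦ jump? k β i ⟧ * (M * W μ L (inc β i)))
          ≡⟨ sum-cong-≗ (λ i → trans (sym (*-distribˡ-+ ⟦ jump? k β i ⟧ _ _)) (trans (⟦⟧-guard (jump? k β i) (λ jump →
               trans (chevalley L comp (inc β i) (inc-distinct β i distβ (proj₂ jump)))
                     (cong (λ y → lower (W μ L) (inc β i) + y * W μ L (inc β i)) (total-jump (potential L) k β distβ i jump))))
               (*-distribˡ-+ ⟦ jump? k β i ⟧ _ _))) ⟩
        sum (λ i → ⟦ jump? k β i ⟧ * lower (W μ L) (inc β i) + ⟦ jump? k β i ⟧ * (Y′ * W μ L (inc β i)))
          ≡⟨ ∑-distrib-+ _ _ ⟩
        gRf + raise k (λ γ → Y′ * W μ L γ) β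
          ≡⟨ cong (gRf +_) (raise-linear k (W μ L) Y′ β) ⟨
        gRf + Y′ * gf ∎

  -- Potentials of the hook word

  -- The letters carry a beta number from `k` to `k + n`, one cell of the row at a time. As a
  -- permutation they form the cycle that sends `k` to `k + n` and lowers `k + 1`, ..., `k + n` by
  -- one.
  rowWord : ℕ → ℕ → (ℕ → ℕ) → Word → Word
  rowWord k zero    h L = L
  rowWord k (suc n) h L = (k , h 0) ∷ rowWord (suc k) n (h ∘ suc) L

  module _ (L : Word) where

    potential-row-< : ∀ k n h {p} → p < k → potential (rowWord k n h L) p ≡ potential L p
    potential-row-< k zero    h p<k = refl
    potential-row-< k (suc n) h p<k =
      trans (cong (potential (rowWord (suc k) n _ L)) (swap-other k (<⇒≢ p<k) (<⇒≢ (m<n⇒m<1+n p<k))))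
            (potential-row-< (suc k) n _ (m<n⇒m<1+n p<k))

    potential-row-> : ∀ k n h {p} → k + n < p → potential (rowWord k n h L) p ≡ potential L p
    potential-row-> k zero    h k+n<p = refl
    potential-row-> k (suc n) h {p} k+n<p =
      trans (cong (potential (rowWord (suc k) n _ L)) (swap-other k (<⇒≢ (<-trans (n<1+n k) k+1<p) ∘ sym) (<⇒≢ k+1<p ∘ sym)))
            (potential-row-> (suc k) n _ (subst (_< p) (+-suc k n) k+n<p))
      where
      k+1<p : suc k < p
      k+1<p = ≤-<-trans (≤-trans (m≤m+n (suc k) n) (≤-reflexive (sym (+-suc k n)))) k+n<p

    potential-row-start : ∀ k n h → potential (rowWord k n h L) k ≡ potential L (k + n)
    potential-row-start k zero    h = cong (potential L) (sym (+-identityʳ k))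
    potential-row-start k (suc n) h =
      trans (cong (potential (rowWord (suc k) n _ L)) (swap-left k))
            (trans (potential-row-start (suc k) n _) (cong (potential L) (sym (+-suc k n))))

    potential-row-inside : ∀ k n h {j} → j < n → potential (rowWord k n h L) (suc (k + j)) ≡ potential L (k + j)
    potential-row-inside k (suc n) h {zero}  _         =
      trans (cong (potential (rowWord (suc k) n _ L)) (trans (cong (swap k ∘ suc) (+-identityʳ k)) (swap-right k)))
            (trans (potential-row-< (suc k) n _ ≤-refl) (cong (potential L) (sym (+-identityʳ k))))
    potential-row-inside k (suc n) h {suc j} (s≤s j<n) =
      trans (cong (potential (rowWord (suc k) n _ L))
              (trans (cong (swap k ∘ suc) (+-suc k j))
                     (swap-other k (m+1+n≢m k ∘ trans (+-suc k (suc j)) ∘ trans (cong suc (+-suc k j))) (m+1+n≢m k ∘ trans (+-suc k j) ∘ suc-injective))))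
            (trans (potential-row-inside (suc k) n _ j<n) (cong (potential L) (sym (+-suc k j))))

    row-compatible : ∀ k n h → Compatible L → (∀ {j} → j < n → potential L (k + n) ≡ h j + potential L (k + j)) →
                     Compatible (rowWord k n h L)
    row-compatible k zero    h comp steps = comp
    row-compatible k (suc n) h comp steps =
      (begin
        potential (rowWord (suc k) n _ L) (suc k)     ≡⟨ potential-row-start (suc k) n _ ⟩
        potential L (suc k + n)                       ≡⟨ cong (potential L) (+-suc k n) ⟨
        potential L (k + suc n)                       ≡⟨ steps (s≤s z≤n) ⟩
        h 0 + potential L (k + 0)                     ≡⟨ cong (λ p → h 0 + potential L p) (+-identityʳ k) ⟩
        h 0 + potential L k                           ≡⟨ cong (h 0 +_) (potential-row-< (suc k) n _ ≤-refl) ⟨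
        h 0 + potential (rowWord (suc k) n _ L) k     ∎) ,
      row-compatible (suc k) n _ comp λ {j} j<n → begin
        potential L (suc k + n)              ≡⟨ cong (potential L) (+-suc k n) ⟨
        potential L (k + suc n)              ≡⟨ steps (s≤s j<n) ⟩
        h (suc j) + potential L (k + suc j)  ≡⟨ cong (λ p → h (suc j) + potential L p) (+-suc k j) ⟩
        h (suc j) + potential L (suc k + j)  ∎
      where open ≡-Reasoning

  -- The word of a row starts at `length ρ`, the number of rows below it, which is its beta number
  -- when all rows are empty.
  rowsWord : (ℕ → ℕ → ℕ) → List ℕ → ℕ → Word
  rowsWord h []      a = []
  rowsWord h (m ∷ ρ) a = rowWord (length ρ) m (h a) (rowsWord h ρ (suc a))

  height : List ℕ → ℕ → ℕ
  height ρ j = length (filter (j <?_) ρ)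

  height-∷ : ∀ {j m} ρ → j < m → height (m ∷ ρ) j ≡ suc (height ρ j)
  height-∷ ρ j<m = cong length (filter-accept (_ <?_) j<m)

  height-0 : ∀ {j} {ρ} → All (_≤ j) ρ → height ρ j ≡ 0
  height-0 ρ≤j = cong length (filter-none (_ <?_) (All.map ≤⇒≯ ρ≤j))

  -- The beta numbers of the r rows with lengths f 0, …, f (r - 1).
  stateOf : ∀ r → (ℕ → ℕ) → State r
  stateOf zero    f = []
  stateOf (suc r) f = (f 0 + r) ∷ stateOf r (f ∘ suc)

  module _ (h : ℕ → ℕ → ℕ) where

    -- The places `length ρ + j` are the gaps of the empty partition. Each row longer than `j`
    -- passes the `j`-th gap once and pushes it down by one.
    potential-height : ∀ ρ a → AllPairs _≥_ ρ → ∀ j → potential (rowsWord h ρ a) (length ρ + j) + height ρ j ≡ length ρ + j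
    potential-height []      a _          j = +-identityʳ j
    potential-height (m ∷ ρ) a (m≥ ∷ dec) j = go (j <? m)
      where
      open ≡-Reasoning
      y : ℕ → ℕ
      y = potential (rowsWord h ρ (suc a))
      y′ : ℕ
      y′ = potential (rowsWord h (m ∷ ρ) a) (suc (length ρ + j))
      go : Dec (j < m) → y′ + height (m ∷ ρ) j ≡ suc (length ρ + j)
      go (yes j<m) = begin
        y′ + height (m ∷ ρ) j                    ≡⟨ cong₂ _+_ (potential-row-inside _ (length ρ) m (h a) j<m) (height-∷ ρ j<m) ⟩
        y (length ρ + j) + suc (height ρ j)      ≡⟨ +-suc _ _ ⟩
        suc (y (length ρ + j) + height ρ j)      ≡⟨ cong suc (potential-height ρ (suc a) dec j) ⟩
        suc (length ρ + j)                       ∎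
      -- The first row stops short of this gap. With one row fewer it is the gap numbered `suc j` of
      -- `ρ`, and both heights vanish.
      go (no j≮m) = begin
        y′ + height (m ∷ ρ) j
          ≡⟨ cong₂ _+_ (potential-row-> _ (length ρ) m (h a) (s≤s (+-monoʳ-≤ (length ρ) m≤j))) (height-0 (m≤j ∷ ρ≤j)) ⟩
        y (suc (length ρ + j)) + 0
          ≡⟨ cong₂ _+_ (cong y (sym (+-suc (length ρ) j))) (sym (height-0 (All.map m≤n⇒m≤1+n ρ≤j))) ⟩
        y (length ρ + suc j) + height ρ (suc j)
          ≡⟨ potential-height ρ (suc a) dec (suc j) ⟩
        length ρ + suc j
          ≡⟨ +-suc (length ρ) j ⟩
        suc (length ρ + j)                       ∎
        where
        m≤j : m ≤ j
        m≤j = ≮⇒≥ j≮m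
        ρ≤j : All (_≤ j) ρ
        ρ≤j = All.map (λ x≤m → ≤-trans x≤m m≤j) m≥

    -- The word of the first row sends `length ρ` to `length ρ + m`, a place that the shorter rows
    -- leave fixed. The beta numbers of those rows lie below `length ρ` and are moved by their own
    -- words only.
    total-potential : ∀ ρ a → AllPairs _≥_ ρ →
                      total (potential (rowsWord h ρ a)) (stateOf (length ρ) λ _ → 0) ≡ total id (stateOf (length ρ) (part ρ))
    total-potential []      a _          = trans (sum-zero _ λ ()) (sym (sum-zero _ λ ()))
    total-potential (m ∷ ρ) a (m≥ ∷ dec) = trans (sum-suc _) (trans (cong₂ _+_ head-eq tail-eq) (sym (sum-suc _)))
      where
      head-eq : potential (rowsWord h (m ∷ ρ) a) (length ρ) ≡ m + length ρ
      head-eq = trans (potential-row-start (rowsWord h ρ (suc a)) (length ρ) m (h a))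
        (trans (sym (+-identityʳ _)) (trans (cong (potential (rowsWord h ρ (suc a)) (length ρ + m) +_) (sym (height-0 m≥)))
        (trans (potential-height ρ (suc a) dec m) (+-comm (length ρ) m))))
      below : ∀ r i → lookup (stateOf r λ _ → 0) i < r
      below (suc r) zero    = ≤-refl
      below (suc r) (suc i) = m<n⇒m<1+n (below r i)
      tail-eq : sum (λ i → potential (rowsWord h (m ∷ ρ) a) (lookup (stateOf (length ρ) λ _ → 0) i))
              ≡ total id (stateOf (length ρ) (part ρ))
      tail-eq = trans (sum-cong-≗ λ i → potential-row-< (rowsWord h ρ (suc a)) (length ρ) m (h a) (below (length ρ) i))
                      (total-potential ρ (suc a) dec)

  module _ (ν : Partition) where

    -- The hook is the beta number of the row minus the gap of the column, which `potential-height`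
    -- locates. The hypothesis on `col` is confined to columns met by the first remaining row, since
    -- only there do all `a` rows above count.
    hooks-compatible : ∀ ρ a → AllPairs _≥_ ρ → (∀ i → row ν (a + i) ≡ part ρ i) →
                       (∀ j → j < part ρ 0 → col ν j ≡ a + height ρ j) →
                       Compatible (rowsWord (λ i j → hook ν (i , j)) ρ a)
    hooks-compatible []      a _          rows cols = tt
    hooks-compatible (m ∷ ρ) a (m≥ ∷ dec) rows cols =
      row-compatible _ (length ρ) m _
        (hooks-compatible ρ (suc a) dec (λ i → trans (cong (row ν) (sym (+-suc a i))) (rows (suc i)))
          (λ j j<ρ → let j<m = <-≤-trans j<ρ (part₀≤ m≥) in trans (cols j j<m) (trans (cong (a +_) (height-∷ ρ j<m)) (+-suc a _))))
        step
      where
      part₀≤ : ∀ {ρ} → All (_≤ m) ρ → part ρ 0 ≤ m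
      part₀≤ []        = z≤n
      part₀≤ (x≤m ∷ _) = x≤m
      y : ℕ → ℕ
      y = potential (rowsWord (λ i j → hook ν (i , j)) ρ (suc a))
      step : ∀ {j} → j < m → y (length ρ + m) ≡ hook ν (a , j) + y (length ρ + j)
      step {j} j<m = begin
        y (length ρ + m)                     ≡⟨ +-identityʳ _ ⟨
        y (length ρ + m) + 0                 ≡⟨ cong (y (length ρ + m) +_) (height-0 m≥) ⟨
        y (length ρ + m) + height ρ m        ≡⟨ potential-height _ ρ (suc a) dec m ⟩
        length ρ + m                         ≡⟨ cong (length ρ +_) (m+[n∸m]≡n j<m) ⟨
        length ρ + (suc j + (m ∸ suc j))     ≡⟨ e₁ (length ρ) j (m ∸ suc j) ⟩
        suc (m ∸ suc j) + (length ρ + j)     ≡⟨ cong (suc (m ∸ suc j) +_) (potential-height _ ρ (suc a) dec j) ⟨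
        suc (m ∸ suc j) + (y (length ρ + j) + height ρ j) ≡⟨ e₂ (m ∸ suc j) (y (length ρ + j)) (height ρ j) ⟩
        suc ((m ∸ suc j) + height ρ j) + y (length ρ + j)
          ≡⟨ cong₂ (λ x z → suc ((x ∸ suc j) + z) + y (length ρ + j)) (trans (cong (row ν) (sym (+-identityʳ a))) (rows 0)) col-eq ⟨
        hook ν (a , j) + y (length ρ + j)    ∎
        where
        open ≡-Reasoning
        col-eq : col ν j ∸ suc a ≡ height ρ j
        col-eq = trans (cong (_∸ suc a) (trans (cols j j<m) (trans (cong (a +_) (height-∷ ρ j<m)) (+-suc a _)))) (m+n∸m≡n (suc a) _)
        e₁ : ∀ l j x → l + (suc j + x) ≡ suc x + (l + j)
        e₁ = solve-∀
        e₂ : ∀ x y z → suc x + (y + z) ≡ suc (x + z) + y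
        e₂ = solve-∀

  -- The list of cells as a hook word

  cellsFrom : List ℕ → ℕ → List Cell
  cellsFrom []      a = []
  cellsFrom (m ∷ ρ) a = map (a ,_) (upTo m) ++ cellsFrom ρ (suc a)

  concatMap-cellsFrom : ∀ ρ a (f s : ℕ → ℕ) → (∀ i → f (a + i) ≡ part ρ i) → (∀ i → s i ≡ a + i) →
    concatMap (λ i → map (i ,_) (upTo (f i))) (applyUpTo s (length ρ)) ≡ cellsFrom ρ a
  concatMap-cellsFrom []      a f s f≡ s≡ = refl
  concatMap-cellsFrom (m ∷ ρ) a f s f≡ s≡ = cong₂ _++_
    (trans (cong (λ i → map (i ,_) (upTo (f i))) (trans (s≡ 0) (+-identityʳ a)))
           (cong (λ n → map (a ,_) (upTo n)) (trans (cong f (sym (+-identityʳ a))) (f≡ 0))))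
    (concatMap-cellsFrom ρ (suc a) f (s ∘ suc) (λ i → trans (cong f (sym (+-suc a i))) (f≡ (suc i))) (λ i → trans (s≡ (suc i)) (+-suc a i)))

  cells-cellsFrom : ∀ ν → cells ν ≡ cellsFrom (parts ν) 0
  cells-cellsFrom ν = concatMap-cellsFrom (parts ν) 0 (row ν) id (λ _ → refl) (λ _ → refl)

  rowWord-applyUpTo : ∀ k n (h : ℕ → ℕ) (f : ℕ → ℕ × ℕ) L → (∀ j → f j ≡ (k + j , h j)) → applyUpTo f n ++ L ≡ rowWord k n h L
  rowWord-applyUpTo k zero    h f L f≡ = refl
  rowWord-applyUpTo k (suc n) h f L f≡ = cong₂ _∷_ (trans (f≡ 0) (cong (_, h 0) (+-identityʳ k)))
    (rowWord-applyUpTo (suc k) n _ _ L λ j → trans (f≡ (suc j)) (cong (_, h (suc j)) (+-suc k j)))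

  -- The diagonal `j - i` shifted by `r - 1`: adding the cell moves the beta number of row `i` from
  -- this place to the next.
  position : ℕ → Cell → ℕ
  position r (i , j) = j + (r ∸ suc i)

  letter : ℕ → (Cell → ℕ) → Cell → ℕ × ℕ
  letter r h c = position r c , h c

  rowsWord-cellsFrom : ∀ r (h : Cell → ℕ) ρ a → r ≡ a + length ρ →
                       map (letter r h) (cellsFrom ρ a) ≡ rowsWord (λ i j → h (i , j)) ρ a
  rowsWord-cellsFrom r h []      a r≡ = refl
  rowsWord-cellsFrom r h (m ∷ ρ) a r≡ = begin
    map (letter r h) (map (a ,_) (upTo m) ++ cellsFrom ρ (suc a))
      ≡⟨ map-++ (letter r h) (map (a ,_) (upTo m)) _ ⟩
    map (letter r h) (map (a ,_) (upTo m)) ++ map (letter r h) (cellsFrom ρ (suc a))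
      ≡⟨ cong₂ _++_ (trans (sym (map-∘ {g = letter r h} (upTo m))) (map-applyUpTo _ _ m))
           (rowsWord-cellsFrom r h ρ (suc a) (trans r≡ (+-suc a _))) ⟩
    applyUpTo (λ j → letter r h (a , j)) m ++ rowsWord (λ i j → h (i , j)) ρ (suc a)
      ≡⟨ rowWord-applyUpTo (length ρ) m _ _ _ (λ j → cong (_, h (a , j)) (trans (cong (j +_) r∸) (+-comm j _))) ⟩
    rowWord (length ρ) m (λ j → h (a , j)) (rowsWord (λ i j → h (i , j)) ρ (suc a)) ∎
    where
    open ≡-Reasoning
    r∸ : r ∸ suc a ≡ length ρ
    r∸ = trans (cong (_∸ suc a) (trans r≡ (+-suc a _))) (m+n∸m≡n (suc a) _)

  module _ (ν : Partition) where

    hookWord : List Cell → Word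
    hookWord = map (letter (length (parts ν)) (hook ν))

    parts-decreasing : AllPairs _≥_ (parts ν)
    parts-decreasing = Linked⇒AllPairs (λ x≥y y≥z → ≤-trans y≥z x≥y) (decreasing ν)

    hookWord-rows : hookWord (cells ν) ≡ rowsWord (λ i j → hook ν (i , j)) (parts ν) 0
    hookWord-rows = trans (cong hookWord (cells-cellsFrom ν)) (rowsWord-cellsFrom _ (hook ν) (parts ν) 0 refl)

    hookWord-compatible : Compatible (hookWord (cells ν))
    hookWord-compatible = subst Compatible (sym hookWord-rows)
      (hooks-compatible ν (parts ν) 0 parts-decreasing (λ _ → refl) (λ _ _ → refl))

    hookWord-total : total (potential (hookWord (cells ν))) (stateOf (length (parts ν)) λ _ → 0)
                   ≡ total id (stateOf (length (parts ν)) (row ν))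
    hookWord-total = trans (cong (λ L → total (potential L) (stateOf (length (parts ν)) λ _ → 0)) hookWord-rows)
                           (total-potential _ (parts ν) 0 parts-decreasing)

  -- Beta numbers and cells

  -- Junk value 0 beyond the last row, so that no cell lies there.
  at : ∀ {r} → State r → ℕ → ℕ
  at []      _       = 0
  at (x ∷ β) zero    = x
  at (x ∷ β) (suc i) = at β i

  at-lookup : ∀ {r} (β : State r) i → at β (toℕ i) ≡ lookup β i
  at-lookup (x ∷ β) zero    = refl
  at-lookup (x ∷ β) (suc i) = at-lookup β i

  at-inc-self : ∀ {r} (β : State r) i → at (inc β i) (toℕ i) ≡ suc (at β (toℕ i))
  at-inc-self (x ∷ β) zero    = refl
  at-inc-self (x ∷ β) (suc i) = at-inc-self β i

  at-inc-other : ∀ {r} (β : State r) i {a} → a ≢ toℕ i → at (inc β i) a ≡ at β a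
  at-inc-other (x ∷ β) zero    {zero}  a≢i = contradiction refl a≢i
  at-inc-other (x ∷ β) zero    {suc a} a≢i = refl
  at-inc-other (x ∷ β) (suc i) {zero}  a≢i = refl
  at-inc-other (x ∷ β) (suc i) {suc a} a≢i = at-inc-other β i (a≢i ∘ cong suc)

  at-ext : ∀ {r} (β γ : State r) → (∀ i → i < r → at β i ≡ at γ i) → β ≡ γ
  at-ext []      []      eq = refl
  at-ext (x ∷ β) (y ∷ γ) eq = cong₂ _∷_ (eq 0 (s≤s z≤n)) (at-ext β γ λ i i<r → eq (suc i) (s≤s i<r))

  at-positive : ∀ {r} (β : State r) {i p} → p < at β i → i < r
  at-positive []      ()
  at-positive (x ∷ β) {zero}  _   = s≤s z≤n
  at-positive (x ∷ β) {suc i} p<β = s≤s (at-positive β p<β)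

  -- `floor` says that row lengths are nonnegative; it makes the truncated subtraction in `newCell`
  -- exact.
  record Valid {r} (β : State r) : Set where
    field
      strict : ∀ i → suc i < r → at β (suc i) < at β i
      floor  : ∀ i → i < r → r ∸ suc i ≤ at β i

  open Valid public

  CellIn : ∀ {r} → State r → Cell → Set
  CellIn {r} β c = position r c < at β (proj₁ c)

  cellIn? : ∀ {r} (β : State r) c → Dec (CellIn β c)
  cellIn? {r} β c = position r c <? at β (proj₁ c)

  position-suc : ∀ {r} i j → suc i < r → position r (i , j) ≡ suc (position r (suc i , j))
  position-suc {r} i j i+1<r = trans (cong (j +_) (go r i i+1<r)) (+-suc j _)
    where
    go : ∀ r i → suc i < r → r ∸ suc i ≡ suc (r ∸ suc (suc i))
    go (suc (suc r)) zero    _       = refl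
    go (suc r)       (suc i) (s≤s p) = go r i p

  position-diagonal : ∀ {r} i j d → i + d < r → position r (i + d , j + d) ≡ position r (i , j)
  position-diagonal {r} i j zero    i+d<r = cong₂ (λ x y → position r (x , y)) (+-identityʳ i) (+-identityʳ j)
  position-diagonal {r} i j (suc d) i+d<r = trans (cong₂ (λ x y → position r (x , y)) (+-suc i d) (+-suc j d))
    (trans (sym (position-suc (i + d) (j + d) si+d<r)) (position-diagonal i j d (<-trans (n<1+n _) si+d<r)))
    where
    si+d<r : suc (i + d) < r
    si+d<r = subst (_< r) (+-suc i d) i+d<r

  module _ {r : ℕ} {β : State r} (valid : Valid β) where

    antitone : ∀ i d → i + d < r → at β (i + d) + d ≤ at β i
    antitone i zero    _     = ≤-reflexive (trans (+-identityʳ _) (cong (at β) (+-identityʳ i)))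
    antitone i (suc d) i+d<r = ≤-trans
      (≤-trans (≤-reflexive (trans (+-suc _ d) (cong (λ x → suc (at β x) + d) (+-suc i d)))) (+-monoˡ-≤ d (strict valid (i + d) si+d<r)))
      (antitone i d (<-trans (n<1+n _) si+d<r))
      where
      si+d<r : suc (i + d) < r
      si+d<r = subst (_< r) (+-suc i d) i+d<r

    antitone-< : ∀ {i j} → i < j → j < r → at β j < at β i
    antitone-< {i} {j} i<j j<r = <-≤-trans
      (m<m+n (at β j) (m<n⇒0<n∸m i<j))
      (subst (λ x → at β x + (j ∸ i) ≤ at β i) (m+[n∸m]≡n (<⇒≤ i<j))
        (antitone i (j ∸ i) (subst (_< r) (sym (m+[n∸m]≡n (<⇒≤ i<j))) j<r)))

    lookup-< : ∀ {i j : Fin r} → lookup β j < lookup β i → toℕ i < toℕ j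
    lookup-< {i} {j} lt with <-cmp (toℕ i) (toℕ j)
    ... | tri< i<j _ _ = i<j
    ... | tri≈ _ i≡j _ = contradiction lt (<-irrefl (cong (lookup β) (toℕ-injective (sym i≡j))))
    ... | tri> _ _ j<i = contradiction lt (<-asym (subst₂ _<_ (at-lookup β i) (at-lookup β j) (antitone-< j<i (toℕ<n i))))

    valid⇒distinct : Distinct β
    valid⇒distinct i j eq with <-cmp (toℕ i) (toℕ j)
    ... | tri≈ _ i≡j _ = toℕ-injective i≡j
    ... | tri< i<j _ _ = contradiction (trans (at-lookup β j) (trans (sym eq) (sym (at-lookup β i)))) (<⇒≢ (antitone-< i<j (toℕ<n j)))
    ... | tri> _ _ j<i = contradiction (trans (at-lookup β i) (trans eq (sym (at-lookup β j)))) (<⇒≢ (antitone-< j<i (toℕ<n i)))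

    closed-up : ∀ i j → CellIn β (suc i , j) → CellIn β (i , j)
    closed-up i j c∈ = ≤-<-trans (≤-trans (≤-reflexive (position-suc i j si<r)) c∈) (strict valid i si<r)
      where
      si<r : suc i < r
      si<r = at-positive β c∈

    closed : ∀ {i j i′ j′} → i ≤ i′ → j ≤ j′ → CellIn β (i′ , j′) → CellIn β (i , j)
    closed {i} {j} {i′} {j′} i≤i′ j≤j′ c∈ = up (i′ ∸ i) (subst (λ x → CellIn β (x , j)) (sym (m∸n+n≡m i≤i′)) (≤-<-trans (+-monoˡ-≤ _ j≤j′) c∈))
      where
      up : ∀ d → CellIn β (d + i , j) → CellIn β (i , j)
      up zero    c∈ = c∈
      up (suc d) c∈ = up d (closed-up (d + i) j c∈)

    valid-inc : ∀ i → Addable β i → Valid (inc β i)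
    strict (valid-inc i add) l sl<r with l ≟ toℕ i | suc l ≟ toℕ i
    ... | yes refl | _      = subst₂ _<_ (sym (at-inc-other β i 1+n≢n)) (sym (at-inc-self β i)) (m<n⇒m<1+n (strict valid l sl<r))
    ... | no l≢i   | no sl≢i = subst₂ _<_ (sym (at-inc-other β i sl≢i)) (sym (at-inc-other β i l≢i)) (strict valid l sl<r)
    ... | no l≢i   | yes sl≡i = subst₂ _<_
        (trans (cong (suc ∘ at β) sl≡i) (trans (sym (at-inc-self β i)) (cong (at (inc β i)) (sym sl≡i)))) (sym (at-inc-other β i l≢i))
        (≤∧≢⇒< (strict valid l sl<r) λ eq → add (fromℕ< l<r) (begin
          lookup β (fromℕ< l<r)     ≡⟨ at-lookup β _ ⟨
          at β (toℕ (fromℕ< l<r))   ≡⟨ cong (at β) (toℕ-fromℕ< l<r) ⟩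
          at β l                    ≡⟨ eq ⟨
          suc (at β (suc l))        ≡⟨ cong (suc ∘ at β) sl≡i ⟩
          suc (at β (toℕ i))        ≡⟨ cong suc (at-lookup β i) ⟩
          suc (lookup β i)          ∎))
      where
      open ≡-Reasoning
      l<r : l < r
      l<r = <-trans (n<1+n l) sl<r
    floor (valid-inc i add) l l<r with l ≟ toℕ i
    ... | yes refl = ≤-trans (floor valid l l<r) (≤-trans (n≤1+n _) (≤-reflexive (sym (at-inc-self β i))))
    ... | no l≢i   = ≤-trans (floor valid l l<r) (≤-reflexive (sym (at-inc-other β i l≢i)))

  newCell : ∀ {r} → State r → Fin r → Cell
  newCell {r} β i = toℕ i , lookup β i ∸ (r ∸ suc (toℕ i))

  module _ {r : ℕ} {β : State r} (valid : Valid β) (i : Fin r) where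

    position-newCell : position r (newCell β i) ≡ lookup β i
    position-newCell = m∸n+n≡m (≤-trans (floor valid (toℕ i) (toℕ<n i)) (≤-reflexive (at-lookup β i)))

    position-self : ∀ {j} → position r (toℕ i , j) ≡ lookup β i → (toℕ i , j) ≡ newCell β i
    position-self {j} eq = cong (toℕ i ,_) (+-cancelʳ-≡ (r ∸ suc (toℕ i)) j _ (trans eq (sym position-newCell)))

    newCell∉ : ¬ CellIn β (newCell β i)
    newCell∉ = <-irrefl (trans position-newCell (sym (at-lookup β i)))

    newCell∈inc : CellIn (inc β i) (newCell β i)
    newCell∈inc = ≤-reflexive (trans (cong suc (trans position-newCell (sym (at-lookup β i)))) (sym (at-inc-self β i)))

    cellIn-inc⁺ : ∀ c → CellIn β c → CellIn (inc β i) c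
    cellIn-inc⁺ (a , b) c∈ with a ≟ toℕ i
    ... | yes refl = <-≤-trans c∈ (≤-trans (n≤1+n _) (≤-reflexive (sym (at-inc-self β i))))
    ... | no a≢i   = <-≤-trans c∈ (≤-reflexive (sym (at-inc-other β i a≢i)))

    cellIn-inc⁻ : ∀ c → CellIn (inc β i) c → CellIn β c ⊎ c ≡ newCell β i
    cellIn-inc⁻ (a , b) c∈ with a ≟ toℕ i
    ... | no a≢i   = inj₁ (<-≤-trans c∈ (≤-reflexive (at-inc-other β i a≢i)))
    ... | yes refl with m≤n⇒m<n∨m≡n (≤-pred (≤-trans c∈ (≤-reflexive (at-inc-self β i))))
    ...   | inj₁ lt = inj₁ lt
    ...   | inj₂ eq = inj₂ (position-self (trans eq (at-lookup β i)))

  cellIn-ext : ∀ {r} {β γ : State r} → Valid β → Valid γ → (∀ c → CellIn β c → CellIn γ c) → (∀ c → CellIn γ c → CellIn β c) → β ≡ γ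
  cellIn-ext {r} {β} {γ} validβ validγ β⊆γ γ⊆β = at-ext β γ λ i i<r →
    ≤-antisym (below {β} {γ} validγ i i<r (β⊆γ _)) (below {γ} {β} validβ i i<r (γ⊆β _))
    where
    -- The cell tested is the first one of row `i` outside `γ`; a longer row of `β` would contain
    -- it.
    below : ∀ {β γ : State r} → Valid γ → ∀ i → i < r →
            (CellIn β (i , at γ i ∸ (r ∸ suc i)) → CellIn γ (i , at γ i ∸ (r ∸ suc i))) → at β i ≤ at γ i
    below {β} {γ} validγ i i<r sub with at β i ≤? at γ i
    ... | yes le = le
    ... | no ≰   = contradiction (subst (_< at γ i) eq (sub (subst (_< at β i) (sym eq) (≰⇒> ≰)))) (<-irrefl refl)
      where
      eq : position r (i , at γ i ∸ (r ∸ suc i)) ≡ at γ i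
      eq = m∸n+n≡m (floor validγ i i<r)

  at-stateOf : ∀ r f {i} → i < r → at (stateOf r f) i ≡ f i + (r ∸ suc i)
  at-stateOf (suc r) f {zero}  _         = refl
  at-stateOf (suc r) f {suc i} (s≤s i<r) = at-stateOf r (f ∘ suc) i<r

  module _ {r : ℕ} {f : ℕ → ℕ} (f-decreasing : ∀ i → f (suc i) ≤ f i) where

    valid-stateOf : Valid (stateOf r f)
    strict valid-stateOf i si<r = subst₂ _<_ (sym (at-stateOf r f si<r)) (sym (at-stateOf r f (<-trans (n<1+n i) si<r)))
      (subst (f (suc i) + (r ∸ suc (suc i)) <_) (sym (position-suc i (f i) si<r)) (s≤s (+-monoˡ-≤ _ (f-decreasing i))))
    floor  valid-stateOf i i<r  = ≤-trans (m≤n+m _ (f i)) (≤-reflexive (sym (at-stateOf r f i<r)))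

  cellIn-stateOf⁻ : ∀ {r f} i j → CellIn (stateOf r f) (i , j) → j < f i
  cellIn-stateOf⁻ {r} {f} i j c∈ = +-cancelʳ-< (r ∸ suc i) j (f i)
    (≤-trans c∈ (≤-reflexive (at-stateOf r f (at-positive (stateOf r f) c∈))))

  cellIn-stateOf⁺ : ∀ {r f i j} → i < r → j < f i → CellIn (stateOf r f) (i , j)
  cellIn-stateOf⁺ {r} {f} {i} i<r j<f = ≤-trans (+-monoˡ-< (r ∸ suc i) j<f) (≤-reflexive (sym (at-stateOf r f i<r)))

  part-decreasing : ∀ {xs} → Linked _≥_ xs → ∀ i → part xs (suc i) ≤ part xs i
  part-decreasing {[]}         _           i       = z≤n
  part-decreasing {x ∷ []}     _           i       = z≤n
  part-decreasing {x ∷ y ∷ xs} (x≥y Linked.∷ _)  zero    = x≥y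
  part-decreasing {x ∷ y ∷ xs} (_ Linked.∷ link) (suc i) = part-decreasing link i

  part-support : ∀ xs {i j} → j < part xs i → i < length xs
  part-support (x ∷ xs) {zero}  _   = s≤s z≤n
  part-support (x ∷ xs) {suc i} j<p = s≤s (part-support xs j<p)

  row-antitone : ∀ ν {i i′} → i ≤ i′ → row ν i′ ≤ row ν i
  row-antitone ν {i} {i′} i≤i′ = subst (λ x → row ν x ≤ row ν i) (m∸n+n≡m i≤i′) (go (i′ ∸ i))
    where
    go : ∀ d → row ν (d + i) ≤ row ν i
    go zero    = ≤-refl
    go (suc d) = ≤-trans (part-decreasing (decreasing ν) (d + i)) (go d)

  ∈ᶜ-closed : ∀ ν {i j i′ j′} → i ≤ i′ → j ≤ j′ → (i′ , j′) ∈ᶜ ν → (i , j) ∈ᶜ ν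
  ∈ᶜ-closed ν i≤i′ j≤j′ c∈ = <-≤-trans (≤-<-trans j≤j′ c∈) (row-antitone ν i≤i′)

  col-antitone : ∀ ν {j j′} → j ≤ j′ → col ν j′ ≤ col ν j
  col-antitone ν {j} {j′} j≤j′ = go (parts ν)
    where
    go : ∀ xs → height xs j′ ≤ height xs j
    go []       = z≤n
    go (x ∷ xs) with j′ <? x | j <? x
    ... | yes j′<x | yes j<x = ≤-trans (≤-reflexive (height-∷ xs j′<x)) (≤-trans (s≤s (go xs)) (≤-reflexive (sym (height-∷ xs j<x))))
    ... | yes j′<x | no j≮x  = contradiction (≤-<-trans j≤j′ j′<x) j≮x
    ... | no j′≮x  | yes j<x = ≤-trans (≤-reflexive (cong length (filter-reject (j′ <?_) j′≮x))) (≤-trans (go xs) (≤-trans (n≤1+n _) (≤-reflexive (sym (height-∷ xs j<x)))))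
    ... | no j′≮x  | no j≮x  = ≤-trans (≤-reflexive (cong length (filter-reject (j′ <?_) j′≮x))) (≤-trans (go xs) (≤-reflexive (sym (cong length (filter-reject (j <?_) j≮x)))))

  hook-antitone : ∀ ν {i j i′ j′} → i ≤ i′ → j ≤ j′ → hook ν (i′ , j′) ≤ hook ν (i , j)
  hook-antitone ν i≤i′ j≤j′ = s≤s (+-mono-≤ (∸-mono (row-antitone ν i≤i′) (s≤s j≤j′)) (∸-mono (col-antitone ν j≤j′) (s≤s i≤i′)))

  -- The reading order of the cells

  _≺_ : Cell → Cell → Set
  (i , j) ≺ (i′ , j′) = i < i′ ⊎ (i ≡ i′ × j < j′)

  ≺-trans : ∀ {u v w} → u ≺ v → v ≺ w → u ≺ w
  ≺-trans (inj₁ p)          (inj₁ q)          = inj₁ (<-trans p q)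
  ≺-trans (inj₁ p)          (inj₂ (refl , _)) = inj₁ p
  ≺-trans (inj₂ (refl , _)) (inj₁ q)          = inj₁ q
  ≺-trans (inj₂ (refl , p)) (inj₂ (refl , q)) = inj₂ (refl , <-trans p q)

  ≺-irrefl : ∀ {u} → ¬ u ≺ u
  ≺-irrefl (inj₁ p)       = <-irrefl refl p
  ≺-irrefl (inj₂ (_ , p)) = <-irrefl refl p

  ∈-cells⁺ : ∀ ν {u} → u ∈ᶜ ν → u ∈ cells ν
  ∈-cells⁺ ν {i , j} j<row = ∈-concatMap⁺ (λ i → map (i ,_) (upTo (row ν i))) {xs = upTo (length (parts ν))}
    (lose (∈-upTo⁺ (part-support (parts ν) j<row)) (∈-map⁺ (i ,_) (∈-upTo⁺ j<row)))

  ∈-cells⁻ : ∀ ν {u} → u ∈ cells ν → u ∈ᶜ ν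
  ∈-cells⁻ ν u∈ with find (∈-concatMap⁻ (λ i → map (i ,_) (upTo (row ν i))) {xs = upTo (length (parts ν))} u∈)
  ... | i , _ , u∈row with ∈-map⁻ (i ,_) u∈row
  ...   | j , j∈ , refl = ∈-upTo⁻ j∈

  cells-sorted : ∀ ν → AllPairs _≺_ (cells ν)
  cells-sorted ν = AllPairsP.concat⁺
    (AllP.map⁺ (All.universal (λ i → AllPairsP.map⁺ {f = i ,_} (AllPairsP.applyUpTo⁺₁ id (row ν i) λ j<j′ _ → inj₂ (refl , j<j′)))
                              (upTo (length (parts ν)))))
    (AllPairsP.map⁺ {f = rowCells} (AllPairsP.applyUpTo⁺₁ id (length (parts ν)) λ {i} {i′} i<i′ _ →
      AllP.map⁺ {f = i ,_} (All.universal (λ _ → AllP.map⁺ {f = i′ ,_} (All.universal (λ _ → inj₁ i<i′) (upTo (row ν i′)))) (upTo (row ν i)))))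
    where
    rowCells : ℕ → List Cell
    rowCells i = map (i ,_) (upTo (row ν i))

  -- Bounds for the weighted sum over subwords

  product-update : {A : Set} (φ φ′ : A → ℕ) (x : ℕ) {v : A} {us : List A} → Unique us → v ∈ us →
                   (∀ u → u ≢ v → φ′ u ≡ φ u) → φ′ v ≡ x * φ v → product (map φ′ us) ≡ x * product (map φ us)
  product-update φ φ′ x (v∉ ∷ _) (here refl) other self =
    trans (cong₂ _*_ self (cong product (map-cong-local (All.map (λ v≢u → other _ (v≢u ∘ sym)) v∉)))) (*-assoc x _ _)
  product-update φ φ′ x {v} {u ∷ us} (u∉ ∷ unique) (there v∈) other self =
    trans (cong₂ _*_ (other u (All.lookup u∉ v∈)) (product-update φ φ′ x unique v∈ other self)) (*-left-comm (φ u) x _)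

  module _ (ν : Partition) where

    rank : ℕ
    rank = length (parts ν)

    -- The invariant of reading a word from left to right. By `below` no remaining letter lies in
    -- `β`; this keeps a new cell from lying below the letter that adds it.
    record Stage (β : State rank) (L : List Cell) : Set where
      field
        valid  : Valid β
        within : ∀ {c} → CellIn β c → c ∈ᶜ ν
        below  : ∀ {c} → CellIn β c → All (c ≺_) L
        sorted : AllPairs _≺_ L
        cells⊆ : All (_∈ᶜ ν) L

    open Stage public

    stage-skip : ∀ {β c L} → Stage β (c ∷ L) → Stage β L
    stage-skip st = record
      { valid = valid st ; within = within st ; below = All.tail ∘ below st
      ; sorted = AllPairs.tail (sorted st) ; cells⊆ = All.tail (cells⊆ st) }

    module _ {β : State rank} {a b L} (st : Stage β ((a , b) ∷ L)) (i : Fin rank) (jump : Jump (position rank (a , b)) β i) where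

      private
        j₀ : ℕ
        j₀ = proj₂ (newCell β i)
        valid′ : Valid (inc β i)
        valid′ = valid-inc (valid st) i (proj₂ jump)
        c∈ν : (a , b) ∈ᶜ ν
        c∈ν = All.head (cells⊆ st)
        a<r : a < rank
        a<r = part-support (parts ν) c∈ν
        same-position : position rank (toℕ i , j₀) ≡ position rank (a , b)
        same-position = trans (position-newCell (valid st) i) (proj₁ jump)

        -- Were the new cell further down the diagonal, `(a , b)` would lie to its upper left, hence
        -- already in `β`, against `below`.
        i≤a : toℕ i ≤ a
        i≤a = ≮⇒≥ λ a<i → [ ≺-irrefl ∘ All.head ∘ below st , (λ eq → <-irrefl (cong proj₁ eq) a<i) ]′
          (cellIn-inc⁻ (valid st) i _ (closed valid′ (<⇒≤ a<i) (b≤j₀ a<i) (newCell∈inc (valid st) i)))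
          where
          b≤j₀ : a < toℕ i → b ≤ j₀
          b≤j₀ a<i = +-cancelʳ-≤ (rank ∸ suc a) b j₀ (≤-trans (≤-reflexive (sym same-position)) (+-monoʳ-≤ j₀ (∸-monoʳ-≤ rank (s≤s (<⇒≤ a<i)))))

      -- The source of excitation: a letter may add a cell higher up its own diagonal, and the
      -- excited diagram records the letter in place of that cell.
      jump-diagonal : ∃[ d ] (a , b) ≡ (toℕ i + d , j₀ + d)
      jump-diagonal = a ∸ toℕ i , cong₂ _,_ (sym a≡) (+-cancelʳ-≡ (rank ∸ suc a) b _
        (trans (sym same-position) (trans (sym (position-diagonal {rank} (toℕ i) j₀ (a ∸ toℕ i) (subst (_< rank) (sym a≡) a<r)))
               (cong (λ x → j₀ + (a ∸ toℕ i) + (rank ∸ suc x)) a≡))))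
        where
        a≡ : toℕ i + (a ∸ toℕ i) ≡ a
        a≡ = m+[n∸m]≡n i≤a

      private
        j₀≤b : j₀ ≤ b
        j₀≤b with jump-diagonal
        ... | d , refl = m≤m+n j₀ d

      newCell∈ν : newCell β i ∈ᶜ ν
      newCell∈ν = ∈ᶜ-closed ν i≤a j₀≤b c∈ν

      hook-newCell : hook ν (a , b) ≤ hook ν (newCell β i)
      hook-newCell = hook-antitone ν i≤a j₀≤b

      newCell-≼ : newCell β i ≡ (a , b) ⊎ newCell β i ≺ (a , b)
      newCell-≼ with jump-diagonal
      ... | zero  , eq = inj₁ (sym (trans eq (cong₂ _,_ (+-identityʳ _) (+-identityʳ _))))
      ... | suc d , refl = inj₂ (inj₁ (m<m+n (toℕ i) (s≤s z≤n)))

      stage-jump : Stage (inc β i) L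
      stage-jump = record
        { valid  = valid′
        ; within = λ c∈ → [ within st , (λ { refl → newCell∈ν }) ]′ (cellIn-inc⁻ (valid st) i _ c∈)
        ; below  = λ c∈ → [ All.tail ∘ below st , (λ { refl → newCell≺ }) ]′ (cellIn-inc⁻ (valid st) i _ c∈)
        ; sorted = AllPairs.tail (sorted st)
        ; cells⊆ = All.tail (cells⊆ st) }
        where
        newCell≺ : All (newCell β i ≺_) L
        newCell≺ = [ (λ eq → subst (λ u → All (u ≺_) L) (sym eq) (AllPairs.head (sorted st)))
                   , (λ new≺ → All.map (≺-trans new≺) (AllPairs.head (sorted st))) ]′ newCell-≼

    word : (Cell → ℕ) → List Cell → Word
    word h = map (letter rank h)

    -- Every letter that is taken adds a cell of `ν`, so no subword leads outside `ν`.
    W-outside : ∀ {μ h} {c} → CellIn μ c → ¬ (c ∈ᶜ ν) → ∀ L {β} → Stage β L → W μ (word h L) β ≡ 0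
    W-outside {μ} c∈μ c∉ν []      {β} st = ⟦⟧-no (β ≟ˢ μ) λ { refl → c∉ν (within st c∈μ) }
    W-outside {μ} {h} c∈μ c∉ν (c ∷ L) {β} st = cong₂ _+_ (W-outside c∈μ c∉ν L (stage-skip st))
      (trans (cong (h c *_) (sum-zero _ λ i → trans (⟦⟧-guard (jump? _ β i) {y = 0} λ jump → W-outside c∈μ c∉ν L (stage-jump st i jump)) (*-zeroʳ ⟦ jump? _ β i ⟧)))
             (*-zeroʳ (h c)))

    -- The exponent 0 or 1 lets products over varying states run over the fixed list `cells ν`.
    hookIn : State rank → Cell → ℕ
    hookIn β c = hook ν c ^ ⟦ cellIn? β c ⟧

    hookProduct : State rank → ℕ
    hookProduct β = product (map (hookIn β) (cells ν))

    hookProduct-inc : ∀ {β} → Valid β → ∀ i → newCell β i ∈ᶜ ν → hookProduct (inc β i) ≡ hook ν (newCell β i) * hookProduct β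
    hookProduct-inc {β} validβ i new∈ν = product-update (hookIn β) (hookIn (inc β i)) (hook ν (newCell β i)) (cells-unique ν) (∈-cells⁺ ν new∈ν) other self
      where
      other : ∀ u → u ≢ newCell β i → hookIn (inc β i) u ≡ hookIn β u
      other u u≢ = cong (hook ν u ^_) (⟦⟧-cong (cellIn? (inc β i) u) (cellIn? β u)
        (λ u∈ → [ id , (λ u≡ → contradiction u≡ u≢) ]′ (cellIn-inc⁻ validβ i u u∈)) (cellIn-inc⁺ validβ i u))
      self : hookIn (inc β i) (newCell β i) ≡ hook ν (newCell β i) * hookIn β (newCell β i)
      self = trans (cong (hook ν (newCell β i) ^_) (⟦⟧-yes (cellIn? (inc β i) (newCell β i)) (newCell∈inc validβ i)))
                   (cong (λ x → hook ν (newCell β i) * hook ν (newCell β i) ^ x) (sym (⟦⟧-no (cellIn? β (newCell β i)) (newCell∉ validβ i))))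

    -- Path by path: the hook of a letter is at most that of the cell it adds, and the cells added
    -- along a path are those of `μ` outside `β`.
    W-upper : ∀ {μ} L {β} → Stage β L → hookProduct β * W μ (word (hook ν) L) β ≤ hookProduct μ * W μ (word (λ _ → 1) L) β
    W-upper {μ} []      {β} st = ≤-reflexive (go (β ≟ˢ μ))
      where
      go : (d : Dec (β ≡ μ)) → hookProduct β * ⟦ d ⟧ ≡ hookProduct μ * ⟦ d ⟧
      go (yes refl) = refl
      go (no _)     = trans (*-zeroʳ (hookProduct β)) (sym (*-zeroʳ (hookProduct μ)))
    W-upper {μ} (c ∷ L) {β} st = begin
      P * (f β + h * raise k f β)                 ≡⟨ e₁ P (f β) h (raise k f β) ⟩
      P * f β + (P * h) * raise k f β             ≡⟨ cong (P * f β +_) (raise-linear k f (P * h) β) ⟩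
      P * f β + raise k (λ γ → P * h * f γ) β     ≤⟨ +-mono-≤ (W-upper L (stage-skip st)) (sum-mono termwise) ⟩
      Q * g β + raise k (λ γ → Q * g γ) β         ≡⟨ cong (Q * g β +_) (raise-linear k g Q β) ⟨
      Q * g β + Q * raise k g β                   ≡⟨ e₂ Q (g β) (raise k g β) ⟩
      Q * (g β + 1 * raise k g β)                 ∎
      where
      open ≤-Reasoning
      k h P Q : ℕ
      k = position rank c
      h = hook ν c
      P = hookProduct β
      Q = hookProduct μ
      f g : State rank → ℕ
      f = W μ (word (hook ν) L)
      g = W μ (word (λ _ → 1) L)
      e₁ : ∀ p f h r → p * (f + h * r) ≡ p * f + (p * h) * r
      e₁ = solve-∀
      e₂ : ∀ q g r → q * g + q * r ≡ q * (g + 1 * r)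
      e₂ = solve-∀
      termwise : ∀ i → ⟦ jump? k β i ⟧ * (P * h * f (inc β i)) ≤ ⟦ jump? k β i ⟧ * (Q * g (inc β i))
      termwise i = ⟦⟧-guard-≤ (jump? k β i) λ jump → ≤-trans (*-monoˡ-≤ (f (inc β i)) (begin
        P * h                             ≤⟨ *-monoʳ-≤ P (hook-newCell st i jump) ⟩
        P * hook ν (newCell β i)          ≡⟨ *-comm P _ ⟩
        hook ν (newCell β i) * P          ≡⟨ hookProduct-inc (valid st) i (newCell∈ν st i jump) ⟨
        hookProduct (inc β i)             ∎)) (W-upper L (stage-jump st i jump))

    -- `β` is what the letters read so far should have built of `μ`; all that is missing is still to
    -- come.
    Truncation : State rank → List Cell → State rank → Set
    Truncation β L μ = (∀ c → CellIn β c → CellIn μ c) × (∀ c → CellIn μ c → CellIn β c ⊎ c ∈ L)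

    -- One subword is enough: a letter is taken exactly if it lies in `μ`. Every cell is then added
    -- by its own letter and contributes its own hook.
    W-lower : ∀ {μ} → Valid μ → ∀ L {β} → Stage β L → Truncation β L μ →
              hookProduct μ ≤ W μ (word (hook ν) L) β * hookProduct β
    W-lower {μ} validμ [] {β} st (β⊆μ , μ⊆β) =
      ≤-reflexive (trans (cong hookProduct (sym β≡μ)) (sym (trans (cong (_* hookProduct β) (⟦⟧-yes (β ≟ˢ μ) β≡μ)) (*-identityˡ _))))
      where
      β≡μ : β ≡ μ
      β≡μ = cellIn-ext (valid st) validμ β⊆μ λ c c∈ → [ id , (λ ()) ]′ (μ⊆β c c∈)
    W-lower {μ} validμ (c ∷ L) {β} st (β⊆μ , μ⊆β) with cellIn? μ c
    ... | no c∉μ = ≤-trans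
      (W-lower validμ L (stage-skip st) (β⊆μ , λ u u∈ → [ inj₁ , (λ { (here refl) → contradiction u∈ c∉μ ; (there u∈L) → inj₂ u∈L }) ]′ (μ⊆β u u∈)))
      (*-monoˡ-≤ (hookProduct β) (m≤m+n (W μ (word (hook ν) L) β) _))
    ... | yes c∈μ = begin
        hookProduct μ                                              ≤⟨ W-lower validμ L (stage-jump st i jump) truncation′ ⟩
        f (inc β i) * hookProduct (inc β i)                        ≡⟨ cong (f (inc β i) *_) (hookProduct-inc (valid st) i (newCell∈ν st i jump)) ⟩
        f (inc β i) * (hook ν (newCell β i) * hookProduct β)       ≡⟨ e₀ (f (inc β i)) (hook ν (newCell β i)) (hookProduct β) ⟩
        hook ν (newCell β i) * (1 * f (inc β i)) * hookProduct β
          ≡⟨ cong₂ (λ u x → hook ν u * (x * f (inc β i)) * hookProduct β) (sym c≡new) (sym (⟦⟧-yes (jump? k β i) jump)) ⟩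
        hook ν c * (⟦ jump? k β i ⟧ * f (inc β i)) * hookProduct β
          ≤⟨ *-monoˡ-≤ (hookProduct β) (*-monoʳ-≤ (hook ν c) (term≤sum (λ i → ⟦ jump? k β i ⟧ * f (inc β i)) i)) ⟩
        hook ν c * raise k f β * hookProduct β                     ≤⟨ *-monoˡ-≤ (hookProduct β) (m≤n+m _ (f β)) ⟩
        (f β + hook ν c * raise k f β) * hookProduct β             ∎
      where
      open ≤-Reasoning
      k : ℕ
      k = position rank c
      f : State rank → ℕ
      f = W μ (word (hook ν) L)
      e₀ : ∀ a b c → a * (b * c) ≡ b * (1 * a) * c
      e₀ = solve-∀
      a b : ℕ
      a = proj₁ c
      b = proj₂ c
      a<r : a < rank
      a<r = at-positive μ c∈μ
      i : Fin rank
      i = fromℕ< a<r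
      toℕ-i : toℕ i ≡ a
      toℕ-i = toℕ-fromℕ< a<r
      βi≡ : lookup β i ≡ at β a
      βi≡ = trans (sym (at-lookup β i)) (cong (at β) toℕ-i)
      c∉β : ¬ CellIn β c
      c∉β c∈β = ≺-irrefl (All.head (below st c∈β))
      earlier : ∀ u → u ≺ c → CellIn μ u → CellIn β u
      earlier u u≺c u∈μ with μ⊆β u u∈μ
      ... | inj₁ u∈β          = u∈β
      ... | inj₂ (here refl)  = contradiction u≺c ≺-irrefl
      ... | inj₂ (there u∈L)  = contradiction (≺-trans u≺c (All.lookup (AllPairs.head (sorted st)) u∈L)) ≺-irrefl
      -- The left neighbour of the cell belongs to `μ` and is read earlier, so it is in `β`: the row
      -- ends just before the cell. In column 0 the `floor` takes its place.
      at≡ : ∀ b → CellIn μ (a , b) → ¬ CellIn β (a , b) → (∀ u → u ≺ (a , b) → CellIn μ u → CellIn β u) → at β a ≡ position rank (a , b)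
      at≡ zero    c∈μ c∉β earlier = ≤-antisym (≮⇒≥ c∉β) (floor (valid st) a a<r)
      at≡ (suc b) c∈μ c∉β earlier = ≤-antisym (≮⇒≥ c∉β) (earlier (a , b) (inj₂ (refl , ≤-refl)) (closed validμ ≤-refl (n≤1+n b) c∈μ))
      -- A row at `k + 1` would have to lie above row `a`. But the cell above `c` has been read, so
      -- every row above is already beyond `k + 1`.
      add : Addable β i
      add l eq = no-row a refl
        where
        βl≡ : at β (toℕ l) ≡ suc k
        βl≡ = trans (at-lookup β l) (trans eq (cong suc (trans βi≡ (at≡ b c∈μ c∉β earlier))))
        l<a : toℕ l < a
        l<a = subst (toℕ l <_) toℕ-i (lookup-< (valid st) (≤-reflexive (sym eq)))
        no-row : ∀ x → ¬ (a ≡ x)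
        no-row zero    a≡0  = contradiction (subst (toℕ l <_) a≡0 l<a) λ ()
        no-row (suc x) a≡sx = <-irrefl refl (≤-trans (subst (_< at β x) pos≡ (earlier (x , b) (inj₁ (≤-reflexive (sym a≡sx))) (closed validμ x≤a ≤-refl c∈μ))) atx≤)
          where
          x≤a : x ≤ a
          x≤a = ≤-trans (n≤1+n x) (≤-reflexive (sym a≡sx))
          pos≡ : position rank (x , b) ≡ suc k
          pos≡ = trans (position-suc x b (subst (_< rank) a≡sx a<r)) (cong (λ y → suc (position rank (y , b))) (sym a≡sx))
          atx≤ : at β x ≤ suc k
          atx≤ with m≤n⇒m<n∨m≡n (≤-pred (subst (toℕ l <_) a≡sx l<a))
          ... | inj₁ l<x = ≤-trans (<⇒≤ (antitone-< (valid st) l<x (≤-<-trans x≤a a<r))) (≤-reflexive βl≡)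
          ... | inj₂ l≡x = ≤-reflexive (trans (cong (at β) (sym l≡x)) βl≡)
      jump : Jump k β i
      jump = trans βi≡ (at≡ b c∈μ c∉β earlier) , add
      c≡new : c ≡ newCell β i
      c≡new = trans (cong (_, b) (sym toℕ-i)) (position-self (valid st) i (trans (cong (λ x → position rank (x , b)) toℕ-i) (sym (proj₁ jump))))
      truncation′ : Truncation (inc β i) L μ
      truncation′ = (λ u u∈ → [ β⊆μ u , (λ u≡ → subst (CellIn μ) (trans c≡new (sym u≡)) c∈μ) ]′ (cellIn-inc⁻ (valid st) i u u∈)) ,
        λ u u∈ → [ inj₁ ∘ cellIn-inc⁺ (valid st) i u
                 , (λ { (here refl) → inj₁ (subst (CellIn (inc β i)) (sym c≡new) (newCell∈inc (valid st) i)) ; (there u∈L) → inj₂ u∈L }) ]′ (μ⊆β u u∈)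

  total-inc : ∀ {r} (β : State r) i → total id (inc β i) ≡ suc (total id β)
  total-inc (x ∷ β) zero    = trans (sum-suc _) (cong suc (sym (sum-suc _)))
  total-inc (x ∷ β) (suc i) = trans (sum-suc _) (trans (cong (x +_) (total-inc β i)) (trans (+-suc x _) (cong suc (sym (sum-suc _)))))

  raise-bound : ∀ {r} k (f : State r → ℕ) β B → Distinct β → (∀ i → Jump k β i → f (inc β i) ≤ B) → raise k f β ≤ B
  raise-bound k f β B dist f≤B with any? (jump? k β)
  ... | no ∄            = ≤-trans (≤-reflexive (sum-zero _ λ i → cong (_* f (inc β i)) (⟦⟧-no (jump? k β i) λ jump → ∄ (i , jump)))) z≤n
  ... | yes (i , jump) = ≤-trans (≤-reflexive (trans
      (sum-single _ i λ j j≢i → cong (_* f (inc β j)) (⟦⟧-no (jump? k β j) λ (βj≡k , _) → j≢i (dist j i (trans βj≡k (sym (proj₁ jump))))))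
      (trans (cong (_* f (inc β i)) (⟦⟧-yes (jump? k β i) jump)) (*-identityˡ _))))
    (f≤B i jump)

  -- Each letter raises the total of the state by at most one.
  W-short : ∀ {r} (μ : State r) L β → Distinct β → total id β + length L < total id μ → W μ L β ≡ 0
  W-short μ []            β dist short = ⟦⟧-no (β ≟ˢ μ) λ { refl → <-irrefl (+-identityʳ _) short }
  W-short μ ((k , h) ∷ L) β dist short = cong₂ _+_ (W-short μ L β dist (≤-<-trans (+-monoʳ-≤ (total id β) (n≤1+n _)) short))
    (trans (cong (h *_) (n≤0⇒n≡0 (raise-bound k (W μ L) β 0 dist λ i (_ , add) → ≤-reflexive
      (W-short μ L (inc β i) (inc-distinct β i dist add) (subst (_< total id μ) (trans (+-suc _ _) (cong (_+ length L) (sym (total-inc β i)))) short)))))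
    (*-zeroʳ h))

  -- No letter can be spared: after skipping one, the rest is too short by `W-short`. Only the full
  -- word remains.
  W-exact : ∀ {r} (μ : State r) L β → Distinct β → total id β + length L ≡ total id μ → W μ L β ≤ product (map proj₂ L)
  W-exact μ []            β dist exact = ⟦⟧≤1 (β ≟ˢ μ)
  W-exact μ ((k , h) ∷ L) β dist exact = ≤-trans
    (≤-reflexive (cong (_+ h * raise k (W μ L) β) (W-short μ L β dist (≤-trans (≤-reflexive (sym (+-suc _ _))) (≤-reflexive exact)))))
    (*-monoʳ-≤ h (raise-bound k (W μ L) β (product (map proj₂ L)) dist λ i (_ , add) →
      W-exact μ L (inc β i) (inc-distinct β i dist add) (trans (cong (_+ length L) (total-inc β i)) (trans (sym (+-suc _ _)) exact))))

  -- Subwords are excited diagrams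

  if-yes : {P A : Set} (d : Dec P) {x y : A} → P → (if does d then x else y) ≡ x
  if-yes d p rewrite dec-true d p = refl

  if-no : {P A : Set} (d : Dec P) {x y : A} → ¬ P → (if does d then x else y) ≡ y
  if-no d ¬p rewrite dec-false d ¬p = refl

  count : {A : Set} {P : A → Set} → Decidable P → List A → ℕ
  count P? xs = length (filter P? xs)

  count-map : {A B : Set} {P : B → Set} (P? : Decidable P) (f : A → B) (xs : List A) → count P? (map f xs) ≡ count (P? ∘ f) xs
  count-map P? f []       = refl
  count-map P? f (x ∷ xs) with P? (f x)
  ... | yes _ = cong suc (count-map P? f xs)
  ... | no _  = count-map P? f xs

  count-subsets : ∀ {n} {P : Subset (suc n) → Set} (P? : Decidable P) →
                  count P? (subsets (suc n)) ≡ count (P? ∘ (inside ∷_)) (subsets n) + count (P? ∘ (outside ∷_)) (subsets n)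
  count-subsets {n} P? = begin
    count P? (map (inside ∷_) (subsets n) ++ map (outside ∷_) (subsets n) ++ [])
      ≡⟨ cong (λ xs → count P? (map (inside ∷_) (subsets n) ++ xs)) (++-identityʳ _) ⟩
    count P? (map (inside ∷_) (subsets n) ++ map (outside ∷_) (subsets n))
      ≡⟨ cong length (filter-++ P? (map (inside ∷_) (subsets n)) _) ⟩
    length (filter P? (map (inside ∷_) (subsets n)) ++ filter P? (map (outside ∷_) (subsets n)))
      ≡⟨ length-++ (filter P? (map (inside ∷_) (subsets n))) ⟩
    count P? (map (inside ∷_) (subsets n)) + count P? (map (outside ∷_) (subsets n))
      ≡⟨ cong₂ _+_ (count-map P? (inside ∷_) (subsets n)) (count-map P? (outside ∷_) (subsets n)) ⟩
    count (P? ∘ (inside ∷_)) (subsets n) + count (P? ∘ (outside ∷_)) (subsets n) ∎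
    where open ≡-Reasoning

  vec-ext : {A : Set} {n : ℕ} {xs ys : Vec A n} → (∀ i → lookup xs i ≡ lookup ys i) → xs ≡ ys
  vec-ext {xs = xs} {ys} eq = trans (sym (tabulate∘lookup xs)) (trans (tabulate-cong eq) (tabulate∘lookup ys))

  _≟ᵘ_ : (u v : Cell) → Dec (u ≡ v)
  _≟ᵘ_ = ≡-dec _≟_ _≟_

  put : (Cell → Bool) → Cell → Cell → Bool
  put χ v u = if does (u ≟ᵘ v) then true else χ u

  -- A diagram between that of `μ` and the excited one: `D` decides on the letters of `L`, `β` on
  -- all other cells. At the end of a path it is the diagram of `μ`; at the start of the full word
  -- it is `D`.
  mix : ∀ {r} (L : List Cell) → Subset (length L) → State r → Cell → Bool
  mix []      []      β u = does (cellIn? β u)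
  mix (c ∷ L) (b ∷ D) β u = if does (u ≟ᵘ c) then b else mix L D β u

  mix-∉ : ∀ {r} L D (β : State r) {u} → u ∉ L → mix L D β u ≡ does (cellIn? β u)
  mix-∉ []      []      β u∉ = refl
  mix-∉ (c ∷ L) (b ∷ D) β {u} u∉ = trans (if-no (u ≟ᵘ c) (u∉ ∘ here)) (mix-∉ L D β (u∉ ∘ there))

  mix-cong : ∀ {r} L D {β γ : State r} {u} → does (cellIn? β u) ≡ does (cellIn? γ u) → mix L D β u ≡ mix L D γ u
  mix-cong []      []      eq = eq
  mix-cong (c ∷ L) (b ∷ D) {u = u} eq = cong (if does (u ≟ᵘ c) then b else_) (mix-cong L D eq)

  mix-lookup : ∀ {r} L D (β : State r) → Unique L → ∀ p → mix L D β (List.lookup L p) ≡ lookup D p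
  mix-lookup (c ∷ L) (b ∷ D) β _          zero    = if-yes (c ≟ᵘ c) refl
  mix-lookup (c ∷ L) (b ∷ D) β (c∉ ∷ uni) (suc p) =
    trans (if-no (List.lookup L p ≟ᵘ c) λ eq → All.lookup c∉ (∈-lookup p) (sym eq)) (mix-lookup L D β uni p)

  module _ (ν : Partition) where

    data Path (μ : State (rank ν)) : (L : List Cell) → Subset (length L) → State (rank ν) → Set where
      done : Path μ [] [] μ
      skip : ∀ {c L D β} → Path μ L D β → Path μ (c ∷ L) (outside ∷ D) β
      take : ∀ {c L D β} i → Jump (position (rank ν) c) β i → Path μ L D (inc β i) → Path μ (c ∷ L) (inside ∷ D) β

    -- A set of letters admits at most one path, since at most one row can jump at a letter. Hence
    -- paths are counted by their sets of letters.
    paths≤count : ∀ μ L {β} → Stage ν β L → {P : Subset (length L) → Set} (P? : Decidable P) → (∀ {D} → Path μ L D β → P D) →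
                  W μ (word ν (λ _ → 1) L) β ≤ count P? (subsets (length L))
    paths≤count μ []      {β} st P? path⇒P with P? []
    ... | yes _  = ⟦⟧≤1 (β ≟ˢ μ)
    ... | no ¬P  = ≤-reflexive (⟦⟧-no (β ≟ˢ μ) λ { refl → ¬P (path⇒P done) })
    paths≤count μ (c ∷ L) {β} st P? path⇒P = begin
      W μ (word ν (λ _ → 1) L) β + 1 * raise k (W μ (word ν (λ _ → 1) L)) β
        ≡⟨ trans (cong (W μ (word ν (λ _ → 1) L) β +_) (*-identityˡ _)) (+-comm (W μ (word ν (λ _ → 1) L) β) _) ⟩
      raise k (W μ (word ν (λ _ → 1) L)) β + W μ (word ν (λ _ → 1) L) β
        ≤⟨ +-mono-≤ (raise-bound k (W μ (word ν (λ _ → 1) L)) β _ (valid⇒distinct (valid st)) λ i jump →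
                       paths≤count μ L (stage-jump ν st i jump) (P? ∘ (inside ∷_)) (path⇒P ∘ take i jump))
                    (paths≤count μ L (stage-skip ν st) (P? ∘ (outside ∷_)) (path⇒P ∘ skip)) ⟩
      count (P? ∘ (inside ∷_)) (subsets (length L)) + count (P? ∘ (outside ∷_)) (subsets (length L))
        ≡⟨ count-subsets P? ⟨
      count P? (subsets (suc (length L))) ∎
      where
      open ≤-Reasoning
      k : ℕ
      k = position (rank ν) c

    toDiagram : (Cell → Bool) → Diagram ν
    toDiagram χ = tabulate (χ ∘ cellAt ν)

    toDiagram-cong : ∀ {χ χ′} → (∀ u → u ∈ᶜ ν → χ u ≡ χ′ u) → toDiagram χ ≡ toDiagram χ′
    toDiagram-cong eq = tabulate-cong λ p → eq _ (∈-cells⁻ ν (∈-lookup p))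

    infix 4 _⟶*_
    _⟶*_ : Diagram ν → Diagram ν → Set
    _⟶*_ = Star (ExcitedMove ν)

    module _ (χ : Cell → Bool) where

      vacant-put : ∀ {v u} → u ∈ᶜ ν → u ≢ v → χ u ≡ false → Vacant ν (toDiagram (put χ v)) u
      vacant-put {v} {u} u∈ u≢v χu = q , q-at , λ q∈ → contradiction (trans (sym ([]=⇒lookup q∈)) unoccupied) λ ()
        where
        q : Fin (length (cells ν))
        q = index (∈-cells⁺ ν u∈)
        q-at : cellAt ν q ≡ u
        q-at = sym (lookup-index (∈-cells⁺ ν u∈))
        unoccupied : lookup (toDiagram (put χ v)) q ≡ outside
        unoccupied = trans (lookup∘tabulate (put χ v ∘ cellAt ν) q) (trans (cong (put χ v) q-at) (trans (if-no (u ≟ᵘ v) u≢v) χu))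

      move : ∀ {i j} → (suc i , suc j) ∈ᶜ ν → χ (i , j) ≡ false → χ (suc i , j) ≡ false → χ (i , suc j) ≡ false → χ (suc i , suc j) ≡ false →
             ExcitedMove ν (toDiagram (put χ (i , j))) (toDiagram (put χ (suc i , suc j)))
      move {i} {j} v′∈ χv χ₁ χ₂ χ₃ = p , q ,
        (lookup⇒[]= p _ (trans (lookup∘tabulate (put χ v ∘ cellAt ν) p) (trans (cong (put χ v) p-at) (if-yes (v ≟ᵘ v) refl)))
        , subst (λ u → Vacant ν D (suc (proj₁ u) , proj₂ u)) (sym p-at) (vacant-put (∈ᶜ-closed ν ≤-refl (n≤1+n j) v′∈) (λ ()) χ₁)
        , subst (λ u → Vacant ν D (proj₁ u , suc (proj₂ u))) (sym p-at) (vacant-put (∈ᶜ-closed ν (n≤1+n i) ≤-refl v′∈) (λ ()) χ₂)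
        , subst (λ u → Vacant ν D (suc (proj₁ u) , suc (proj₂ u))) (sym p-at) (vacant-put v′∈ (λ ()) χ₃)) ,
        trans q-at (cong (λ u → suc (proj₁ u) , suc (proj₂ u)) (sym p-at)) , vec-ext entry
        where
        v v′ : Cell
        v  = i , j
        v′ = suc i , suc j
        v∈ : v ∈ᶜ ν
        v∈ = ∈ᶜ-closed ν (n≤1+n i) (n≤1+n j) v′∈
        p q : Fin (length (cells ν))
        p = index (∈-cells⁺ ν v∈)
        q = index (∈-cells⁺ ν v′∈)
        p-at : cellAt ν p ≡ v
        p-at = sym (lookup-index (∈-cells⁺ ν v∈))
        q-at : cellAt ν q ≡ v′
        q-at = sym (lookup-index (∈-cells⁺ ν v′∈))
        D : Diagram ν
        D = toDiagram (put χ v)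
        entry : ∀ x → lookup (toDiagram (put χ v′)) x ≡ lookup ((D [ p ]≔ outside) [ q ]≔ inside) x
        entry x = trans (lookup∘tabulate (put χ v′ ∘ cellAt ν) x) (go (x ≟ᶠ q) (x ≟ᶠ p))
          where
          go : Dec (x ≡ q) → Dec (x ≡ p) → put χ v′ (cellAt ν x) ≡ lookup ((D [ p ]≔ outside) [ q ]≔ inside) x
          go (yes refl) _ = trans (trans (cong (put χ v′) q-at) (if-yes (v′ ≟ᵘ v′) refl)) (sym (lookup∘update q (D [ p ]≔ outside) inside))
          go (no x≢q) (yes refl) = trans (trans (cong (put χ v′) p-at) (trans (if-no (v ≟ᵘ v′) λ ()) χv))
            (sym (trans (lookup∘update′ x≢q (D [ p ]≔ outside) inside) (lookup∘update p D outside)))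
          go (no x≢q) (no x≢p) = trans (if-no (cellAt ν x ≟ᵘ v′) (λ eq → x≢q (cellAt-injective ν (trans eq (sym q-at)))))
            (sym (trans (lookup∘update′ x≢q (D [ p ]≔ outside) inside) (trans (lookup∘update′ x≢p D outside)
                 (trans (lookup∘tabulate (put χ v ∘ cellAt ν) x) (if-no (cellAt ν x ≟ᵘ v) λ eq → x≢p (cellAt-injective ν (trans eq (sym p-at))))))))

      -- Vacancy of the whole square supplies, at each step down the diagonal, the three vacant
      -- neighbours that make the cell active.
      slide : ∀ i j d → (i + d , j + d) ∈ᶜ ν →
              (∀ x y → i ≤ x → j ≤ y → x ≤ i + d → y ≤ j + d → χ (x , y) ≡ false) →
              toDiagram (put χ (i , j)) ⟶* toDiagram (put χ (i + d , j + d))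
      slide i j zero    _  _   = subst (λ u → toDiagram (put χ (i , j)) ⟶* toDiagram (put χ u)) (cong₂ _,_ (sym (+-identityʳ i)) (sym (+-identityʳ j))) ε
      slide i j (suc d) c∈ vac rewrite +-suc i d | +-suc j d =
        move (∈ᶜ-closed ν (s≤s (m≤m+n i d)) (s≤s (m≤m+n j d)) c∈)
          (vac i j ≤-refl ≤-refl i≤ j≤) (vac (suc i) j (n≤1+n i) ≤-refl si≤ j≤) (vac i (suc j) ≤-refl (n≤1+n j) i≤ sj≤)
          (vac (suc i) (suc j) (n≤1+n i) (n≤1+n j) si≤ sj≤)
        ◅ slide (suc i) (suc j) d c∈ λ x y i≤x j≤y → vac x y (≤-trans (n≤1+n i) i≤x) (≤-trans (n≤1+n j) j≤y)
        where
        si≤ : suc i ≤ suc (i + d)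
        si≤ = s≤s (m≤m+n i d)
        sj≤ : suc j ≤ suc (j + d)
        sj≤ = s≤s (m≤m+n j d)
        i≤ : i ≤ suc (i + d)
        i≤ = ≤-trans (n≤1+n i) si≤
        j≤ : j ≤ suc (j + d)
        j≤ = ≤-trans (n≤1+n j) sj≤

    ≺-∉ : ∀ {c L} → All (c ≺_) L → c ∉ L
    ≺-∉ c≺L c∈L = ≺-irrefl (All.lookup c≺L c∈L)

    -- For a letter c that is taken, the cell added to β slides down its diagonal to c; the cells it
    -- passes are vacant because they do not lie in β and are read before L.
    path⇒reachable : ∀ {μ L D β} → Stage ν β L → Path μ L D β →
                     toDiagram (does ∘ cellIn? μ) ⟶* toDiagram (mix L D β)
    path⇒reachable st done = ε
    path⇒reachable {μ} {c ∷ L} {_ ∷ D} {β} st (skip path) =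
      subst (toDiagram (does ∘ cellIn? μ) ⟶*_) (toDiagram-cong λ u _ → eq u (u ≟ᵘ c)) (path⇒reachable (stage-skip ν st) path)
      where
      eq : ∀ u → (d : Dec (u ≡ c)) → mix L D β u ≡ (if does d then false else mix L D β u)
      eq u (no _)     = refl
      eq u (yes refl) = trans (mix-∉ L D β (≺-∉ (AllPairs.head (sorted st)))) (dec-false (cellIn? β u) λ u∈ → ≺-irrefl (All.head (below st u∈)))
    path⇒reachable {μ} {c ∷ L} {_ ∷ D} {β} st (take i jump path) =
      subst (toDiagram (does ∘ cellIn? μ) ⟶*_) (toDiagram-cong λ u _ → eq u (u ≟ᵘ newCell β i)) (path⇒reachable (stage-jump ν st i jump) path)
      ◅◅ final
      where
      χ : Cell → Bool
      χ = mix L D β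
      vacant : ∀ u → u ≡ c ⊎ u ≺ c → ¬ CellIn β u → χ u ≡ false
      vacant u u≼c u∉β = trans (mix-∉ L D β (≺-∉ u≺L)) (dec-false (cellIn? β u) u∉β)
        where
        u≺L : All (u ≺_) L
        u≺L = [ (λ { refl → AllPairs.head (sorted st) }) , (λ u≺c → All.map (≺-trans u≺c) (AllPairs.head (sorted st))) ]′ u≼c
      eq : ∀ u → (d : Dec (u ≡ newCell β i)) → mix L D (inc β i) u ≡ (if does d then true else χ u)
      eq u (yes refl) = trans (mix-∉ L D (inc β i) (≺-∉ (below (stage-jump ν st i jump) new∈))) (dec-true (cellIn? (inc β i) u) new∈)
        where
        new∈ : CellIn (inc β i) u
        new∈ = newCell∈inc (valid st) i
      eq u (no u≢)    = mix-cong L D (does-⇔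
        (mk⇔ (λ u∈ → [ id , (λ u≡ → contradiction u≡ u≢) ]′ (cellIn-inc⁻ (valid st) i u u∈)) (cellIn-inc⁺ (valid st) i u))
        (cellIn? (inc β i) u) (cellIn? β u))
      final : toDiagram (put χ (newCell β i)) ⟶* toDiagram (put χ c)
      final with jump-diagonal ν st i jump
      ... | d , refl = slide χ (toℕ i) (proj₂ (newCell β i)) d (All.head (cells⊆ st)) λ x y i≤x j≤y x≤ y≤ →
        vacant (x , y) (before x≤ y≤) (newCell∉ (valid st) i ∘ closed (valid st) i≤x j≤y)
        where
        before : ∀ {x y a b} → x ≤ a → y ≤ b → (x , y) ≡ (a , b) ⊎ (x , y) ≺ (a , b)
        before x≤ y≤ with m≤n⇒m<n∨m≡n x≤ | m≤n⇒m<n∨m≡n y≤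
        ... | inj₁ x< | _        = inj₂ (inj₁ x<)
        ... | inj₂ x≡ | inj₁ y<  = inj₂ (inj₂ (x≡ , y<))
        ... | inj₂ refl | inj₂ refl = inj₁ refl

    ∅ : State (rank ν)
    ∅ = stateOf (rank ν) λ _ → 0

    stage-∅ : Stage ν ∅ (cells ν)
    stage-∅ = record
      { valid  = valid-stateOf λ _ → z≤n
      ; within = λ {c} c∈ → contradiction (cellIn-stateOf⁻ {rank ν} {λ _ → 0} (proj₁ c) (proj₂ c) c∈) λ ()
      ; below  = λ {c} c∈ → contradiction (cellIn-stateOf⁻ {rank ν} {λ _ → 0} (proj₁ c) (proj₂ c) c∈) λ ()
      ; sorted = cells-sorted ν
      ; cells⊆ = All.tabulate (∈-cells⁻ ν) }

  innerState : (S : SkewShape) → State (rank (outer S))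
  innerState S = stateOf (rank (outer S)) (row (inner S))

  paths≤ξ : ∀ S → W (innerState S) (word (outer S) (λ _ → 1) (cells (outer S))) (∅ (outer S)) ≤ ξ S
  paths≤ξ S = paths≤count ν (innerState S) (cells ν) (stage-∅ ν) (isExcited? S) excited
    where
    ν : Partition
    ν = outer S
    excited : ∀ {D} → Path ν (innerState S) (cells ν) D (∅ ν) → IsExcited S D
    excited {D} path = subst₂ (_⟶*_ ν) (toDiagram-cong ν start)
      (vec-ext λ p → trans (lookup∘tabulate (mix (cells ν) D (∅ ν) ∘ cellAt ν) p) (mix-lookup (cells ν) D (∅ ν) (cells-unique ν) p))
      (path⇒reachable ν (stage-∅ ν) path)
      where
      start : ∀ u → u ∈ᶜ ν → does (cellIn? (innerState S) u) ≡ does (u ∈ᶜ? inner S)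
      start (i , j) u∈ = does-⇔ (mk⇔ (cellIn-stateOf⁻ {rank ν} i j) (cellIn-stateOf⁺ (part-support (parts ν) u∈)))
        (cellIn? (innerState S) (i , j)) ((i , j) ∈ᶜ? inner S)

  -- Counting linear extensions

  unique-↭ : {A : Set} {xs ys : List A} → Unique xs → Unique ys → (∀ {x} → x ∈ xs → x ∈ ys) → (∀ {x} → x ∈ ys → x ∈ xs) → xs ↭ ys
  unique-↭ uxs uys to from = ∼bag⇒↭ (unique∧set⇒bag uxs uys (mk⇔ to from))

  count-⇔ : {A : Set} {P Q : A → Set} (P? : Decidable P) (Q? : Decidable Q) → (∀ {x} → P x → Q x) → (∀ {x} → Q x → P x) →
            ∀ xs → count P? xs ≡ count Q? xs
  count-⇔ P? Q? to from xs = cong length (filter-≐ P? Q? (to , from) xs)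

  length-concatMap : {A B : Set} (f : A → List B) (xs : List A) → length (concatMap f xs) ≡ sumˡ (map (length ∘ f) xs)
  length-concatMap f []       = refl
  length-concatMap f (x ∷ xs) = trans (length-++ (f x)) (cong₂ _+_ refl (length-concatMap f xs))

  allVecs-unique : {A : Set} {xs : List A} → Unique xs → ∀ n → Unique (allVecs xs n)
  allVecs-unique u zero    = [] ∷ []
  allVecs-unique u (suc n) = cartesianProductWith⁺ _∷_ ∷-injective u (allVecs-unique u n)

  ∈-allVecs : {A : Set} {xs : List A} → (∀ x → x ∈ xs) → ∀ {n} (v : Vec A n) → v ∈ allVecs xs n
  ∈-allVecs all []      = here refl
  ∈-allVecs all (x ∷ v) = ∈-cartesianProductWith⁺ _∷_ (all x) (∈-allVecs all v)

  punchIn-view : ∀ {n} (p q : Fin (suc n)) → q ≡ p ⊎ ∃[ j ] q ≡ punchIn p j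
  punchIn-view p q with p ≟ᶠ q
  ... | yes p≡q = inj₁ (sym p≡q)
  ... | no p≢q  = inj₂ (punchOut p≢q , sym (punchIn-punchOut p≢q))

  module LinearExtensions {A : Set} {_◁_ : A → A → Set} (_◁?_ : ∀ u v → Dec (u ◁ v)) where

    Increasing : ∀ {n} → (Fin n → A) → Vec (Fin n) n → Set
    Increasing c T = ∀ p q → c p ◁ c q → (T ‼ p) <ᶠ (T ‼ q)

    IsLE : ∀ {n} → (Fin n → A) → Vec (Fin n) n → Set
    IsLE c T = Bijective _≡_ _≡_ (T ‼_) × Increasing c T

    isLE? : ∀ {n} (c : Fin n → A) → Decidable (IsLE c)
    isLE? c T = bijective? (T ‼_) ×-dec all? λ p → all? λ q → (c p ◁? c q) →-dec ((T ‼ p) <ᶠ? (T ‼ q))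

    extensions : ∀ {n} → (Fin n → A) → List (Vec (Fin n) n)
    extensions {n} c = filter (isLE? c) (fillings n)

    #LE : ∀ {n} → (Fin n → A) → ℕ
    #LE c = length (extensions c)

    extensions-unique : ∀ {n} (c : Fin n → A) → Unique (extensions c)
    extensions-unique {n} c = filter⁺ (isLE? c) (allVecs-unique (allFin⁺ n) n)

    ∈-extensions : ∀ {n} (c : Fin n → A) {T} → IsLE c T → T ∈ extensions c
    ∈-extensions c {T} le = ∈-filter⁺ (isLE? c) (∈-allVecs ∈-allFin T) le

    ∈-extensions⁻ : ∀ {n} (c : Fin n → A) {T} → T ∈ extensions c → IsLE c T
    ∈-extensions⁻ {n} c T∈ = proj₂ (∈-filter⁻ (isLE? c) {xs = fillings n} T∈)

    Minimal : ∀ {n} → (Fin n → A) → Fin n → Set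
    Minimal c p = ∀ q → ¬ (c q ◁ c p)

    minimal? : ∀ {n} (c : Fin n → A) → Decidable (Minimal c)
    minimal? c p = all? λ q → ¬? (c q ◁? c p)

    prepend : ∀ {n} → Fin (suc n) → Vec (Fin n) n → Vec (Fin (suc n)) (suc n)
    prepend p T = insertAt (Vec.map suc T) p zero

    module _ {n : ℕ} (p : Fin (suc n)) (T : Vec (Fin n) n) where

      prepend-self : prepend p T ‼ p ≡ zero
      prepend-self = insertAt-lookup (Vec.map suc T) p zero

      prepend-other : ∀ j → prepend p T ‼ punchIn p j ≡ suc (T ‼ j)
      prepend-other j = trans (insertAt-punchIn (Vec.map suc T) p zero j) (lookup-map j suc T)

    prepend-injective : ∀ {n} (p : Fin (suc n)) {T T′} → prepend p T ≡ prepend p T′ → T ≡ T′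
    prepend-injective p {T} {T′} eq = vec-ext λ j → suc-injectiveᶠ
      (trans (sym (prepend-other p T j)) (trans (cong (_‼ punchIn p j) eq) (prepend-other p T′ j)))

    module _ {n : ℕ} (c : Fin (suc n) → A) where

      prepend-isLE : ∀ p {T} → Minimal c p → IsLE (c ∘ punchIn p) T → IsLE c (prepend p T)
      prepend-isLE p {T} min ((inj , sur) , incr) = ((λ {x} {y} → injective x y) , strictlySurjective⇒surjective surjective) , increasing
        where
        at-p : prepend p T ‼ p ≡ zero
        at-p = prepend-self p T
        off-p : ∀ j → prepend p T ‼ punchIn p j ≡ suc (T ‼ j)
        off-p = prepend-other p T
        injective : ∀ x y → prepend p T ‼ x ≡ prepend p T ‼ y → x ≡ y
        injective x y eq with punchIn-view p x | punchIn-view p y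
        ... | inj₁ refl       | inj₁ refl       = refl
        ... | inj₁ refl       | inj₂ (k , refl) = contradiction (trans (sym at-p) (trans eq (off-p k))) λ ()
        ... | inj₂ (j , refl) | inj₁ refl       = contradiction (trans (sym at-p) (trans (sym eq) (off-p j))) λ ()
        ... | inj₂ (j , refl) | inj₂ (k , refl) = cong (punchIn p) (inj (suc-injectiveᶠ (trans (sym (off-p j)) (trans eq (off-p k)))))
        surjective : ∀ y → ∃[ x ] prepend p T ‼ x ≡ y
        surjective zero    = p , at-p
        surjective (suc y) = punchIn p (proj₁ (sur y)) , trans (off-p _) (cong suc (proj₂ (sur y) refl))
        increasing : Increasing c (prepend p T)
        increasing x y x◁y with punchIn-view p x | punchIn-view p y
        ... | _               | inj₁ refl       = contradiction x◁y (min x)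
        ... | inj₁ refl       | inj₂ (k , refl) = subst₂ _<ᶠ_ (sym at-p) (sym (off-p k)) z<s
        ... | inj₂ (j , refl) | inj₂ (k , refl) = subst₂ _<ᶠ_ (sym (off-p j)) (sym (off-p k)) (s<s (incr j k x◁y))

      -- The place of the smallest entry is minimal, because a cell before it would need a smaller
      -- entry.
      isLE-prepend : ∀ {T} → IsLE c T → ∃[ p ] ∃[ T′ ] Minimal c p × IsLE (c ∘ punchIn p) T′ × T ≡ prepend p T′
      isLE-prepend {T} ((inj , sur) , incr) = p , T′ , min , ((injective , strictlySurjective⇒surjective surjective) , increasing) , vec-ext agree
        where
        p : Fin (suc n)
        p = proj₁ (sur zero)
        at-p : T ‼ p ≡ zero
        at-p = proj₂ (sur zero) refl
        min : Minimal c p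
        min q q◁p = contradiction (subst ((T ‼ q) <ᶠ_) at-p (incr q p q◁p)) λ ()
        nonzero : ∀ j → zero ≢ T ‼ punchIn p j
        nonzero j 0≡ = punchInᵢ≢i p j (inj (trans (sym 0≡) (sym at-p)))
        T′ : Vec (Fin n) n
        T′ = tabulate λ j → punchOut (nonzero j)
        off-p : ∀ j → T ‼ punchIn p j ≡ suc (T′ ‼ j)
        off-p j = trans (sym (punchIn-punchOut (nonzero j))) (cong suc (sym (lookup∘tabulate (λ j → punchOut (nonzero j)) j)))
        injective : Injective _≡_ _≡_ (T′ ‼_)
        injective {j} {k} eq = punchIn-injective p j k (inj (trans (off-p j) (trans (cong suc eq) (sym (off-p k)))))
        surjective : ∀ y → ∃[ j ] T′ ‼ j ≡ y
        surjective y with punchIn-view p (proj₁ (sur (suc y)))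
        ... | inj₁ q≡p       = contradiction (trans (sym at-p) (proj₂ (sur (suc y)) (sym q≡p))) λ ()
        ... | inj₂ (j , q≡)  = j , suc-injectiveᶠ (trans (sym (off-p j)) (proj₂ (sur (suc y)) (sym q≡)))
        increasing : Increasing (c ∘ punchIn p) T′
        increasing j k j◁k = s<s⁻¹ (subst₂ _<ᶠ_ (off-p j) (off-p k) (incr _ _ j◁k))
        agree : ∀ q → T ‼ q ≡ prepend p T′ ‼ q
        agree q with punchIn-view p q
        ... | inj₁ refl       = trans at-p (sym (prepend-self p T′))
        ... | inj₂ (j , refl) = trans (off-p j) (sym (prepend-other p T′ j))

      private
        minima : List (Fin (suc n))
        minima = filter (minimal? c) (allFin (suc n))

        block : Fin (suc n) → List (Vec (Fin (suc n)) (suc n))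
        block p = map (prepend p) (extensions (c ∘ punchIn p))

        block-disjoint : ∀ {p q} → p ≢ q → Disjoint (block p) (block q)
        block-disjoint {p} {q} p≢q (T∈p , T∈q) with ∈-map⁻ (prepend p) T∈p | ∈-map⁻ (prepend q) T∈q
        ... | T , _ , refl | T′ , _ , eq with punchIn-view q p
        ...   | inj₁ p≡q      = p≢q p≡q
        ...   | inj₂ (j , p≡) = contradiction (trans (sym (prepend-self p T)) (trans (cong (_‼ p) eq) (trans (cong (prepend q T′ ‼_) p≡) (prepend-other q T′ j)))) λ ()

        blocks-unique : Unique (concatMap block minima)
        blocks-unique = concat⁺ (AllP.map⁺ (All.universal (λ p → map⁺ (prepend-injective p) (extensions-unique (c ∘ punchIn p))) minima))
          (AllPairsP.map⁺ {f = block} (AllPairs.map block-disjoint (filter⁺ (minimal? c) (allFin⁺ (suc n)))))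

        to : ∀ {T} → T ∈ extensions c → T ∈ concatMap block minima
        to {T} T∈ = let p , T′ , min , le , T≡ = isLE-prepend {T} (∈-extensions⁻ c {T} T∈) in
          subst (_∈ concatMap block minima) (sym T≡) (∈-concatMap⁺ block
            (lose (∈-filter⁺ (minimal? c) (∈-allFin p) min) (∈-map⁺ (prepend p) (∈-extensions (c ∘ punchIn p) {T′} le))))

        from : ∀ {T} → T ∈ concatMap block minima → T ∈ extensions c
        from T∈ with find (∈-concatMap⁻ block {xs = minima} T∈)
        ... | p , p∈ , T∈p with ∈-map⁻ (prepend p) T∈p
        ...   | T′ , T′∈ , refl = ∈-extensions c {prepend p T′} (prepend-isLE p {T′} (proj₂ (∈-filter⁻ (minimal? c) {xs = allFin (suc n)} p∈)) (∈-extensions⁻ (c ∘ punchIn p) {T′} T′∈))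

      #LE-recursion : #LE c ≡ sumˡ (map (λ p → #LE (c ∘ punchIn p)) (filter (minimal? c) (allFin (suc n))))
      #LE-recursion = begin
        length (extensions c)               ≡⟨ ↭-length (unique-↭ (extensions-unique c) blocks-unique to from) ⟩
        length (concatMap block minima)     ≡⟨ length-concatMap block minima ⟩
        sumˡ (map (length ∘ block) minima)  ≡⟨ cong sumˡ (map-cong (λ p → length-map (prepend p) (extensions (c ∘ punchIn p))) minima) ⟩
        sumˡ (map (λ p → #LE (c ∘ punchIn p)) minima) ∎
        where open ≡-Reasoning

    #LE-cong : ∀ {n} {c c′ : Fin n → A} → (∀ i → c i ≡ c′ i) → #LE c ≡ #LE c′
    #LE-cong {n} {c} {c′} eq = count-⇔ (isLE? c) (isLE? c′)
      (λ (bij , incr) → bij , λ p q → incr p q ∘ subst₂ _◁_ (sym (eq p)) (sym (eq q)))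
      (λ (bij , incr) → bij , λ p q → incr p q ∘ subst₂ _◁_ (eq p) (eq q)) (fillings n)

    #LEˡ : List A → ℕ
    #LEˡ L = #LE (List.lookup L)

    #LE-tabulate : ∀ {n} (c : Fin n → A) → #LE c ≡ #LEˡ (List.tabulate c)
    #LE-tabulate c = go (List.tabulate c) c (sym (length-tabulate c)) λ i → sym (lookup-tabulate c i)
      where
      -- The list is generalised so that the equation between the lengths can be matched with
      -- `refl`.
      go : ∀ {n} M (c : Fin n → A) (eq : n ≡ length M) → (∀ i → c i ≡ List.lookup M (cast eq i)) → #LE c ≡ #LEˡ M
      go M c refl agree = #LE-cong λ i → trans (agree i) (cong (List.lookup M) (cast-is-id refl i))

    module _ (_≟_ : (u v : A) → Dec (u ≡ v)) where

      delete : A → List A → List A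
      delete v = filter λ u → ¬? (u ≟ v)

      delete-lookup : ∀ x xs → Unique (x ∷ xs) → ∀ p →
                      delete (List.lookup (x ∷ xs) p) (x ∷ xs) ≡ List.tabulate (List.lookup (x ∷ xs) ∘ punchIn p)
      delete-lookup x xs (x∉ ∷ _) zero =
        trans (filter-reject (λ u → ¬? (u ≟ x)) (λ x≢x → x≢x refl))
        (trans (filter-all (λ u → ¬? (u ≟ x)) (All.map (λ x≢u u≡x → x≢u (sym u≡x)) x∉)) (sym (tabulate-lookup xs)))
      delete-lookup x (y ∷ xs) (x∉ ∷ u) (suc p) =
        trans (filter-accept (λ u → ¬? (u ≟ List.lookup (y ∷ xs) p)) (All.lookup x∉ (∈-lookup p))) (cong (x ∷_) (delete-lookup y xs u p))

      #LEˡ-recursion : ∀ {L} → Unique L → 0 < length L →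
                       #LEˡ L ≡ sumˡ (map (λ v → #LEˡ (delete v L)) (map (List.lookup L) (filter (minimal? (List.lookup L)) (allFin (length L)))))
      #LEˡ-recursion {x ∷ xs} u _ = trans (#LE-recursion (List.lookup (x ∷ xs))) (cong sumˡ (trans
        (map-cong (λ p → trans (#LE-tabulate (List.lookup (x ∷ xs) ∘ punchIn p)) (cong #LEˡ (sym (delete-lookup x xs u p)))) minima)
        (map-∘ minima)))
        where
        minima : List (Fin (suc (length xs)))
        minima = filter (minimal? (List.lookup (x ∷ xs))) (allFin (suc (length xs)))

  -- Standard fillings of skew shapes

  filter-filter : {A : Set} {P Q R : A → Set} (P? : Decidable P) (Q? : Decidable Q) (R? : Decidable R) →
                  (∀ {x} → P x → Q x → R x) → (∀ {x} → R x → P x × Q x) → ∀ xs → filter P? (filter Q? xs) ≡ filter R? xs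
  filter-filter P? Q? R? to from []       = refl
  filter-filter {P = P} {Q} P? Q? R? to from (x ∷ xs) = go (Q? x) (P? x)
    where
    ih : filter P? (filter Q? xs) ≡ filter R? xs
    ih = filter-filter P? Q? R? to from xs
    go : Dec (Q x) → Dec (P x) → filter P? (filter Q? (x ∷ xs)) ≡ filter R? (x ∷ xs)
    go (no ¬q) _       = trans (cong (filter P?) (filter-reject Q? ¬q)) (trans ih (sym (filter-reject R? (¬q ∘ proj₂ ∘ from))))
    go (yes q) (no ¬p) = trans (cong (filter P?) (filter-accept Q? q)) (trans (filter-reject P? ¬p) (trans ih (sym (filter-reject R? (¬p ∘ proj₁ ∘ from)))))
    go (yes q) (yes p) = trans (cong (filter P?) (filter-accept Q? q)) (trans (filter-accept P? p) (trans (cong (x ∷_) ih) (sym (filter-accept R? (to p q)))))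

  sum-filter-allFin : ∀ {n} {P : Fin n → Set} (P? : Decidable P) (f : Fin n → ℕ) →
                      sumˡ (map f (filter P? (allFin n))) ≡ sum λ i → ⟦ P? i ⟧ * f i
  sum-filter-allFin P? f = go P? f id
    where
    go : ∀ {A : Set} {n} {P : A → Set} (P? : Decidable P) (f : A → ℕ) (g : Fin n → A) →
         sumˡ (map f (filter P? (List.tabulate g))) ≡ sum λ i → ⟦ P? (g i) ⟧ * f (g i)
    go {n = zero}  P? f g = sym (sum-zero _ λ ())
    go {n = suc n} {P} P? f g = trans (head (P? (g zero))) (sym (sum-suc _))
      where
      rest : ℕ
      rest = sum λ i → ⟦ P? (g (suc i)) ⟧ * f (g (suc i))
      head : Dec (P (g zero)) → sumˡ (map f (filter P? (g zero ∷ List.tabulate (g ∘ suc)))) ≡ ⟦ P? (g zero) ⟧ * f (g zero) + rest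
      head (yes p) = trans (cong (sumˡ ∘ map f) (filter-accept P? p)) (cong₂ _+_
        (sym (trans (cong (_* f (g zero)) (⟦⟧-yes (P? (g zero)) p)) (*-identityˡ _))) (go P? f (g ∘ suc)))
      head (no ¬p) = trans (cong (sumˡ ∘ map f) (filter-reject P? ¬p))
        (trans (go P? f (g ∘ suc)) (cong (λ x → x * f (g zero) + rest) (sym (⟦⟧-no (P? (g zero)) ¬p))))

  product-split : {A : Set} {P : A → Set} (P? : Decidable P) (h : A → ℕ) → ∀ xs →
                  product (map h xs) ≡ product (map (λ u → h u ^ ⟦ P? u ⟧) xs) * product (map h (filter (λ u → ¬? (P? u)) xs))
  product-split P? h []       = refl
  product-split {P = P} P? h (x ∷ xs) = go (P? x)
    where
    a b : ℕ
    a = product (map (λ u → h u ^ ⟦ P? u ⟧) xs)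
    b = product (map h (filter (λ u → ¬? (P? u)) xs))
    e₁ : ∀ x a b → x * (a * b) ≡ x * 1 * a * b
    e₁ = solve-∀
    e₂ : ∀ x a b → x * (a * b) ≡ 1 * a * (x * b)
    e₂ = solve-∀
    go : Dec (P x) → h x * product (map h xs) ≡ h x ^ ⟦ P? x ⟧ * a * product (map h (filter (λ u → ¬? (P? u)) (x ∷ xs)))
    go (yes p) = trans (cong (h x *_) (product-split P? h xs)) (trans (e₁ (h x) a b)
      (cong₂ (λ y zs → h x ^ y * a * product (map h zs)) (sym (⟦⟧-yes (P? x) p)) (sym (filter-reject (λ u → ¬? (P? u)) λ ¬p → ¬p p))))
    go (no ¬p) = trans (cong (h x *_) (product-split P? h xs)) (trans (e₂ (h x) a b)
      (cong₂ (λ y zs → h x ^ y * a * product (map h zs)) (sym (⟦⟧-no (P? x) ¬p)) (sym (filter-accept (λ u → ¬? (P? u)) ¬p))))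

  -- `Q` fails on the first `B - R` elements and holds from there on; `R` grows by one with each
  -- element peeled off.
  count-applyUpTo : ∀ {A : Set} {Q : A → Set} (Q? : Decidable Q) (f : ℕ → A) m R B →
                    (∀ j → B ≤ j + R → Q (f j)) → (∀ j → Q (f j) → B ≤ j + R) → R ≤ B → B ≤ m + R →
                    count Q? (applyUpTo f m) + B ≡ m + R
  count-applyUpTo Q? f zero    R B to from R≤B B≤R = ≤-antisym B≤R R≤B
  count-applyUpTo Q? f (suc m) R B to from R≤B B≤ with m≤n⇒m<n∨m≡n R≤B
  ... | inj₁ R<B  = trans (cong (λ xs → length xs + B) (filter-reject Q? λ q → <⇒≱ R<B (from 0 q)))
    (trans (count-applyUpTo Q? (f ∘ suc) m (suc R) B
             (λ j le → to (suc j) (≤-trans le (≤-reflexive (+-suc j R)))) (λ j q → ≤-trans (from (suc j) q) (≤-reflexive (sym (+-suc j R))))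
             R<B (≤-trans B≤ (≤-reflexive (sym (+-suc m R))))) (+-suc m R))
  -- The threshold is reached and all later elements count. From here `B` grows together with `R`,
  -- so that the recursion stays in this case.
  ... | inj₂ refl = trans (cong (λ xs → length xs + R) (filter-accept Q? (to 0 ≤-refl)))
    (trans (sym (+-suc _ R)) (trans (count-applyUpTo Q? (f ∘ suc) m (suc R) (suc R)
             (λ j _ → to (suc j) (m≤n⇒m≤o+n (suc j) ≤-refl)) (λ j _ → m≤n+m (suc R) j) ≤-refl (m≤n+m (suc R) m)) (+-suc m R)))

  -- `Q` stands for lying outside `β`. It is abstract because the recursion cuts `β` down to its
  -- tail while the cells keep their row numbers through the offset `a`.
  count-cellsFrom : ∀ {Q : Cell → Set} (Q? : Decidable Q) ρ a (β : State (length ρ)) →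
    (∀ i j → i < length ρ → at β i ≤ j + (length ρ ∸ suc i) → Q (a + i , j)) →
    (∀ i j → i < length ρ → Q (a + i , j) → at β i ≤ j + (length ρ ∸ suc i)) →
    (∀ i → i < length ρ → length ρ ∸ suc i ≤ at β i) → (∀ i → i < length ρ → at β i ≤ part ρ i + (length ρ ∸ suc i)) →
    count Q? (cellsFrom ρ a) + total id β ≡ total id (stateOf (length ρ) (part ρ))
  count-cellsFrom Q? []      a []      to from lo hi = refl
  count-cellsFrom {Q} Q? (m ∷ ρ) a (x ∷ β) to from lo hi = begin
    count Q? (map (a ,_) (upTo m) ++ cellsFrom ρ (suc a)) + total id (x ∷ β)
      ≡⟨ cong₂ _+_ (trans (cong length (filter-++ Q? (map (a ,_) (upTo m)) _)) (length-++ (filter Q? (map (a ,_) (upTo m))))) (sum-suc _) ⟩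
    count Q? (map (a ,_) (upTo m)) + count Q? (cellsFrom ρ (suc a)) + (x + total id β)
      ≡⟨ exchange (count Q? (map (a ,_) (upTo m))) _ x _ ⟩
    (count Q? (map (a ,_) (upTo m)) + x) + (count Q? (cellsFrom ρ (suc a)) + total id β)
      ≡⟨ cong₂ _+_ first (count-cellsFrom Q? ρ (suc a) β
           (λ i j i<ρ le → subst (λ y → Q (y , j)) (+-suc a i) (to (suc i) j (s≤s i<ρ) le))
           (λ i j i<ρ q → from (suc i) j (s≤s i<ρ) (subst (λ y → Q (y , j)) (sym (+-suc a i)) q))
           (λ i i<ρ → lo (suc i) (s≤s i<ρ)) (λ i i<ρ → hi (suc i) (s≤s i<ρ))) ⟩
    (m + length ρ) + total id (stateOf (length ρ) (part ρ))
      ≡⟨ sum-suc _ ⟨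
    total id (stateOf (suc (length ρ)) (part (m ∷ ρ))) ∎
    where
    open ≡-Reasoning
    exchange : ∀ a b c d → a + b + (c + d) ≡ (a + c) + (b + d)
    exchange = solve-∀
    first : count Q? (map (a ,_) (upTo m)) + x ≡ m + length ρ
    first = trans (cong (_+ x) (count-map Q? (a ,_) (upTo m))) (count-applyUpTo (Q? ∘ (a ,_)) id m (length ρ) x
      (λ j le → subst (λ y → Q (y , j)) (+-identityʳ a) (to 0 j (s≤s z≤n) le))
      (λ j q → from 0 j (s≤s z≤n) (subst (λ y → Q (y , j)) (sym (+-identityʳ a)) q))
      (lo 0 (s≤s z≤n)) (hi 0 (s≤s z≤n)))

  _◁_ : Cell → Cell → Set
  (i , j) ◁ (i′ , j′) = (i ≡ i′ × j < j′) ⊎ (j ≡ j′ × i < i′)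

  _◁?_ : ∀ u v → Dec (u ◁ v)
  (i , j) ◁? (i′ , j′) = ((i ≟ i′) ×-dec (j <? j′)) ⊎-dec ((j ≟ j′) ×-dec (i <? i′))

  open LinearExtensions _◁?_

  module _ (ν : Partition) where

    skew : State (rank ν) → List Cell
    skew β = filter (λ u → ¬? (cellIn? β u)) (cells ν)

    Λ : State (rank ν)
    Λ = stateOf (rank ν) (row ν)

    valid-Λ : Valid Λ
    valid-Λ = valid-stateOf (part-decreasing (decreasing ν))

    ∈Λ : ∀ {u} → u ∈ᶜ ν → CellIn Λ u
    ∈Λ u∈ = cellIn-stateOf⁺ (part-support (parts ν) u∈) u∈

    ∈skew⁺ : ∀ {β u} → u ∈ᶜ ν → ¬ CellIn β u → u ∈ skew β
    ∈skew⁺ {β} u∈ u∉ = ∈-filter⁺ (λ u → ¬? (cellIn? β u)) (∈-cells⁺ ν u∈) u∉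

    ∈skew⁻ : ∀ {β u} → u ∈ skew β → u ∈ᶜ ν × ¬ CellIn β u
    ∈skew⁻ {β} u∈ with ∈-filter⁻ (λ u → ¬? (cellIn? β u)) {xs = cells ν} u∈
    ... | u∈ν , u∉ = ∈-cells⁻ ν u∈ν , u∉

    skew-unique : ∀ β → Unique (skew β)
    skew-unique β = filter⁺ (λ u → ¬? (cellIn? β u)) (cells-unique ν)

    module _ {β : State (rank ν)} (validβ : Valid β) where

      -- A cell before the new one lies in `inc β i`, which is closed under going left and up, and
      -- so already in `β`.
      new⇒minimal : ∀ i → Addable β i → ∀ {v} → v ∈ skew β → ¬ (v ◁ newCell β i)
      new⇒minimal i add {a , b} v∈ v◁ with cellIn-inc⁻ validβ i (a , b) (covered v◁)
        where
        covered : (a , b) ◁ newCell β i → CellIn (inc β i) (a , b)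
        covered (inj₁ (refl , b<)) = closed (valid-inc validβ i add) ≤-refl (<⇒≤ b<) (newCell∈inc validβ i)
        covered (inj₂ (refl , a<)) = closed (valid-inc validβ i add) (<⇒≤ a<) ≤-refl (newCell∈inc validβ i)
      ... | inj₁ v∈β  = proj₂ (∈skew⁻ {β} v∈) v∈β
      ... | inj₂ refl = [ <-irrefl refl ∘ proj₂ , <-irrefl refl ∘ proj₂ ]′ v◁

      -- Minimality puts the left and the upper neighbour into `β`. The left one fixes where the row
      -- ends; the upper one keeps the next place free.
      minimal⇒new : ∀ {u} → u ∈ skew β → (∀ {v} → v ∈ skew β → ¬ (v ◁ u)) → ∃[ i ] Addable β i × u ≡ newCell β i
      minimal⇒new {a , b} u∈ min = i , add , trans (cong (_, b) (sym toℕ-i)) (position-self validβ i (trans (cong (λ x → position (rank ν) (x , b)) toℕ-i) (trans pos≡ (sym βi≡))))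
        where
        u∈ν : (a , b) ∈ᶜ ν
        u∈ν = proj₁ (∈skew⁻ {β} u∈)
        u∉β : ¬ CellIn β (a , b)
        u∉β = proj₂ (∈skew⁻ {β} u∈)
        a<r : a < rank ν
        a<r = part-support (parts ν) u∈ν
        i : Fin (rank ν)
        i = fromℕ< a<r
        toℕ-i : toℕ i ≡ a
        toℕ-i = toℕ-fromℕ< a<r
        βi≡ : lookup β i ≡ at β a
        βi≡ = trans (sym (at-lookup β i)) (cong (at β) toℕ-i)
        filled : ∀ {v} → v ∈ᶜ ν → v ◁ (a , b) → CellIn β v
        filled {v} v∈ν v◁ with cellIn? β v
        ... | yes v∈ = v∈
        ... | no v∉  = contradiction v◁ (min (∈skew⁺ {β} v∈ν v∉))
        position≤ : ∀ b → (a , b) ∈ᶜ ν → (∀ {v} → v ∈ᶜ ν → v ◁ (a , b) → CellIn β v) → position (rank ν) (a , b) ≤ at β a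
        position≤ zero    _   _      = floor validβ a a<r
        position≤ (suc b) u∈ν filled = filled (∈ᶜ-closed ν ≤-refl (n≤1+n b) u∈ν) (inj₁ (refl , ≤-refl))
        pos≡ : position (rank ν) (a , b) ≡ at β a
        pos≡ = ≤-antisym (position≤ b u∈ν filled) (≮⇒≥ u∉β)
        add : Addable β i
        add l eq = no-row a refl
          where
          βl≡ : at β (toℕ l) ≡ suc (position (rank ν) (a , b))
          βl≡ = trans (at-lookup β l) (trans eq (cong suc (trans βi≡ (sym pos≡))))
          l<a : toℕ l < a
          l<a = subst (toℕ l <_) toℕ-i (lookup-< validβ (≤-reflexive (sym eq)))
          no-row : ∀ x → ¬ (a ≡ x)
          no-row zero    a≡0  = contradiction (subst (toℕ l <_) a≡0 l<a) λ ()
          no-row (suc x) refl = <-irrefl refl (≤-trans (subst (_< at β x) (position-suc x b a<r)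
            (filled (∈ᶜ-closed ν (n≤1+n x) ≤-refl u∈ν) (inj₂ (refl , ≤-refl)))) atx≤)
            where
            atx≤ : at β x ≤ suc (position (rank ν) (a , b))
            atx≤ with m≤n⇒m<n∨m≡n (≤-pred l<a)
            ... | inj₁ l<x = ≤-trans (<⇒≤ (antitone-< validβ l<x (<-trans (n<1+n x) a<r))) (≤-reflexive βl≡)
            ... | inj₂ l≡x = ≤-reflexive (trans (cong (at β) (sym l≡x)) βl≡)

      delete-new : ∀ i → delete _≟ᵘ_ (newCell β i) (skew β) ≡ skew (inc β i)
      delete-new i = filter-filter (λ u → ¬? (u ≟ᵘ newCell β i)) (λ u → ¬? (cellIn? β u)) (λ u → ¬? (cellIn? (inc β i) u))
        (λ {u} u≢ u∉ → [ u∉ , u≢ ]′ ∘ cellIn-inc⁻ validβ i u)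
        (λ {u} u∉ → (λ u≡ → u∉ (subst (CellIn (inc β i)) (sym u≡) (newCell∈inc validβ i))) , u∉ ∘ cellIn-inc⁺ validβ i u)
        (cells ν)

      Extends : Fin (rank ν) → Set
      Extends i = Addable β i × newCell β i ∈ᶜ ν

      extends? : ∀ i → Dec (Extends i)
      extends? i = addable? β i ×-dec (newCell β i ∈ᶜ? ν)

      private
        L : List Cell
        L = skew β
        minimalCells newCells : List Cell
        minimalCells = map (List.lookup L) (filter (minimal? (List.lookup L)) (allFin (length L)))
        newCells     = map (newCell β) (filter extends? (allFin (rank ν)))

        minimal-everywhere : ∀ {p} → Minimal (List.lookup L) p → ∀ {v} → v ∈ L → ¬ (v ◁ List.lookup L p)
        minimal-everywhere {p} min v∈ v◁ = min (index v∈) (subst (_◁ List.lookup L p) (lookup-index v∈) v◁)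

        to : ∀ {u} → u ∈ minimalCells → u ∈ newCells
        to u∈ =
          let p , p∈ , u≡lookup = ∈-map⁻ (List.lookup L) u∈
              minimal = proj₂ (∈-filter⁻ (minimal? (List.lookup L)) {xs = allFin (length L)} p∈)
              i , add , lookup≡ = minimal⇒new (∈-lookup p) (λ {v} → minimal-everywhere {p} minimal {v})
              extends = add , subst (_∈ᶜ ν) lookup≡ (proj₁ (∈skew⁻ {β} (∈-lookup p)))
          in subst (_∈ newCells) (sym (trans u≡lookup lookup≡)) (∈-map⁺ (newCell β) (∈-filter⁺ extends? (∈-allFin i) extends))

        from : ∀ {u} → u ∈ newCells → u ∈ minimalCells
        from u∈ with ∈-map⁻ (newCell β) u∈
        ... | i , i∈ , refl = subst (_∈ minimalCells) (sym (lookup-index new∈)) (∈-map⁺ (List.lookup L)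
              (∈-filter⁺ (minimal? (List.lookup L)) (∈-allFin (index new∈)) λ q q◁ →
                new⇒minimal i (proj₁ ext) (∈-lookup q) (subst (List.lookup L q ◁_) (sym (lookup-index new∈)) q◁)))
          where
          ext : Extends i
          ext = proj₂ (∈-filter⁻ extends? {xs = allFin (rank ν)} i∈)
          new∈ : newCell β i ∈ L
          new∈ = ∈skew⁺ {β} (proj₂ ext) (newCell∉ validβ i)

        minimal↭new : minimalCells ↭ newCells
        minimal↭new = unique-↭
          (map⁺ (lookup-injective (skew-unique β) _ _) (filter⁺ (minimal? (List.lookup L)) (allFin⁺ _)))
          (map⁺ (toℕ-injective ∘ cong proj₁) (filter⁺ extends? (allFin⁺ _))) to from

      #LE-skew : 0 < length (skew β) → #LEˡ (skew β) ≡ sum λ i → ⟦ extends? i ⟧ * #LEˡ (skew (inc β i))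
      #LE-skew nonempty = begin
        #LEˡ L
          ≡⟨ #LEˡ-recursion _≟ᵘ_ (skew-unique β) nonempty ⟩
        sumˡ (map (λ v → #LEˡ (delete _≟ᵘ_ v L)) minimalCells)
          ≡⟨ sum-↭ (↭-map⁺ (λ v → #LEˡ (delete _≟ᵘ_ v L)) minimal↭new) ⟩
        sumˡ (map (λ v → #LEˡ (delete _≟ᵘ_ v L)) newCells)
          ≡⟨ cong sumˡ (trans (sym (map-∘ rows)) (map-cong (λ i → cong #LEˡ (delete-new i)) rows)) ⟩
        sumˡ (map (λ i → #LEˡ (skew (inc β i))) rows)
          ≡⟨ sum-filter-allFin extends? (λ i → #LEˡ (skew (inc β i))) ⟩
        sum (λ i → ⟦ extends? i ⟧ * #LEˡ (skew (inc β i))) ∎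
        where
        open ≡-Reasoning
        rows : List (Fin (rank ν))
        rows = filter extends? (allFin (rank ν))

      length-skew : (∀ {u} → CellIn β u → u ∈ᶜ ν) → length (skew β) + total id β ≡ total id Λ
      length-skew β⊆ν = trans (cong (λ xs → count (λ u → ¬? (cellIn? β u)) xs + total id β) (cells-cellsFrom ν))
        (count-cellsFrom (λ u → ¬? (cellIn? β u)) (parts ν) 0 β (λ _ _ _ → ≤⇒≯) (λ _ _ _ → ≮⇒≥) (floor validβ)
          λ i i<r → ≮⇒≥ λ lt → <-irrefl refl (β⊆ν {i , row ν i} lt))

  -- Naruse's formula

  product-ones : {A : Set} {f : A → ℕ} → (∀ u → f u ≡ 1) → ∀ us → product (map f us) ≡ 1
  product-ones f≡1 []       = refl
  product-ones f≡1 (u ∷ us) = cong₂ _*_ (f≡1 u) (product-ones f≡1 us)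

  product-positive : {A : Set} {f : A → ℕ} → (∀ u → 0 < f u) → ∀ us → 0 < product (map f us)
  product-positive f>0 []       = s≤s z≤n
  product-positive f>0 (u ∷ us) = *-mono-≤ (f>0 u) (product-positive f>0 us)

  module _ (ν : Partition) where

    private
      L : Word
      L = word ν (hook ν) (cells ν)

    ∉∅ : ∀ u → ¬ CellIn (∅ ν) u
    ∉∅ (i , j) u∈ = contradiction (cellIn-stateOf⁻ {rank ν} {λ _ → 0} i j u∈) λ ()

    hookProduct-∅ : hookProduct ν (∅ ν) ≡ 1
    hookProduct-∅ = product-ones (λ u → cong (hook ν u ^_) (⟦⟧-no (cellIn? (∅ ν) u) (∉∅ u))) (cells ν)

    hookProduct-Λ : hookProduct ν (Λ ν) ≡ product (map (hook ν) (cells ν))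
    hookProduct-Λ = cong product (map-cong-local (All.tabulate λ {u} u∈ →
      trans (cong (hook ν u ^_) (⟦⟧-yes (cellIn? (Λ ν) u) (∈Λ ν (∈-cells⁻ ν u∈)))) (^-identityʳ (hook ν u))))

    hookProduct-positive : ∀ β → 0 < hookProduct ν β
    hookProduct-positive β = product-positive (λ u → m^n>0 (hook ν u) ⟦ cellIn? β u ⟧) (cells ν)

    hookProduct≤W : ∀ {μ} → Valid μ → (∀ {u} → CellIn μ u → u ∈ᶜ ν) → hookProduct ν μ ≤ W μ L (∅ ν)
    hookProduct≤W {μ} validμ μ⊆ν = ≤-trans
      (W-lower ν validμ (cells ν) (stage-∅ ν) ((λ u u∈ → contradiction u∈ (∉∅ u)) , λ u u∈ → inj₂ (∈-cells⁺ ν (μ⊆ν u∈))))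
      (≤-reflexive (trans (cong (W μ L (∅ ν) *_) hookProduct-∅) (*-identityʳ _)))

    total-∅ : length (cells ν) + total id (∅ ν) ≡ total id (Λ ν)
    total-∅ = trans (cong (λ us → length us + total id (∅ ν)) (sym (filter-all (λ u → ¬? (cellIn? (∅ ν) u)) (All.universal ∉∅ (cells ν)))))
      (length-skew ν (valid (stage-∅ ν)) λ {u} u∈ → contradiction u∈ (∉∅ u))

    W-full : W (Λ ν) L (∅ ν) ≡ hookProduct ν (Λ ν)
    W-full = ≤-antisym
      (≤-trans (W-exact (Λ ν) L (∅ ν) (valid⇒distinct (valid (stage-∅ ν)))
                 (trans (cong (total id (∅ ν) +_) (length-map _ (cells ν))) (trans (+-comm (total id (∅ ν)) _) total-∅)))
               (≤-reflexive (trans (cong product (sym (map-∘ (cells ν)))) (sym hookProduct-Λ))))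
      (hookProduct≤W (valid-Λ ν) λ {u} → cellIn-stateOf⁻ {rank ν} (proj₁ u) (proj₂ u))

    -- The beta numbers of empty rows are r - 1, ..., 0: each is blocked by the next, and the last
    -- is 0.
    ∅-irremovable : ∀ i → ¬ Removable (∅ ν) i
    ∅-irremovable i (≢0 , gap) = go (suc (toℕ i) <? rank ν)
      where
      at∅ : ∀ {a} → a < rank ν → at (∅ ν) a ≡ rank ν ∸ suc a
      at∅ = at-stateOf (rank ν) λ _ → 0
      here≡ : lookup (∅ ν) i ≡ rank ν ∸ suc (toℕ i)
      here≡ = trans (sym (at-lookup (∅ ν) i)) (at∅ (toℕ<n i))
      go : Dec (suc (toℕ i) < rank ν) → _
      go (no ≮)   = ≢0 (trans here≡ (m≤n⇒m∸n≡0 (≮⇒≥ ≮)))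
      go (yes lt) = gap (fromℕ< lt) (trans (cong suc (trans (sym (at-lookup (∅ ν) (fromℕ< lt))) (trans (cong (at (∅ ν)) (toℕ-fromℕ< lt)) (at∅ lt))))
                                           (sym (trans here≡ (position-suc (toℕ i) 0 lt))))

    module _ {β : State (rank ν)} (validβ : Valid β) (β⊆ν : ∀ {u} → CellIn β u → u ∈ᶜ ν) where

      covers-recursion : sum (λ i → ⟦ addable? β i ⟧ * W (inc β i) L (∅ ν)) ≡ length (skew ν β) * W β L (∅ ν)
      covers-recursion = +-cancelʳ-≡ (total id β * W β L (∅ ν)) _ _ (begin
        sum (λ i → ⟦ addable? β i ⟧ * W (inc β i) L (∅ ν)) + total id β * W β L (∅ ν)
          ≡⟨ chevalley β (valid⇒distinct validβ) L (hookWord-compatible ν) (∅ ν) (valid⇒distinct (valid (stage-∅ ν))) ⟩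
        lower (W β L) (∅ ν) + total (potential L) (∅ ν) * W β L (∅ ν)
          ≡⟨ cong₂ (λ x y → x + y * W β L (∅ ν))
               (sum-zero _ λ i → cong (_* W β L (dec (∅ ν) i)) (⟦⟧-no (removable? (∅ ν) i) (∅-irremovable i)))
               (hookWord-total ν) ⟩
        total id (Λ ν) * W β L (∅ ν)
          ≡⟨ cong (_* W β L (∅ ν)) (length-skew ν validβ β⊆ν) ⟨
        (length (skew ν β) + total id β) * W β L (∅ ν)
          ≡⟨ *-distribʳ-+ (W β L (∅ ν)) (length (skew ν β)) _ ⟩
        length (skew ν β) * W β L (∅ ν) + total id β * W β L (∅ ν) ∎)
        where open ≡-Reasoning

      -- Reconciles the two recursions: covers of `β` that leave `ν` occur in `chevalley` but not
      -- among tableaux, and they have weight zero by `W-outside`.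
      extends-weight : ∀ c i → ⟦ extends? ν validβ i ⟧ * (c * W (inc β i) L (∅ ν)) ≡ c * (⟦ addable? β i ⟧ * W (inc β i) L (∅ ν))
      extends-weight c i = go (addable? β i) (newCell β i ∈ᶜ? ν)
        where
        w : ℕ
        w = W (inc β i) L (∅ ν)
        go : (d : Dec (Addable β i)) (d′ : Dec (newCell β i ∈ᶜ ν)) → ⟦ d ×-dec d′ ⟧ * (c * w) ≡ c * (⟦ d ⟧ * w)
        go (no _)  _         = sym (*-zeroʳ c)
        go (yes _) (yes _)   = trans (*-identityˡ _) (cong (c *_) (sym (*-identityˡ w)))
        go (yes _) (no new∉) = sym (trans (cong (c *_) (trans (*-identityˡ w) (W-outside ν (newCell∈inc validβ i) new∉ (cells ν) (stage-∅ ν)))) (*-zeroʳ c))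

    #LE-[] : #LEˡ [] ≡ 1
    #LE-[] = refl

    inc⊆ν : ∀ {β : State (rank ν)} → Valid β → (∀ {u} → CellIn β u → u ∈ᶜ ν) → ∀ i → newCell β i ∈ᶜ ν → ∀ {u} → CellIn (inc β i) u → u ∈ᶜ ν
    inc⊆ν validβ β⊆ν i new∈ {u} u∈ = [ β⊆ν , (λ u≡ → subst (_∈ᶜ ν) (sym u≡) new∈) ]′ (cellIn-inc⁻ validβ i u u∈)

    #LE-step : ∀ {β : State (rank ν)} (validβ : Valid β) → (∀ {u} → CellIn β u → u ∈ᶜ ν) → 0 < length (skew ν β) → ∀ c →
               (∀ i → Extends ν validβ i → #LEˡ (skew ν (inc β i)) * hookProduct ν (Λ ν) ≡ c * W (inc β i) L (∅ ν)) →
               #LEˡ (skew ν β) * hookProduct ν (Λ ν) ≡ length (skew ν β) * c * W β L (∅ ν)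
    #LE-step {β} validβ β⊆ν nonempty c ih = begin
      #LEˡ (skew ν β) * P
        ≡⟨ cong (_* P) (#LE-skew ν validβ nonempty) ⟩
      sum (λ i → ⟦ extends? ν validβ i ⟧ * #LEˡ (skew ν (inc β i))) * P
        ≡⟨ *-distribʳ-sum P (λ i → ⟦ extends? ν validβ i ⟧ * #LEˡ (skew ν (inc β i))) ⟩
      sum (λ i → ⟦ extends? ν validβ i ⟧ * #LEˡ (skew ν (inc β i)) * P)
        ≡⟨ sum-cong-≗ (λ i → trans (*-assoc ⟦ extends? ν validβ i ⟧ (#LEˡ (skew ν (inc β i))) P) (⟦⟧-guard (extends? ν validβ i) (ih i))) ⟩
      sum (λ i → ⟦ extends? ν validβ i ⟧ * (c * W (inc β i) L (∅ ν)))
        ≡⟨ sum-cong-≗ (extends-weight validβ β⊆ν c) ⟩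
      sum (λ i → c * (⟦ addable? β i ⟧ * W (inc β i) L (∅ ν)))
        ≡⟨ *-distribˡ-sum c (λ i → ⟦ addable? β i ⟧ * W (inc β i) L (∅ ν)) ⟨
      c * sum (λ i → ⟦ addable? β i ⟧ * W (inc β i) L (∅ ν))
        ≡⟨ cong (c *_) (covers-recursion validβ β⊆ν) ⟩
      c * (length (skew ν β) * W β L (∅ ν))
        ≡⟨ rearrange c (length (skew ν β)) (W β L (∅ ν)) ⟩
      length (skew ν β) * c * W β L (∅ ν) ∎
      where
      open ≡-Reasoning
      P : ℕ
      P = hookProduct ν (Λ ν)
      rearrange : ∀ a b c → a * (b * c) ≡ b * a * c
      rearrange = solve-∀

    length-skew-inc : ∀ {β : State (rank ν)} (validβ : Valid β) → (∀ {u} → CellIn β u → u ∈ᶜ ν) → ∀ i → Extends ν validβ i →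
                      length (skew ν β) ≡ suc (length (skew ν (inc β i)))
    length-skew-inc {β} validβ β⊆ν i (add , new∈) = +-cancelʳ-≡ (total id β) _ _ (begin
      length (skew ν β) + total id β                  ≡⟨ length-skew ν validβ β⊆ν ⟩
      total id (Λ ν)                                  ≡⟨ length-skew ν (valid-inc validβ i add) (inc⊆ν validβ β⊆ν i new∈) ⟨
      length (skew ν (inc β i)) + total id (inc β i)  ≡⟨ cong (length (skew ν (inc β i)) +_) (total-inc β i) ⟩
      length (skew ν (inc β i)) + suc (total id β)    ≡⟨ +-suc (length (skew ν (inc β i))) (total id β) ⟩
      suc (length (skew ν (inc β i))) + total id β    ∎)
      where open ≡-Reasoning

    -- Naruse's hook-length formula for the skew shapes of size n, with denominators cleared.
    Naruse : ℕ → Set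
    Naruse n = ∀ {β} → Valid β → (∀ {u} → CellIn β u → u ∈ᶜ ν) → length (skew ν β) ≡ n →
               #LEˡ (skew ν β) * hookProduct ν (Λ ν) ≡ n ! * W β L (∅ ν)

    naruse-zero : Naruse 0
    naruse-zero {β} validβ β⊆ν size≡0 = cong₂ _*_ (trans (cong #LEˡ (empty (skew ν β) size≡0)) #LE-[])
      (trans (sym W-full) (cong (λ γ → W γ L (∅ ν)) (sym β≡Λ)))
      where
      empty : (us : List Cell) → length us ≡ 0 → us ≡ []
      empty [] _ = refl
      full : ∀ u → CellIn (Λ ν) u → CellIn β u
      full u u∈ with cellIn? β u
      ... | yes u∈β = u∈β
      ... | no u∉β  = contradiction (subst (u ∈_) (empty (skew ν β) size≡0) (∈skew⁺ ν {β} (cellIn-stateOf⁻ {rank ν} (proj₁ u) (proj₂ u) u∈) u∉β)) λ ()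
      β≡Λ : β ≡ Λ ν
      β≡Λ = cellIn-ext validβ (valid-Λ ν) (λ u u∈ → ∈Λ ν (β⊆ν u∈)) full

    naruse-suc : ∀ n → Naruse n → Naruse (suc n)
    naruse-suc n ih {β} validβ β⊆ν size≡ = trans
      (#LE-step {β} validβ β⊆ν (≤-trans (s≤s z≤n) (≤-reflexive (sym size≡))) (n !) λ i ext →
        ih {inc β i} (valid-inc validβ i (proj₁ ext)) (inc⊆ν validβ β⊆ν i (proj₂ ext))
          (suc-injective (trans (sym (length-skew-inc {β} validβ β⊆ν i ext)) size≡)))
      (cong (λ m → m * n ! * W β L (∅ ν)) size≡)

    naruse : ∀ n → Naruse n
    naruse zero    = naruse-zero
    naruse (suc n) = naruse-suc n (naruse n)

  module _ (S : SkewShape) where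

    private
      ν : Partition
      ν = outer S
      μ : State (rank ν)
      μ = innerState S
      Q : ℕ
      Q = product (map (hook ν) (skewCells S))

    valid-inner : Valid μ
    valid-inner = valid-stateOf (part-decreasing (decreasing (inner S)))

    inner⁻ : ∀ {u} → CellIn μ u → u ∈ᶜ inner S
    inner⁻ {i , j} = cellIn-stateOf⁻ {rank ν} i j

    inner⊆ : ∀ {u} → u ∈ᶜ inner S → u ∈ᶜ ν
    inner⊆ {i , j} u∈ = <-≤-trans u∈ (contained S i)

    inner⁺ : ∀ {u} → u ∈ᶜ inner S → CellIn μ u
    inner⁺ {u} u∈ = cellIn-stateOf⁺ (part-support (parts ν) (inner⊆ {u} u∈)) u∈

    skewCells-skew : skewCells S ≡ skew ν μ
    skewCells-skew = filter-≐ (λ u → ¬? (u ∈ᶜ? inner S)) (λ u → ¬? (cellIn? μ u)) ((λ {u} u∉ → u∉ ∘ inner⁻ {u}) , (λ {u} u∉ → u∉ ∘ inner⁺ {u})) (cells ν)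

    e-#LE : e S ≡ #LEˡ (skewCells S)
    e-#LE = count-⇔ (isSYT? S) (isLE? (List.lookup (skewCells S)))
      (λ {T} t → IsSYT.bijective t , λ p q → [ IsSYT.rows t p q , IsSYT.columns t p q ]′)
      (λ {T} (bij , incr) → record { bijective = bij ; rows = λ p q → incr p q ∘ inj₁ ; columns = λ p q → incr p q ∘ inj₂ })
      (fillings (size S))

    hookProduct-split : hookProduct ν (Λ ν) ≡ hookProduct ν μ * Q
    hookProduct-split = trans (hookProduct-Λ ν) (trans (product-split (cellIn? μ) (hook ν) (cells ν))
      (cong (λ us → hookProduct ν μ * product (map (hook ν) us)) (sym skewCells-skew)))

    naruse-skew : hookProduct ν μ * (e S * Q) ≡ size S ! * W μ (word ν (hook ν) (cells ν)) (∅ ν)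
    naruse-skew = begin
      hookProduct ν μ * (e S * Q)                        ≡⟨ *-left-comm (hookProduct ν μ) (e S) Q ⟩
      e S * (hookProduct ν μ * Q)                        ≡⟨ cong₂ _*_ (trans e-#LE (cong #LEˡ skewCells-skew)) (sym hookProduct-split) ⟩
      #LEˡ (skew ν μ) * hookProduct ν (Λ ν)              ≡⟨ naruse ν (size S) {μ} valid-inner (λ {u} → inner⊆ {u} ∘ inner⁻ {u}) (cong length (sym skewCells-skew)) ⟩
      size S ! * W μ (word ν (hook ν) (cells ν)) (∅ ν)   ∎
      where
      open ≡-Reasoning

    private
      instance
        hookProduct-nonZero : NonZero (hookProduct ν μ)
        hookProduct-nonZero = >-nonZero (hookProduct-positive ν μ)

    lower-bound : size S ! ≤ e S * Q
    lower-bound = *-cancelˡ-≤ (hookProduct ν μ) (begin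
      hookProduct ν μ * size S !                          ≡⟨ *-comm (hookProduct ν μ) _ ⟩
      size S ! * hookProduct ν μ                          ≤⟨ *-monoʳ-≤ (size S !) (hookProduct≤W ν {μ} valid-inner (λ {u} → inner⊆ {u} ∘ inner⁻ {u})) ⟩
      size S ! * W μ (word ν (hook ν) (cells ν)) (∅ ν)    ≡⟨ naruse-skew ⟨
      hookProduct ν μ * (e S * Q)                         ∎)
      where open ≤-Reasoning

    upper-bound : e S * Q ≤ ξ S * size S !
    upper-bound = *-cancelˡ-≤ (hookProduct ν μ) (begin
      hookProduct ν μ * (e S * Q)                                           ≡⟨ naruse-skew ⟩
      -- The factor `hookProduct ν (∅ ν)` equals 1 and is inserted to fit `W-upper`.
      size S ! * W μ (word ν (hook ν) (cells ν)) (∅ ν)                      ≡⟨ cong (size S ! *_) (trans (sym (*-identityˡ _)) (cong (_* W μ (word ν (hook ν) (cells ν)) (∅ ν)) (sym (hookProduct-∅ ν)))) ⟩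
      size S ! * (hookProduct ν (∅ ν) * W μ (word ν (hook ν) (cells ν)) (∅ ν)) ≤⟨ *-monoʳ-≤ (size S !) (W-upper ν (cells ν) (stage-∅ ν)) ⟩
      size S ! * (hookProduct ν μ * W μ (word ν (λ _ → 1) (cells ν)) (∅ ν)) ≤⟨ *-monoʳ-≤ (size S !) (*-monoʳ-≤ (hookProduct ν μ) (paths≤ξ S)) ⟩
      size S ! * (hookProduct ν μ * ξ S)                                    ≡⟨ rearrange (size S !) (hookProduct ν μ) (ξ S) ⟩
      hookProduct ν μ * (ξ S * size S !)                                    ∎)
      where
      open ≤-Reasoning
      rearrange : ∀ a b c → a * (b * c) ≡ b * (c * a)
      rearrange = solve-∀

-- Passage to rational numbers

open import Algebra.Bundles using (CommutativeMonoid)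
import Data.Integer as ℤ
import Data.Integer.Properties as ℤ
import Data.Nat.Properties as ℕ
open import Data.Rational using (ℚ; 1ℚ; _/_; _*_; _≤_; toℚᵘ; fromℚᵘ; NonNegative; nonNegative)
open import Data.Rational.Properties using (toℚᵘ-fromℚᵘ; fromℚᵘ-cong; toℚᵘ-injective; toℚᵘ-homo-*; toℚᵘ-cancel-≤; *-monoʳ-≤-nonNeg; nonNeg*nonNeg⇒nonNeg; *-assoc; *-identityʳ; *-1-commutativeMonoid)
open import Algebra.Properties.CommutativeSemigroup (CommutativeMonoid.commutativeSemigroup *-1-commutativeMonoid) using (interchange)
open import Data.Rational.Unnormalised as ℚᵘ using (mkℚᵘ; *≡*; *≤*)
import Data.Rational.Unnormalised.Properties as ℚᵘ
import Relation.Binary.Reasoning.Setoid as SetoidReasoning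

-- A fraction `n / d` is `fromℚᵘ` of an unnormalised one, where equations and inequalities reduce to
-- cross multiplication.
fromℚᵘ-* : ∀ p q → fromℚᵘ (p ℚᵘ.* q) ≡ fromℚᵘ p * fromℚᵘ q
fromℚᵘ-* p q = toℚᵘ-injective (begin
  toℚᵘ (fromℚᵘ (p ℚᵘ.* q))                ≈⟨ toℚᵘ-fromℚᵘ _ ⟩
  p ℚᵘ.* q                                ≈⟨ ℚᵘ.*-cong (toℚᵘ-fromℚᵘ p) (toℚᵘ-fromℚᵘ q) ⟨
  toℚᵘ (fromℚᵘ p) ℚᵘ.* toℚᵘ (fromℚᵘ q)    ≈⟨ toℚᵘ-homo-* (fromℚᵘ p) (fromℚᵘ q) ⟨
  toℚᵘ (fromℚᵘ p * fromℚᵘ q)              ∎)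
  where open SetoidReasoning ℚᵘ.≃-setoid

fromℚᵘ-mono-≤ : ∀ {p q} → p ℚᵘ.≤ q → fromℚᵘ p ≤ fromℚᵘ q
fromℚᵘ-mono-≤ {p} {q} p≤q = toℚᵘ-cancel-≤ (ℚᵘ.≤-respˡ-≃ (ℚᵘ.≃-sym (toℚᵘ-fromℚᵘ p)) (ℚᵘ.≤-respʳ-≃ (ℚᵘ.≃-sym (toℚᵘ-fromℚᵘ q)) p≤q))

fromℕ-* : ∀ a b → fromℕ (a ℕ.* b) ≡ fromℕ a * fromℕ b
fromℕ-* a b = trans (fromℚᵘ-cong {mkℚᵘ (ℤ.+ (a ℕ.* b)) 0} {mkℚᵘ (ℤ.+ a) 0 ℚᵘ.* mkℚᵘ (ℤ.+ b) 0} (*≡* (cong (ℤ._* ℤ.+ 1) (ℤ.pos-* a b))))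
                    (fromℚᵘ-* (mkℚᵘ (ℤ.+ a) 0) (mkℚᵘ (ℤ.+ b) 0))

fromℕ-mono-≤ : ∀ {a b} → a ℕ.≤ b → fromℕ a ≤ fromℕ b
fromℕ-mono-≤ {a} {b} a≤b = fromℚᵘ-mono-≤ {mkℚᵘ (ℤ.+ a) 0} {mkℚᵘ (ℤ.+ b) 0} (*≤* (ℤ.*-monoʳ-≤-nonNeg (ℤ.+ 1) (ℤ.+≤+ a≤b)))

1/-inverse : ∀ n → fromℕ (suc n) * (ℤ.+ 1 / suc n) ≡ 1ℚ
1/-inverse n = trans (sym (fromℚᵘ-* (mkℚᵘ (ℤ.+ suc n) 0) (mkℚᵘ (ℤ.+ 1) n)))
  (fromℚᵘ-cong {mkℚᵘ (ℤ.+ suc n) 0 ℚᵘ.* mkℚᵘ (ℤ.+ 1) n} {mkℚᵘ (ℤ.+ 1) 0}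
    (*≡* (cong ℤ.+_ (trans (cong (ℕ._* 1) (ℕ.*-identityʳ (suc n))) (trans (ℕ.*-identityʳ (suc n)) (sym (trans (ℕ.*-identityˡ _) (ℕ.*-identityˡ _))))))))

1/-nonNegative : ∀ n → NonNegative (ℤ.+ 1 / suc n)
1/-nonNegative n = nonNegative (fromℚᵘ-mono-≤ {mkℚᵘ (ℤ.+ 0) 0} {mkℚᵘ (ℤ.+ 1) n} (*≤* (ℤ.+≤+ ℕ.z≤n)))

module _ {A : Set} (h : A → ℕ) where

  -- Denominators have the form `suc (h u)` so that they are visibly nonzero.
  reciprocals : List A → ℚ
  reciprocals us = foldr _*_ 1ℚ (map (λ u → ℤ.+ 1 / suc (h u)) us)

  reciprocals-inverse : ∀ us → fromℕ (product (map (λ u → suc (h u)) us)) * reciprocals us ≡ 1ℚ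
  reciprocals-inverse []       = refl
  reciprocals-inverse (u ∷ us) = begin
    fromℕ (suc (h u) ℕ.* q) * (x * r)          ≡⟨ cong (_* (x * r)) (fromℕ-* (suc (h u)) q) ⟩
    fromℕ (suc (h u)) * fromℕ q * (x * r)      ≡⟨ interchange (fromℕ (suc (h u))) (fromℕ q) x r ⟩
    fromℕ (suc (h u)) * x * (fromℕ q * r)      ≡⟨ cong₂ _*_ (1/-inverse (h u)) (reciprocals-inverse us) ⟩
    1ℚ                                         ∎
    where
    open ≡-Reasoning
    q : ℕ
    q = product (map (λ u → suc (h u)) us)
    x r : ℚ
    x = ℤ.+ 1 / suc (h u)
    r = reciprocals us

  reciprocals-nonNegative : ∀ us → NonNegative (reciprocals us)
  reciprocals-nonNegative []       = _
  reciprocals-nonNegative (u ∷ us) =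
    nonNeg*nonNeg⇒nonNeg (ℤ.+ 1 / suc (h u)) {{1/-nonNegative (h u)}} (reciprocals us) {{reciprocals-nonNegative us}}

  module _ (us : List A) where

    private
      q : ℕ
      q = product (map (λ u → suc (h u)) us)
      instance
        nonNeg : NonNegative (reciprocals us)
        nonNeg = reciprocals-nonNegative us

    fromℕ-cancel : ∀ a → fromℕ (a ℕ.* q) * reciprocals us ≡ fromℕ a
    fromℕ-cancel a = trans (cong (_* reciprocals us) (fromℕ-* a q))
      (trans (*-assoc (fromℕ a) _ _) (trans (cong (fromℕ a *_) (reciprocals-inverse us)) (*-identityʳ _)))

    divide-≤ : ∀ {a b} → a ℕ.≤ b ℕ.* q → fromℕ a * reciprocals us ≤ fromℕ b
    divide-≤ {a} {b} a≤ = subst (fromℕ a * reciprocals us ≤_) (fromℕ-cancel b) (*-monoʳ-≤-nonNeg (reciprocals us) (fromℕ-mono-≤ a≤))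

    ≤-divide : ∀ {a b c} → a ℕ.* q ℕ.≤ b ℕ.* c → fromℕ a ≤ fromℕ b * (fromℕ c * reciprocals us)
    ≤-divide {a} {b} {c} ≤bc = subst₂ _≤_ (fromℕ-cancel a) (trans (cong (_* reciprocals us) (fromℕ-* b c)) (*-assoc (fromℕ b) _ _))
      (*-monoʳ-≤-nonNeg (reciprocals us) (fromℕ-mono-≤ ≤bc))

theorem3p3 : (S : SkewShape) → F S ≤ fromℕ (e S) × fromℕ (e S) ≤ fromℕ (ξ S) * F S
theorem3p3 S = divide-≤ h (skewCells S) {size S ℕ.!} {e S} (NaruseFormula.lower-bound S) ,
  ≤-divide h (skewCells S) {e S} {ξ S} {size S ℕ.!} (NaruseFormula.upper-bound S)
  where
  h : Cell → ℕ
  -- A hook is a successor by definition, so `suc (h u)` reduces to it.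
  h u = pred (hook (outer S) u)
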